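{- Let $G$ be a connected graph of order $n\ge 4$ and diameter $D$ with $3\le D\le n-1$. Then $\xi^c(G)\le f(n,D)$, with equality if and only if $G$ is isomorphic to a graph in the class $\mathcal{C}_n^D$, where \[ \mathcal{C}_n^D= \begin{cases} \{G_{n,3,n-4}\} & \text{if } n\in\{4,5\},\ D=3;\\ \{G_{6,3,2},H_2\} & \text{if } n=6,\ D=3;\\ \{G_{7,3,0},G_{7,3,1},G_{7,3,2},G_{7,3,3},H_3\} & \text{if } n=7,\ D=3;\\ \{G_{n,3,0}\} & \text{if } n>7,\ D=3;\\ \{G_{n,D,n-D-1}\} & \text{if } n<3(D-1),\ D\ge4;\\ \{G_{n,D,0},\ldots,G_{n,D,n-D-1}\} & \text{if } n=3(D-1),\ D\ge4;\\ \{G_{n,D,0}\} & \text{if } n>3(D-1),\ D\ge4. \end{cases} \]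
   Context: Graphs are simple, finite, undirected. For a connected graph $G=(V,E)$, $\mathrm{ecc}(v)=\max_{w\in V}\mathrm{dist}(v,w)$, the diameter is the maximum eccentricity, and $\xi^c(G)=\sum_{v\in V}\deg(v)\,\mathrm{ecc}(v)$. For integers $n\ge4$, $3\le D\le n-1$, $0\le k\le n-D-1$, the graph $G_{n,D,k}$ is constructed from a path $u_0-u_1-\cdots-u_D$ and a disjoint clique $K_{n-D-1}$ by joining every vertex of the clique to $u_0$ and $u_1$, and joining $k$ of the clique vertices to $u_2$; it has order $n$ and diameter $D$. Define $f(n,D)=\max_{0\le k\le n-D-1}\xi^c(G_{n,D,k})$. $H_2$ is the graph on $6$ vertices consisting of a path $u_0-u_1-u_2-u_3$ and two adjacent vertices $x,y$, where $x$ is adjacent to $u_0,u_1,u_2$ and $y$ is adjacent to $u_1,u_2,u_3$. $H_3$ is the graph on $7$ vertices obtained from a complete graph $K_5$ on vertices $\{1,2,3,4,5\}$ by adding a vertex $a$ adjacent to exactly $1,2,3$ and a vertex $b$ adjacent to exactly $4,5$. -}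

module Defs where

open import Data.Nat using (ℕ; zero; suc; _+_; _*_; _∸_; _≤_; _<_; _⊔_; _≡ᵇ_; _<ᵇ_; _≤ᵇ_)
open import Data.Bool using (Bool; true; false; _∧_; _∨_; not; if_then_else_)
open import Data.Bool.Properties using (∨-comm)
open import Data.Fin using (Fin; toℕ; _≟_)
open import Data.List using (List; []; _∷_; map; foldr; allFin; upTo)
open import Data.Bool.ListAction using (any)
open import Data.Nat.ListAction using (sum)
open import Data.Product using (Σ; _×_; _,_; ∃-syntax)
open import Function.Bundles using (_↔_; Inverse)
open import Relation.Nullary using (yes; no; Dec)
open import Relation.Binary.PropositionalEquality using (_≡_; refl; sym; cong)

record Graph (n : ℕ) : Set where
  field
    adj     : Fin n → Fin n → Bool
    adj-sym : ∀ u v → adj u v ≡ adj v u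
    adj-irr : ∀ v → adj v v ≡ false
open Graph public

sadj : ∀ {n} → (Fin n → Fin n → Bool) → Fin n → Fin n → Bool
sadj e u v with u ≟ v
... | yes _ = false
... | no  _ = e u v ∨ e v u

mkGraph : ∀ {n} → (Fin n → Fin n → Bool) → Graph n
mkGraph {n} e = record { adj = sadj e ; adj-sym = s ; adj-irr = i }
  where
  s : ∀ u v → sadj e u v ≡ sadj e v u
  s u v with u ≟ v | v ≟ u
  ... | yes _ | yes _ = refl
  ... | yes p | no ¬q = Data.Empty.⊥-elim (¬q (sym p))
    where import Data.Empty
  ... | no ¬p | yes q = Data.Empty.⊥-elim (¬p (sym q))
    where import Data.Empty
  ... | no _  | no _  = ∨-comm (e u v) (e v u)
  i : ∀ v → sadj e v v ≡ false
  i v with v ≟ v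
  ... | yes _ = refl
  ... | no ¬p = Data.Empty.⊥-elim (¬p refl)
    where import Data.Empty

data Walk {n : ℕ} (G : Graph n) : Fin n → Fin n → Set where
  here : ∀ {v} → Walk G v v
  step : ∀ {u v w} → adj G u v ≡ true → Walk G v w → Walk G u w

Connected : ∀ {n} → Graph n → Set
Connected {n} G = ∀ (v w : Fin n) → Walk G v w

reach : ∀ {n} → Graph n → ℕ → Fin n → Fin n → Bool
reach {n} G zero    v w with v ≟ w
... | yes _ = true
... | no  _ = false
reach {n} G (suc k) v w =
  reach G k v w ∨ any (λ u → reach G k v u ∧ adj G u w) (allFin n)

-- least k ≤ b with p k = true (returns b if there is none)
firstTrue : (ℕ → Bool) → ℕ → ℕ
firstTrue p zero    = zero
firstTrue p (suc b) = if p zero then zero else suc (firstTrue (λ k → p (suc k)) b)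

-- distance: the least length of a walk from v to w
-- (in a connected graph of order n this is < n, so the search bound n suffices)
dist : ∀ {n} → Graph n → Fin n → Fin n → ℕ
dist {n} G v w = firstTrue (λ k → reach G k v w) n

maxOver : ∀ {n} → (Fin n → ℕ) → ℕ
maxOver {n} f = foldr _⊔_ 0 (map f (allFin n))

sumOver : ∀ {n} → (Fin n → ℕ) → ℕ
sumOver {n} f = sum (map f (allFin n))

ecc : ∀ {n} → Graph n → Fin n → ℕ
ecc G v = maxOver (λ w → dist G v w)

diameter : ∀ {n} → Graph n → ℕ
diameter G = maxOver (λ v → ecc G v)

deg : ∀ {n} → Graph n → Fin n → ℕ
deg {n} G v = sumOver (λ w → if adj G v w then 1 else 0)

ξc : ∀ {n} → Graph n → ℕ
ξc G = sumOver (λ v → deg G v * ecc G v)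

_≅_ : ∀ {n m} → Graph n → Graph m → Set
_≅_ {n} {m} G H =
  Σ (Fin n ↔ Fin m) λ σ →
    ∀ u v → adj H (Inverse.to σ u) (Inverse.to σ v) ≡ adj G u v

-- The graphs G_{n,D,k}, H_2, H_3
--
-- Labelling of G_{n,D,k} on Fin n:  vertex i (0 ≤ i ≤ D) is u_i,
-- vertices D+1, …, n-1 form the clique K_{n-D-1}; the clique vertices
-- D+1, …, D+k are the k ones joined to u_2.

GEdge : ℕ → ℕ → ℕ → ℕ → Bool
GEdge D k a b =
     ((b ≡ᵇ suc a) ∧ (b ≤ᵇ D))
  ∨ ((suc D ≤ᵇ a) ∧ (suc D ≤ᵇ b))
  ∨ ((suc D ≤ᵇ a) ∧ ((b ≡ᵇ 0) ∨ (b ≡ᵇ 1)))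
  ∨ ((suc D ≤ᵇ a) ∧ (a <ᵇ suc (D + k)) ∧ (b ≡ᵇ 2))

Gnk : (n D k : ℕ) → Graph n
Gnk n D k = mkGraph (λ a b → GEdge D k (toℕ a) (toℕ b))

edgeIn : List (ℕ × ℕ) → ℕ → ℕ → Bool
edgeIn es a b = any (λ { (x , y) → (x ≡ᵇ a) ∧ (y ≡ᵇ b) }) es

-- H_2: u_0..u_3 = 0..3, x = 4, y = 5
H₂ : Graph 6
H₂ = mkGraph (λ a b → edgeIn
  ((0 , 1) ∷ (1 , 2) ∷ (2 , 3) ∷ (4 , 5) ∷
   (4 , 0) ∷ (4 , 1) ∷ (4 , 2) ∷ (5 , 1) ∷ (5 , 2) ∷ (5 , 3) ∷ []) (toℕ a) (toℕ b))

-- H_3: K_5 on 0..4 (the paper's 1..5), a = 5 adjacent to 0,1,2, b = 6 adjacent to 3,4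
H₃ : Graph 7
H₃ = mkGraph (λ a b → edgeIn
  ((0 , 1) ∷ (0 , 2) ∷ (0 , 3) ∷ (0 , 4) ∷ (1 , 2) ∷ (1 , 3) ∷ (1 , 4) ∷
   (2 , 3) ∷ (2 , 4) ∷ (3 , 4) ∷
   (5 , 0) ∷ (5 , 1) ∷ (5 , 2) ∷ (6 , 3) ∷ (6 , 4) ∷ []) (toℕ a) (toℕ b))

f : ℕ → ℕ → ℕ
f n D = foldr _⊔_ 0 (map (λ k → ξc (Gnk n D k)) (upTo (n ∸ D)))

InClass : (n D : ℕ) → Graph n → Set
InClass n D G =
     (D ≡ 3 × (n ≡ 4 ⊎ n ≡ 5) × G ≅ Gnk n 3 (n ∸ 4))
  ⊎ (D ≡ 3 × n ≡ 6 × (G ≅ Gnk 6 3 2 ⊎ G ≅ H₂))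
  ⊎ (D ≡ 3 × n ≡ 7 × ((∃[ k ] (k ≤ 3 × G ≅ Gnk 7 3 k)) ⊎ G ≅ H₃))
  ⊎ (D ≡ 3 × 7 < n × G ≅ Gnk n 3 0)
  ⊎ (4 ≤ D × n < 3 * (D ∸ 1) × G ≅ Gnk n D (n ∸ D ∸ 1))
  ⊎ (4 ≤ D × n ≡ 3 * (D ∸ 1) × ∃[ k ] (k ≤ n ∸ D ∸ 1 × G ≅ Gnk n D k))
  ⊎ (4 ≤ D × 3 * (D ∸ 1) < n × G ≅ Gnk n D 0)
  where open import Data.Sum using (_⊎_)

{-# OPTIONS --safe #-}

-- Fix a diametral path u₀ … u_D and let m be the number of vertices off it.  Writing
-- o i = max (i , D − i) ≤ ecc u_i, the index splits as
--   Σ_i deg_path(u_i) ecc(u_i) + Σ_{v off} wt v,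
--   wt v = Σ_{u_i ∼ v} ecc(u_i) + deg(v) ecc(v).
-- The neighbours of v on the path lie among three consecutive u_i.  If ecc = o along the path,
-- then wt v is at most M = max (A , B), where A and B are its values for v joined to {u₀, u₁} and
-- to {u₀, u₁, u₂} and to all other vertices off the path.
-- Eccentricities above o are paid for by the set W of vertices off the path with at most one
-- neighbour on it: all vertices farther than o i from u_i are in W, so ecc(u_i) − o i ≤ |W|,
-- which costs at most 2(D − 1)|W| along the path, while each w ∈ W falls short of M by 2D − 1,
-- and by a further D for every non-neighbour off the path.  The latter covers the only vertices
-- exceeding M: those of eccentricity D with three path neighbours exceed it by at most D, and
-- miss some w ∈ W.  Hence ξᶜ + |W| ≤ base + m M.
-- Equality forces W = ∅, a clique off the path, and every vertex off the path to be of kind A or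
-- B at one of the two ends; such graphs are determined up to isomorphism by the number of
-- vertices of each kind, and both ends occur only for D = 3 with m = 2 (H₂) or m = 3 (H₃).

module Submission where

open import Defs
open import Data.Nat
open import Data.Nat.Properties
open import Data.Nat.Tactic.RingSolver using (solve-∀)
import Data.Nat.ListAction as List
open import Data.Bool as Bool using (Bool; true; false; if_then_else_; _∧_; _∨_; not)
open import Data.Bool.ListAction using (any)
open import Data.Bool.Properties using (T-≡; ∨-comm; ∧-identityʳ; ∨-identityʳ; ∧-zeroʳ; ∨-zeroʳ)
open import Data.Empty using (⊥; ⊥-elim)
open import Data.Fin as Fin using (Fin; zero; suc; toℕ; punchIn)
open import Data.Fin.Patterns using (0F; 1F; 2F; 3F; 4F; 5F; 6F)
open import Data.Fin.Permutation using (insert; insert-punchIn; permutation)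
import Data.Fin.Properties as Fin
open import Data.List using (map; foldr; allFin; tabulate; applyUpTo)
open import Data.List.Membership.Propositional using (lose)
open import Data.List.Membership.Propositional.Properties using (∈-allFin)
open import Data.List.Properties using (map-tabulate)
import Data.List.Relation.Unary.Any as Any
open import Data.List.Relation.Unary.Any.Properties using (any⁺; any⁻)
open import Data.Product using (Σ; ∃; _×_; _,_; proj₁; proj₂)
import Data.Product.Properties as Product
open import Data.Sum using (_⊎_; inj₁; inj₂; [_,_]′)
import Data.Sum.Properties as Sum
open import Function using (_∘_; id; case_of_)
open import Function.Bundles using (_↔_; _⇔_; mk⇔; Inverse; Equivalence)
open import Relation.Binary.Definitions using (DecidableEquality; tri<; tri≈; tri>)
open import Relation.Binary.PropositionalEquality
open import Relation.Nullary using (Dec; yes; no; does; ¬_)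
open import Relation.Nullary.Decidable using (dec-true; dec-false; toWitness; _→-dec_; ¬?)
open import Algebra.Properties.CommutativeMonoid.Sum +-0-commutativeMonoid using (sum; sum-remove; sum-permute; sum-cong-≗; ∑-distrib-+; ∑-comm)

-- The many cases of the class come from a single comparison. For fixed `D` and `m` the difference
-- of `A` and `B` is `m` minus a constant, so the heavier kind changes once as `m` grows, and
-- exactly at the change the two kinds may be mixed freely. For `D ≥ 4` the constant is 2D - 4,
-- which reads n = 3(D - 1) in terms of the order. For `D = 3` it is 3 instead of 2: the value `o 2`
-- = max (2 , D - 2) is then 2 and no longer D - 2. This moves the change to n = 7, and it is also
-- what leaves room for `H₃`, whose three vertices off the path are all of kind B.

𝟙 : Bool → ℕ
𝟙 b = if b then 1 else 0

𝟙-≤1 : ∀ b → 𝟙 b ≤ 1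
𝟙-≤1 true = ≤-refl
𝟙-≤1 false = z≤n

𝟙-inj : ∀ {b c} → 𝟙 b ≡ 𝟙 c → b ≡ c
𝟙-inj {true} {true} _ = refl
𝟙-inj {false} {false} _ = refl

δ : ∀ {n} → Fin n → Fin n → ℕ
δ u v = 𝟙 (does (u Fin.≟ v))

δ-refl : ∀ {n} (u : Fin n) → δ u u ≡ 1
δ-refl u = cong 𝟙 (dec-true (u Fin.≟ u) refl)

δ-≢ : ∀ {n} {u v : Fin n} → u ≢ v → δ u v ≡ 0
δ-≢ {u = u} {v} ne = cong 𝟙 (dec-false (u Fin.≟ v) ne)

-- Finite sums over the vertices

sumOver≡sum : ∀ {n} (g : Fin n → ℕ) → sumOver g ≡ sum g
sumOver≡sum {n} g = trans (cong List.sum (map-tabulate id g)) (go g)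
  where
  go : ∀ {n} (g : Fin n → ℕ) → List.sum (tabulate g) ≡ sum g
  go {zero} g = refl
  go {suc n} g = cong (g zero +_) (go (g ∘ suc))

sum-cong : ∀ {n} {g h : Fin n → ℕ} → (∀ v → g v ≡ h v) → sum g ≡ sum h
sum-cong = sum-cong-≗

sum-mono : ∀ {n} {g h : Fin n → ℕ} → (∀ v → g v ≤ h v) → sum g ≤ sum h
sum-mono {zero} _ = z≤n
sum-mono {suc n} le = +-mono-≤ (le zero) (sum-mono (le ∘ suc))

sum-zero : ∀ {n} {g : Fin n → ℕ} → (∀ v → g v ≡ 0) → sum g ≡ 0
sum-zero {zero} _ = refl
sum-zero {suc n} z = cong₂ _+_ (z zero) (sum-zero (z ∘ suc))

sum-const : ∀ n c → sum {n} (λ _ → c) ≡ n * c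
sum-const zero c = refl
sum-const (suc n) c = cong (c +_) (sum-const n c)

sum-*ˡ : ∀ {n} c (g : Fin n → ℕ) → sum (λ v → c * g v) ≡ c * sum g
sum-*ˡ {zero} c g = sym (*-zeroʳ c)
sum-*ˡ {suc n} c g = trans (cong (c * g zero +_) (sum-*ˡ c (g ∘ suc))) (sym (*-distribˡ-+ c (g zero) _))

sum-*ʳ : ∀ {n} c (g : Fin n → ℕ) → sum (λ v → g v * c) ≡ sum g * c
sum-*ʳ c g = trans (sum-cong (λ v → *-comm (g v) c)) (trans (sum-*ˡ c g) (*-comm c _))

term≤sum : ∀ {n} (g : Fin n → ℕ) v → g v ≤ sum g
term≤sum g zero = m≤m+n _ _
term≤sum g (suc v) = ≤-trans (term≤sum (g ∘ suc) v) (m≤n+m _ _)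

two-terms≤sum : ∀ {n} (g : Fin n → ℕ) {u v} → u ≢ v → g u + g v ≤ sum g
two-terms≤sum g {zero} {zero} ne = ⊥-elim (ne refl)
two-terms≤sum g {zero} {suc v} ne = +-monoʳ-≤ (g zero) (term≤sum (g ∘ suc) v)
two-terms≤sum g {suc u} {zero} ne =
  subst (_≤ sum g) (+-comm (g zero) (g (suc u))) (+-monoʳ-≤ (g zero) (term≤sum (g ∘ suc) u))
two-terms≤sum g {suc u} {suc v} ne = ≤-trans (two-terms≤sum (g ∘ suc) (ne ∘ cong suc)) (m≤n+m _ _)

-- A term that were strictly smaller could not be made up for by the others. In this way equality in
-- a summed bound is passed on to the single vertices.
sum-tight : ∀ {n} {g h : Fin n → ℕ} → (∀ v → g v ≤ h v) → sum h ≤ sum g → ∀ v → g v ≡ h v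
sum-tight {suc n} {g} {h} le eq zero = ≤-antisym (le zero)
  (+-cancelʳ-≤ (sum (h ∘ suc)) (h zero) (g zero)
    (≤-trans eq (+-monoʳ-≤ (g zero) (sum-mono (le ∘ suc)))))
sum-tight {suc n} {g} {h} le eq (suc v) = sum-tight (le ∘ suc)
  (+-cancelˡ-≤ (h zero) _ _ (≤-trans eq (+-monoˡ-≤ _ (le zero)))) v

sum-δ : ∀ {n} (u : Fin n) (g : Fin n → ℕ) → sum (λ v → δ u v * g v) ≡ g u
sum-δ {suc n} zero g = trans (cong (g zero + 0 +_) (sum-zero {g = λ v → δ zero (suc v) * g (suc v)} λ _ → refl))
  (trans (+-identityʳ _) (+-identityʳ _))
sum-δ {suc n} (suc u) g = sum-δ u (g ∘ suc)

sum-δ₁ : ∀ {n} (u : Fin n) → sum (δ u) ≡ 1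
sum-δ₁ {n} u = trans (sum-cong {n} (λ v → sym (*-identityʳ _))) (sum-δ u (λ _ → 1))

sum>0⇒∃ : ∀ {n} (b : Fin n → Bool) → 1 ≤ sum (𝟙 ∘ b) → ∃ λ v → b v ≡ true
sum>0⇒∃ {suc n} b le with b zero in eq
... | true = zero , eq
... | false with sum>0⇒∃ (b ∘ suc) le
... | v , q = suc v , q

-- Sums over the range 0 ≤ i < N

opaque
  -- Opaque because the ranges have the form `suc D` with `D = 3 + k`: a transparent sum would
  -- unfold its first four terms during type checking.
  ∑ : ℕ → (ℕ → ℕ) → ℕ
  ∑ N g = sum {N} (g ∘ toℕ)

opaque
  unfolding ∑

  ∑-0 : ∀ g → ∑ 0 g ≡ 0
  ∑-0 g = refl

  ∑-suc : ∀ N g → ∑ (suc N) g ≡ g 0 + ∑ N (g ∘ suc)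
  ∑-suc N g = refl

  ∑-Fin : ∀ N g → ∑ N g ≡ sum {N} (g ∘ toℕ)
  ∑-Fin N g = refl

  ∑-cong : ∀ N {g h : ℕ → ℕ} → (∀ i → i < N → g i ≡ h i) → ∑ N g ≡ ∑ N h
  ∑-cong N eq = sum-cong {N} λ i → eq (toℕ i) (Fin.toℕ<n i)

  ∑-mono : ∀ N {g h : ℕ → ℕ} → (∀ i → i < N → g i ≤ h i) → ∑ N g ≤ ∑ N h
  ∑-mono N le = sum-mono {N} λ i → le (toℕ i) (Fin.toℕ<n i)

  ∑-+ : ∀ N (g h : ℕ → ℕ) → ∑ N (λ i → g i + h i) ≡ ∑ N g + ∑ N h
  ∑-+ N g h = ∑-distrib-+ {N} (g ∘ toℕ) (h ∘ toℕ)

  ∑-*ˡ : ∀ N c (g : ℕ → ℕ) → ∑ N (λ i → c * g i) ≡ c * ∑ N g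
  ∑-*ˡ N c g = sum-*ˡ {N} c (g ∘ toℕ)

  ∑-*ʳ : ∀ N c (g : ℕ → ℕ) → ∑ N (λ i → g i * c) ≡ ∑ N g * c
  ∑-*ʳ N c g = sum-*ʳ {N} c (g ∘ toℕ)

  ∑-const : ∀ N c → ∑ N (λ _ → c) ≡ N * c
  ∑-const N c = sum-const N c

  sum-∑-comm : ∀ {n} N (g : Fin n → ℕ → ℕ) → sum (λ v → ∑ N (g v)) ≡ ∑ N (λ i → sum (λ v → g v i))
  sum-∑-comm {n} N g = ∑-comm {n} {N} (λ v i → g v (toℕ i))

∑-zero : ∀ N {g : ℕ → ℕ} → (∀ i → i < N → g i ≡ 0) → ∑ N g ≡ 0
∑-zero N z = trans (∑-cong N z) (trans (∑-const N 0) (*-zeroʳ N))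

∑-split : ∀ M N (g : ℕ → ℕ) → ∑ (M + N) g ≡ ∑ M g + ∑ N (λ i → g (M + i))
∑-split zero N g = cong (_+ ∑ N g) (sym (∑-0 g))
∑-split (suc M) N g = trans (∑-suc (M + N) g) (trans (cong (g 0 +_) (∑-split M N (g ∘ suc)))
  (trans (sym (+-assoc (g 0) _ _)) (cong (_+ ∑ N (λ i → g (suc M + i))) (sym (∑-suc M g)))))

∑-1 : ∀ g → ∑ 1 g ≡ g 0
∑-1 g = trans (∑-suc 0 g) (trans (cong (g 0 +_) (∑-0 (g ∘ suc))) (+-identityʳ (g 0)))

∑-3 : ∀ g → ∑ 3 g ≡ g 0 + (g 1 + g 2)
∑-3 g = trans (∑-suc 2 g) (cong (g 0 +_) (trans (∑-suc 1 (g ∘ suc)) (cong (g 1 +_) (∑-1 (λ i → g (2 + i))))))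

-- The window `i`, `1 + i`, `2 + i` may run past `N`. The sum is therefore first lengthened by
-- `i + 3` vanishing terms, after which it contains the whole window, and then cut into the part
-- below `i`, the window and a vanishing rest.
∑-window : ∀ N i (g : ℕ → ℕ) → (∀ j → j < i → g j ≡ 0) → (∀ j → N ≤ j → g j ≡ 0) →
  (∀ j → 3 + i ≤ j → g j ≡ 0) → ∑ N g ≡ g i + g (1 + i) + g (2 + i)
∑-window N i g below beyond above = begin
  ∑ N g                                      ≡⟨ +-identityʳ _ ⟨
  ∑ N g + 0                                  ≡⟨ cong (∑ N g +_) (∑-zero (i + 3) λ j _ → beyond (N + j) (m≤m+n N j)) ⟨
  ∑ N g + ∑ (i + 3) (λ j → g (N + j))        ≡⟨ ∑-split N (i + 3) g ⟨
  ∑ (N + (i + 3)) g                          ≡⟨ cong (λ k → ∑ k g) (+-comm N (i + 3)) ⟩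
  ∑ (i + 3 + N) g                            ≡⟨ ∑-split (i + 3) N g ⟩
  ∑ (i + 3) g + ∑ N (λ j → g (i + 3 + j))    ≡⟨ cong₂ _+_ (∑-split i 3 g) (∑-zero N λ j _ → above (i + 3 + j) (subst (_≤ i + 3 + j) (+-comm i 3) (m≤m+n (i + 3) j))) ⟩
  ∑ i g + ∑ 3 (λ j → g (i + j)) + 0          ≡⟨ +-identityʳ _ ⟩
  ∑ i g + ∑ 3 (λ j → g (i + j))              ≡⟨ cong (_+ ∑ 3 (λ j → g (i + j))) (∑-zero i below) ⟩
  ∑ 3 (λ j → g (i + j))                      ≡⟨ ∑-3 (λ j → g (i + j)) ⟩
  g (i + 0) + (g (i + 1) + g (i + 2))        ≡⟨ cong₂ _+_ (cong g (+-identityʳ i)) (cong₂ _+_ (cong g (+-comm i 1)) (cong g (+-comm i 2))) ⟩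
  g i + (g (1 + i) + g (2 + i))              ≡⟨ +-assoc (g i) _ _ ⟨
  g i + g (1 + i) + g (2 + i)                ∎
  where open ≡-Reasoning

∑-last : ∀ N (g : ℕ → ℕ) → ∑ (suc N) g ≡ ∑ N g + g N
∑-last N g = trans (cong (λ k → ∑ k g) (+-comm 1 N)) (trans (∑-split N 1 g)
  (cong (∑ N g +_) (trans (∑-1 (λ i → g (N + i))) (cong g (+-identityʳ N)))))

∑-hit≤1 : ∀ k x c → ∑ k (λ s → 𝟙 (does (x ≟ c + s))) ≤ 1
∑-hit≤1 zero x c = ≤-trans (≤-reflexive (∑-0 (λ s → 𝟙 (does (x ≟ c + s))))) z≤n
∑-hit≤1 (suc k) x c = subst (_≤ 1) (sym (∑-suc k (λ s → 𝟙 (does (x ≟ c + s))))) (case x ≟ c + 0 of λ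
  { (yes p) → +-mono-≤ (𝟙-≤1 (does (x ≟ c + 0))) (≤-reflexive (∑-zero k λ s _ → cong 𝟙 (dec-false (x ≟ c + suc s)
        λ q → m+1+n≢m c (trans (sym q) (trans p (+-identityʳ c))))))
  ; (no ¬p) → +-mono-≤ (≤-reflexive (cong 𝟙 (dec-false (x ≟ c + 0) ¬p)))
        (subst (_≤ 1) (∑-cong k λ s _ → cong (λ z → 𝟙 (does (x ≟ z))) (sym (+-suc c s))) (∑-hit≤1 k x (suc c))) })

∑-hit-none : ∀ k x c → x < c → ∑ k (λ s → 𝟙 (does (x ≟ c + s))) ≡ 0
∑-hit-none k x c lt = ∑-zero k λ s _ → cong 𝟙 (dec-false (x ≟ c + s)
  λ eq → <⇒≱ lt (subst (c ≤_) (sym eq) (m≤m+n c s)))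

-- Double counting of the pairs of an index `s < k` and a vertex with label `c + s`: every `s` has
-- at least one vertex, every vertex at most one `s`, and none if its label is below `c`.
distinct-labels : ∀ {n} k c (ℓ : Fin n → ℕ) (χ : Fin n → ℕ) →
  (∀ s → s < k → ∃ λ v → ℓ v ≡ c + s) → (∀ v → c ≤ ℓ v → 1 ≤ χ v) → k ≤ sum χ
distinct-labels {n} k c ℓ χ ex hit = begin
  k                                                      ≡⟨ trans (∑-const k 1) (*-identityʳ k) ⟨
  ∑ k (λ _ → 1)                                          ≤⟨ ∑-mono k (λ s s<k → one s (ex s s<k)) ⟩
  ∑ k (λ s → sum (λ v → 𝟙 (does (ℓ v ≟ c + s))))         ≡⟨ sum-∑-comm {n} k (λ v s → 𝟙 (does (ℓ v ≟ c + s))) ⟨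
  sum (λ v → ∑ k (λ s → 𝟙 (does (ℓ v ≟ c + s))))         ≤⟨ sum-mono bound ⟩
  sum χ                                                  ∎
  where
  open ≤-Reasoning
  one : ∀ s → (∃ λ v → ℓ v ≡ c + s) → 1 ≤ sum (λ v → 𝟙 (does (ℓ v ≟ c + s)))
  one s (v , eq) = subst (_≤ sum (λ v → 𝟙 (does (ℓ v ≟ c + s)))) (cong 𝟙 (dec-true (ℓ v ≟ c + s) eq))
    (term≤sum (λ v → 𝟙 (does (ℓ v ≟ c + s))) v)
  bound : ∀ v → ∑ k (λ s → 𝟙 (does (ℓ v ≟ c + s))) ≤ χ v
  bound v with c ≤? ℓ v
  ... | yes c≤ = ≤-trans (∑-hit≤1 k (ℓ v) c) (hit v c≤)
  ... | no c≰ = subst (_≤ χ v) (sym (∑-hit-none k (ℓ v) c (≰⇒> c≰))) z≤n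

-- Maxima over the vertices, matching of colourings, bounded search

module _ where
  private
    fold-ub : ∀ {n} (g : Fin n → ℕ) v → g v ≤ foldr _⊔_ 0 (tabulate g)
    fold-ub g zero = m≤m⊔n _ _
    fold-ub g (suc v) = ≤-trans (fold-ub (g ∘ suc) v) (m≤n⊔m _ _)

    fold-lub : ∀ {n} (g : Fin n → ℕ) {b} → (∀ v → g v ≤ b) → foldr _⊔_ 0 (tabulate g) ≤ b
    fold-lub {zero} g le = z≤n
    fold-lub {suc n} g le = ⊔-lub (le zero) (fold-lub (g ∘ suc) (le ∘ suc))

    fold-att : ∀ {n} (g : Fin (suc n) → ℕ) → ∃ λ v → g v ≡ foldr _⊔_ 0 (tabulate g)
    fold-att {zero} g = zero , sym (⊔-identityʳ _)
    fold-att {suc n} g with fold-att (g ∘ suc) | ⊔-sel (g zero) (foldr _⊔_ 0 (tabulate (g ∘ suc)))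
    ... | _ | inj₁ eq = zero , sym eq
    ... | v , eq′ | inj₂ eq = suc v , trans eq′ (sym eq)

  ≤maxOver : ∀ {n} (g : Fin n → ℕ) v → g v ≤ maxOver g
  ≤maxOver {n} g v = subst (λ l → g v ≤ foldr _⊔_ 0 l) (sym (map-tabulate id g)) (fold-ub g v)

  maxOver≤ : ∀ {n} (g : Fin n → ℕ) {b} → (∀ v → g v ≤ b) → maxOver g ≤ b
  maxOver≤ {n} g {b} le = subst (λ l → foldr _⊔_ 0 l ≤ b) (sym (map-tabulate id g)) (fold-lub g le)

  maxOver-attained : ∀ {n} (g : Fin n → ℕ) → Fin n → ∃ λ v → g v ≡ maxOver g
  maxOver-attained {suc n} g _ with fold-att g
  ... | v , eq = v , trans eq (cong (foldr _⊔_ 0) (sym (map-tabulate id g)))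

-- Induction on `n`: vertex `zero` is matched with some `w` of its colour, which exists because the
-- class sizes agree; after removing both vertices the sizes still agree.
match-colours : ∀ {C : Set} (_≟_ : DecidableEquality C) n (κ κ′ : Fin n → C) →
  (∀ c → sum (λ v → 𝟙 (does (κ v ≟ c))) ≡ sum (λ v → 𝟙 (does (κ′ v ≟ c)))) →
  Σ (Fin n ↔ Fin n) λ π → ∀ v → κ′ (Inverse.to π v) ≡ κ v
match-colours _≟_ zero κ κ′ eq = permutation id id (λ ()) (λ ()) , λ ()
match-colours _≟_ (suc n) κ κ′ eq = result (match-colours _≟_ n (κ ∘ suc) (κ′ ∘ punchIn w) eq′)
  where
  c₀ = κ zero
  found : ∃ λ w → does (κ′ w ≟ c₀) ≡ true
  found = sum>0⇒∃ (λ v → does (κ′ v ≟ c₀)) (subst (1 ≤_) (eq c₀)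
    (subst (λ b → 1 ≤ 𝟙 b + sum (λ v → 𝟙 (does (κ (suc v) ≟ c₀)))) (sym (dec-true (κ zero ≟ c₀) refl)) (s≤s z≤n)))
  w = proj₁ found
  κ′w : κ′ w ≡ c₀
  κ′w with κ′ w ≟ c₀ | proj₂ found
  ... | yes p | _ = p
  eq′ : ∀ c → sum (λ v → 𝟙 (does (κ (suc v) ≟ c))) ≡ sum (λ v → 𝟙 (does (κ′ (punchIn w v) ≟ c)))
  eq′ c = +-cancelˡ-≡ (𝟙 (does (c₀ ≟ c))) _ _ (trans (eq c) (trans (sum-remove {i = w} (λ v → 𝟙 (does (κ′ v ≟ c))))
    (cong (λ z → 𝟙 (does (z ≟ c)) + sum (λ v → 𝟙 (does (κ′ (punchIn w v) ≟ c)))) κ′w)))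
  result : (Σ (Fin n ↔ Fin n) λ π → ∀ v → κ′ (punchIn w (Inverse.to π v)) ≡ κ (suc v)) →
    Σ (Fin (suc n) ↔ Fin (suc n)) λ π → ∀ v → κ′ (Inverse.to π v) ≡ κ v
  result (π , hyp) = insert zero w π , λ
    { zero → κ′w
    ; (suc v) → trans (cong κ′ (insert-punchIn zero w π v)) (hyp v) }

∑-pick : ∀ N (g : ℕ → ℕ) {l} → l < N → ∑ N (λ j → g j * 𝟙 (does (j ≟ l))) ≡ g l
∑-pick (suc N) g {zero} _ = trans (∑-suc N (λ j → g j * 𝟙 (does (j ≟ 0))))
  (trans (cong₂ _+_ (*-identityʳ (g 0)) (∑-zero N {λ j → g (suc j) * 0} λ j _ → *-zeroʳ (g (suc j)))) (+-identityʳ (g 0)))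
∑-pick (suc N) g {suc l} (s≤s lt) = trans (∑-suc N (λ j → g j * 𝟙 (does (j ≟ suc l))))
  (trans (cong (_+ ∑ N (λ j → g (suc j) * 𝟙 (does (j ≟ l)))) (*-zeroʳ (g 0))) (∑-pick N (g ∘ suc) lt))

least : (P : ℕ → Bool) → ∀ N → (∀ j → j < N → P j ≡ false) ⊎ (∃ λ i → i < N × P i ≡ true × (∀ j → j < i → P j ≡ false))
least P zero = inj₁ λ _ ()
least P (suc N) with P 0 in eq
... | true = inj₂ (0 , s≤s z≤n , eq , λ _ ())
... | false with least (P ∘ suc) N
...   | inj₁ none = inj₁ λ { zero _ → eq ; (suc j) (s≤s lt) → none j lt }
...   | inj₂ (i , lt , Pi , below) = inj₂ (suc i , s≤s lt , Pi , λ { zero _ → eq ; (suc j) (s≤s lt) → below j lt })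

-- Distances

any-allFin⁺ : ∀ {n} (p : Fin n → Bool) v → p v ≡ true → any p (allFin n) ≡ true
any-allFin⁺ p v pv = Equivalence.to T-≡ (any⁺ p (lose (∈-allFin v) (Equivalence.from T-≡ pv)))

any-allFin⁻ : ∀ {n} (p : Fin n → Bool) → any p (allFin n) ≡ true → ∃ λ v → p v ≡ true
any-allFin⁻ {n} p eq with Any.satisfied (any⁻ p (allFin n) (Equivalence.from T-≡ eq))
... | v , pv = v , Equivalence.to T-≡ pv

∧-true : ∀ {a b} → a ∧ b ≡ true → a ≡ true × b ≡ true
∧-true {true} {true} _ = refl , refl

∨-true : ∀ {a b} → a ∨ b ≡ true → a ≡ true ⊎ b ≡ true
∨-true {true} _ = inj₁ refl
∨-true {false} eq = inj₂ eq

∨-trueʳ : ∀ a {b} → b ≡ true → a ∨ b ≡ true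
∨-trueʳ true _ = refl
∨-trueʳ false eq = eq

-- Reach G k u w: some walk from u to w has length at most k.
data Reach {n} (G : Graph n) : ℕ → Fin n → Fin n → Set where
  nil  : ∀ {k u} → Reach G k u u
  cons : ∀ {k u v w} → adj G u v ≡ true → Reach G k v w → Reach G (suc k) u w

module _ {n : ℕ} {G : Graph n} where

  Reach-mono : ∀ {k l u w} → k ≤ l → Reach G k u w → Reach G l u w
  Reach-mono _ nil = nil
  Reach-mono (s≤s le) (cons e r) = cons e (Reach-mono le r)

  Reach-trans : ∀ {k l u v w} → Reach G k u v → Reach G l v w → Reach G (k + l) u w
  Reach-trans {k} {l} nil r = Reach-mono (m≤n+m l k) r
  Reach-trans (cons e q) r = cons e (Reach-trans q r)

  Reach-snoc : ∀ {k u v w} → Reach G k u v → adj G v w ≡ true → Reach G (suc k) u w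
  Reach-snoc nil e = cons e nil
  Reach-snoc (cons e′ r) e = cons e′ (Reach-snoc r e)

  Reach-sym : ∀ {k u w} → Reach G k u w → Reach G k w u
  Reach-sym nil = nil
  Reach-sym (cons {u = u} {v} e r) = Reach-snoc (Reach-sym r) (trans (adj-sym G v u) e)

  reach-refl : ∀ k u → reach G k u u ≡ true
  reach-refl zero u with u Fin.≟ u
  ... | yes _ = refl
  ... | no ¬p = ⊥-elim (¬p refl)
  reach-refl (suc k) u rewrite reach-refl k u = refl

  -- `reach` prolongs walks at their end and `Reach` at their start; prepending an edge is the step
  -- that translates the second into the first.
  reach-cons : ∀ k {u v w} → adj G u v ≡ true → reach G k v w ≡ true → reach G (suc k) u w ≡ true
  reach-cons zero {u} {v} {w} e r with v Fin.≟ w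
  ... | yes refl = ∨-trueʳ (reach G 0 u v) (any-allFin⁺ (λ x → reach G 0 u x ∧ adj G x v) u (cong₂ _∧_ (reach-refl 0 u) e))
  reach-cons (suc k) {u} {v} {w} e r with ∨-true {reach G k v w} r
  ... | inj₁ r′ = cong (_∨ any (λ x → reach G (suc k) u x ∧ adj G x w) (allFin n)) (reach-cons k e r′)
  ... | inj₂ r′ with any-allFin⁻ (λ x → reach G k v x ∧ adj G x w) r′
  ... | x , eq with ∧-true {reach G k v x} eq
  ... | p , q = ∨-trueʳ (reach G (suc k) u w)
        (any-allFin⁺ (λ x → reach G (suc k) u x ∧ adj G x w) x (cong₂ _∧_ (reach-cons k e p) q))

  Reach⇒reach : ∀ {k u w} → Reach G k u w → reach G k u w ≡ true
  Reach⇒reach {k} {u} nil = reach-refl k u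
  Reach⇒reach (cons {k} e r) = reach-cons k e (Reach⇒reach r)

  reach⇒Reach : ∀ k {u w} → reach G k u w ≡ true → Reach G k u w
  reach⇒Reach zero {u} {w} r with u Fin.≟ w
  ... | yes refl = nil
  reach⇒Reach (suc k) {u} {w} r with ∨-true {reach G k u w} r
  ... | inj₁ r′ = Reach-mono (n≤1+n k) (reach⇒Reach k r′)
  ... | inj₂ r′ with any-allFin⁻ (λ x → reach G k u x ∧ adj G x w) r′
  ... | x , eq with ∧-true {reach G k u x} eq
  ... | p , q = Reach-snoc (reach⇒Reach k p) q

firstTrue≤ : ∀ p b k → p k ≡ true → firstTrue p b ≤ k
firstTrue≤ p zero k pk = z≤n
firstTrue≤ p (suc b) k pk with p 0 in eq
... | true = z≤n
firstTrue≤ p (suc b) zero pk | false with trans (sym eq) pk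
... | ()
firstTrue≤ p (suc b) (suc k) pk | false = s≤s (firstTrue≤ (p ∘ suc) b k pk)

-- `firstTrue` answers `b` when it finds nothing, so only an answer below `b` carries information.
firstTrue-hit : ∀ p b → firstTrue p b < b → p (firstTrue p b) ≡ true
firstTrue-hit p (suc b) lt with p 0 in eq
... | true = eq
... | false = firstTrue-hit (p ∘ suc) b (s≤s⁻¹ lt)

dist≤ : ∀ {n} (G : Graph n) {k} u w → Reach G k u w → dist G u w ≤ k
dist≤ {n} G {k} u w r = firstTrue≤ (λ k → reach G k u w) n k (Reach⇒reach r)

dist-Reach : ∀ {n} (G : Graph n) {u w} → dist G u w < n → Reach G (dist G u w) u w
dist-Reach {n} G {u} {w} lt = reach⇒Reach _ (firstTrue-hit (λ k → reach G k u w) n lt)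

-- Since dist returns n when no shorter walk exists, the hypothesis makes it a metric.
module Metric {n : ℕ} (G : Graph n) (d<n : ∀ u w → dist G u w < n) where

  d : Fin n → Fin n → ℕ
  d = dist G

  geo : ∀ u w → Reach G (d u w) u w
  geo u w = dist-Reach G (d<n u w)

  d-refl : ∀ u → d u u ≡ 0
  d-refl u = n≤0⇒n≡0 (dist≤ G u u nil)

  d-sym : ∀ u w → d u w ≡ d w u
  d-sym u w = ≤-antisym (dist≤ G u w (Reach-sym (geo w u))) (dist≤ G w u (Reach-sym (geo u w)))

  d-tri : ∀ u v w → d u w ≤ d u v + d v w
  d-tri u v w = dist≤ G u w (Reach-trans (geo u v) (geo v w))

  d-adj : ∀ {u w} → adj G u w ≡ true → d u w ≤ 1
  d-adj {u} {w} e = dist≤ G u w (cons e nil)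

  d≤1⇒ : ∀ u w → d u w ≤ 1 → u ≡ w ⊎ adj G u w ≡ true
  d≤1⇒ u w le with Reach-mono le (geo u w)
  ... | nil = inj₁ refl
  ... | cons e nil = inj₂ e

  ecc-ub : ∀ u w → d u w ≤ ecc G u
  ecc-ub u = ≤maxOver (d u)

  ecc-far : ∀ u → ∃ λ w → d u w ≡ ecc G u
  ecc-far u = maxOver-attained (d u) u

  -- Constant after the end of the walk: `Reach G k` bounds the length only from above, and a total
  -- function spares comparing the position with the true length.
  along : ∀ {k u w} → Reach G k u w → ℕ → Fin n
  along {u = u} nil _ = u
  along {u = u} (cons e r) zero = u
  along (cons e r) (suc i) = along r i

  along-0 : ∀ {k u w} (r : Reach G k u w) → along r 0 ≡ u
  along-0 nil = refl
  along-0 (cons _ _) = refl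

  along-from : ∀ {k u w} (r : Reach G k u w) i → d u (along r i) ≤ i
  along-from {u = u} nil i = subst (_≤ i) (sym (d-refl u)) z≤n
  along-from {u = u} (cons e r) zero = subst (_≤ 0) (sym (d-refl u)) z≤n
  along-from {u = u} (cons {v = v} e r) (suc i) =
    ≤-trans (d-tri u v (along r i)) (+-mono-≤ (d-adj e) (along-from r i))

  along-to : ∀ {k u w} (r : Reach G k u w) i → d (along r i) w ≤ k ∸ i
  along-to {k} {u} nil i = subst (_≤ k ∸ i) (sym (d-refl u)) z≤n
  along-to {u = u} {w} (cons e r) zero = dist≤ G u w (cons e r)
  along-to (cons e r) (suc i) = along-to r i

  along-step : ∀ {k u w} (r : Reach G k u w) i → d (along r i) (along r (suc i)) ≤ 1
  along-step {u = u} nil i = subst (_≤ 1) (sym (d-refl u)) z≤n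
  along-step {u = u} (cons e r) zero = subst (λ z → d u z ≤ 1) (sym (along-0 r)) (d-adj e)
  along-step (cons e r) (suc i) = along-step r i

  -- The walk gives `d u v ≤ i` and `d v w ≤ d u w ∸ i`; the triangle inequality leaves no slack in
  -- either.
  layer : ∀ u w i → i ≤ d u w → ∃ λ v → d u v ≡ i × d v w ≡ d u w ∸ i
  layer u w i le = v , ≤-antisym (along-from (geo u w) i) lower , ≤-antisym (along-to (geo u w) i) upper
    where
    open ≤-Reasoning
    v = along (geo u w) i
    upper : d u w ∸ i ≤ d v w
    upper = begin
      d u w ∸ i           ≤⟨ ∸-monoˡ-≤ i (d-tri u v w) ⟩
      d u v + d v w ∸ i   ≤⟨ ∸-monoˡ-≤ i (+-monoˡ-≤ (d v w) (along-from (geo u w) i)) ⟩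
      i + d v w ∸ i       ≡⟨ m+n∸m≡n i (d v w) ⟩
      d v w               ∎
    lower : i ≤ d u v
    lower = +-cancelʳ-≤ (d u w ∸ i) i (d u v) (begin
      i + (d u w ∸ i)      ≡⟨ m+[n∸m]≡n le ⟩
      d u w                ≤⟨ d-tri u v w ⟩
      d u v + d v w        ≤⟨ +-monoʳ-≤ (d u v) (along-to (geo u w) i) ⟩
      d u v + (d u w ∸ i)  ∎)

  -- The stretches before `i` and after `j` have length at most `i` and `d u w ∸ j`, so a shortcut
  -- between them would shorten a geodesic.
  along-dist : ∀ u w {i j} → i ≤ j → j ≤ d u w → d (along (geo u w) i) (along (geo u w) j) ≡ j ∸ i
  along-dist u w {i} {j} i≤j j≤ = ≤-antisym (upper i j i≤j) lower
    where
    open ≤-Reasoning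
    U = along (geo u w)
    upper′ : ∀ i k → d (U i) (U (k + i)) ≤ k
    upper′ i zero = subst (_≤ 0) (sym (d-refl (U i))) z≤n
    upper′ i (suc k) = ≤-trans (d-tri (U i) (U (k + i)) (U (suc (k + i))))
      (subst (d (U i) (U (k + i)) + d (U (k + i)) (U (suc (k + i))) ≤_) (+-comm k 1)
        (+-mono-≤ (upper′ i k) (along-step (geo u w) (k + i))))
    upper : ∀ i j → i ≤ j → d (U i) (U j) ≤ j ∸ i
    upper i j i≤j = subst (λ z → d (U i) (U z) ≤ j ∸ i) (m∸n+n≡m i≤j) (upper′ i (j ∸ i))
    lower : j ∸ i ≤ d (U i) (U j)
    lower = m≤n+o⇒m∸n≤o j i (+-cancelʳ-≤ (d u w ∸ j) j (i + d (U i) (U j)) (begin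
      j + (d u w ∸ j)                          ≡⟨ m+[n∸m]≡n j≤ ⟩
      d u w                                    ≤⟨ d-tri u (U i) w ⟩
      d u (U i) + d (U i) w                    ≤⟨ +-mono-≤ (along-from (geo u w) i) (d-tri (U i) (U j) w) ⟩
      i + (d (U i) (U j) + d (U j) w)          ≤⟨ +-monoʳ-≤ i (+-monoʳ-≤ (d (U i) (U j)) (along-to (geo u w) j)) ⟩
      i + (d (U i) (U j) + (d u w ∸ j))        ≡⟨ +-assoc i _ _ ⟨
      i + d (U i) (U j) + (d u w ∸ j)          ∎))

ξc-sum : ∀ {n} (G : Graph n) → ξc G ≡ sum (λ v → sum (λ w → 𝟙 (adj G v w)) * ecc G v)
ξc-sum {n} G = trans (sumOver≡sum (λ v → deg G v * ecc G v))
  (sum-cong {n} (λ v → cong (_* ecc G v) (sumOver≡sum (λ w → 𝟙 (adj G v w)))))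

-- Invariance under isomorphism

module Iso {n : ℕ} {G H : Graph n} (iso : G ≅ H) where
  open Inverse (proj₁ iso)

  private
    pres = proj₂ iso

  Reach-to : ∀ {k u w} → Reach G k u w → Reach H k (to u) (to w)
  Reach-to nil = nil
  Reach-to (cons e r) = cons (trans (pres _ _) e) (Reach-to r)

  Reach-from : ∀ {k u w} → Reach H k u w → Reach G k (from u) (from w)
  Reach-from nil = nil
  Reach-from (cons {u = u} {v} e r) = cons
    (trans (sym (pres _ _)) (trans (cong₂ (adj H) (strictlyInverseˡ u) (strictlyInverseˡ v)) e)) (Reach-from r)

  reach-iso : ∀ k u w → reach H k (to u) (to w) ≡ reach G k u w
  reach-iso k u w with reach G k u w in eqG | reach H k (to u) (to w) in eqH
  ... | true  | true  = refl
  ... | false | false = refl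
  ... | true  | false = trans (sym eqH) (Reach⇒reach (Reach-to (reach⇒Reach k eqG)))
  ... | false | true  = trans (sym (Reach⇒reach (subst₂ (Reach G k) (strictlyInverseʳ u) (strictlyInverseʳ w)
                          (Reach-from (reach⇒Reach k eqH))))) eqG

  dist-iso : ∀ u w → dist H (to u) (to w) ≡ dist G u w
  dist-iso u w = go n (λ k → reach-iso k u w)
    where
    go : ∀ b {p q : ℕ → Bool} → (∀ k → p k ≡ q k) → firstTrue p b ≡ firstTrue q b
    go zero _ = refl
    go (suc b) {p} {q} eq rewrite eq 0 = cong (λ z → if q 0 then 0 else suc z) (go b (eq ∘ suc))

  ecc-iso : ∀ u → ecc H (to u) ≡ ecc G u
  ecc-iso u = ≤-antisym
    (maxOver≤ _ λ w → subst (_≤ ecc G u) (trans (sym (dist-iso u (from w))) (cong (dist H (to u)) (strictlyInverseˡ w)))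
      (≤maxOver (dist G u) (from w)))
    (maxOver≤ _ λ w → subst (_≤ ecc H (to u)) (dist-iso u w) (≤maxOver (dist H (to u)) (to w)))

  ξc-iso : ξc G ≡ ξc H
  ξc-iso = begin
    ξc G                                                          ≡⟨ ξc-sum G ⟩
    sum (λ v → sum (λ w → 𝟙 (adj G v w)) * ecc G v)               ≡⟨ sum-cong {n} (λ v → cong₂ _*_ (degs v) (sym (ecc-iso v))) ⟩
    sum (λ v → sum (λ w → 𝟙 (adj H (to v) w)) * ecc H (to v))     ≡⟨ sum-permute (λ v → sum (λ w → 𝟙 (adj H v w)) * ecc H v) (proj₁ iso) ⟨
    sum (λ v → sum (λ w → 𝟙 (adj H v w)) * ecc H v)               ≡⟨ ξc-sum H ⟨
    ξc H                                                          ∎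
    where
    open ≡-Reasoning
    degs : ∀ v → sum (λ w → 𝟙 (adj G v w)) ≡ sum (λ w → 𝟙 (adj H (to v) w))
    degs v = trans (sum-cong {n} (λ w → cong 𝟙 (sym (pres v w))))
      (sym (sum-permute (λ w → 𝟙 (adj H (to v) w)) (proj₁ iso)))

-- Splitting the index along a path

module Decomposition {n : ℕ} (G : Graph n) (D : ℕ) (U : ℕ → Fin n)
  (U-inj : ∀ {i j} → i ≤ D → j ≤ D → U i ≡ U j → i ≡ j) where

  a : Fin n → Fin n → ℕ
  a u v = 𝟙 (adj G u v)

  a-sym : ∀ u v → a u v ≡ a v u
  a-sym u v = cong 𝟙 (adj-sym G u v)

  OnP : Fin n → Set
  OnP v = ∃ λ (i : Fin (suc D)) → U (toℕ i) ≡ v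

  Off : Fin n → Set
  Off v = ¬ OnP v

  opaque
    -- Opaque so that `ō` stays folded and the search over `Fin (suc D)` is not run on open terms.
    onP? : ∀ v → Dec (OnP v)
    onP? v = Fin.any? λ i → U (toℕ i) Fin.≟ v

  onP : ∀ {i} → i ≤ D → OnP (U i)
  onP i≤D = Fin.fromℕ< (s≤s i≤D) , cong U (Fin.toℕ-fromℕ< (s≤s i≤D))

  off≢ : ∀ {i v} → i ≤ D → Off v → U i ≢ v
  off≢ i≤D off refl = off (onP i≤D)

  ō : Fin n → ℕ
  ō v = 𝟙 (not (does (onP? v)))

  ō-off : ∀ {v} → Off v → ō v ≡ 1
  ō-off {v} off = cong (𝟙 ∘ not) (dec-false (onP? v) off)

  ō-on : ∀ {v} → OnP v → ō v ≡ 0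
  ō-on {v} on = cong (𝟙 ∘ not) (dec-true (onP? v) on)

  sumO : (Fin n → ℕ) → ℕ
  sumO g = sum (λ v → ō v * g v)

  m : ℕ
  m = sumO (λ _ → 1)

  ō-pointwise : ∀ {_∼_ : ℕ → ℕ → Set} → (0 ∼ 0) → ∀ {g h : Fin n → ℕ} → (∀ v → Off v → g v ∼ h v) →
    ∀ v → (ō v * g v) ∼ (ō v * h v)
  ō-pointwise {_∼_} z le v with onP? v
  ... | yes _ = z
  ... | no off = subst₂ _∼_ (sym (+-identityʳ _)) (sym (+-identityʳ _)) (le v off)

  sumO-mono : ∀ {g h} → (∀ v → Off v → g v ≤ h v) → sumO g ≤ sumO h
  sumO-mono le = sum-mono {n} (ō-pointwise {_≤_} z≤n le)

  sumO-cong : ∀ {g h} → (∀ v → Off v → g v ≡ h v) → sumO g ≡ sumO h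
  sumO-cong eq = sum-cong {n} (ō-pointwise {_≡_} refl eq)

  sumO-+ : ∀ g h → sumO (λ v → g v + h v) ≡ sumO g + sumO h
  sumO-+ g h = trans (sum-cong {n} (λ v → *-distribˡ-+ (ō v) (g v) (h v))) (∑-distrib-+ (λ v → ō v * g v) (λ v → ō v * h v))

  sumO-*ˡ : ∀ c g → sumO (λ v → c * g v) ≡ c * sumO g
  sumO-*ˡ c g = trans (sum-cong {n} (λ v → x∙yz (ō v) c (g v))) (sum-*ˡ {n} c (λ v → ō v * g v))
    where
    x∙yz : ∀ x y z → x * (y * z) ≡ y * (x * z)
    x∙yz = solve-∀

  sumO-const : ∀ c → sumO (λ _ → c) ≡ m * c
  sumO-const c = trans (sumO-cong (λ _ _ → sym (*-identityʳ c))) (trans (sumO-*ˡ c (λ _ → 1)) (*-comm c m))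

  term≤sumO : ∀ g {v} → Off v → g v ≤ sumO g
  term≤sumO g {v} off = subst (_≤ sumO g) (trans (cong (_* g v) (ō-off off)) (+-identityʳ _)) (term≤sum {n} (λ v → ō v * g v) v)

  two-terms≤sumO : ∀ g {u v} → Off u → Off v → u ≢ v → g u + g v ≤ sumO g
  two-terms≤sumO g {u} {v} offu offv ne = subst (_≤ sumO g)
    (cong₂ _+_ (trans (cong (_* g u) (ō-off offu)) (+-identityʳ _)) (trans (cong (_* g v) (ō-off offv)) (+-identityʳ _)))
    (two-terms≤sum {n} (λ v → ō v * g v) ne)

  sumO-tight : ∀ {g h} → (∀ v → Off v → g v ≤ h v) → sumO h ≤ sumO g → ∀ v → Off v → g v ≡ h v
  sumO-tight {g} {h} le eq v off = subst₂ _≡_ (one (g v)) (one (h v))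
    (sum-tight {n} (ō-pointwise {_≤_} z≤n le) eq v)
    where
    one : ∀ x → ō v * x ≡ x
    one x = trans (cong (_* x) (ō-off off)) (+-identityʳ x)

  private
    -- A partition of unity: since `U` is injective, a path vertex is hit by one index only.
    -- Multiplying a summand by this 1 gives `split`.
    hits : ∀ v → ∑ (suc D) (λ i → δ (U i) v) + ō v ≡ 1
    hits v with onP? v
    ... | yes (j , refl) = trans (+-identityʳ _) (trans (∑-Fin (suc D) (λ i → δ (U i) (U (toℕ j)))) (trans (sum-cong {suc D} eq) (sum-δ₁ j)))
      where
      eq : ∀ i → δ (U (toℕ i)) (U (toℕ j)) ≡ δ j i
      eq i with i Fin.≟ j
      ... | yes refl = trans (δ-refl (U (toℕ i))) (sym (δ-refl i))
      ... | no i≢j = trans (δ-≢ (λ e → i≢j (Fin.toℕ-injective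
              (U-inj (s≤s⁻¹ (Fin.toℕ<n i)) (s≤s⁻¹ (Fin.toℕ<n j)) e)))) (sym (δ-≢ (i≢j ∘ sym)))
    ... | no off = cong (_+ 1) (∑-zero (suc D) λ i i≤D → δ-≢ (off≢ (s≤s⁻¹ i≤D) off))

  split : ∀ g → sum g ≡ ∑ (suc D) (g ∘ U) + sumO g
  split g = begin
    sum g
      ≡⟨ sum-cong {n} (λ v → trans (sym (+-identityʳ (g v))) (trans (cong (_* g v) (sym (hits v))) (*-distribʳ-+ (g v) (∑ (suc D) (λ i → δ (U i) v)) (ō v)))) ⟩
    sum (λ v → ∑ (suc D) (λ i → δ (U i) v) * g v + ō v * g v)
      ≡⟨ ∑-distrib-+ (λ v → ∑ (suc D) (λ i → δ (U i) v) * g v) (λ v → ō v * g v) ⟩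
    sum (λ v → ∑ (suc D) (λ i → δ (U i) v) * g v) + sumO g
      ≡⟨ cong (_+ sumO g) (sum-cong {n} (λ v → ∑-*ʳ (suc D) (g v) (λ i → δ (U i) v))) ⟨
    sum (λ v → ∑ (suc D) (λ i → δ (U i) v * g v)) + sumO g
      ≡⟨ cong (_+ sumO g) (sum-∑-comm {n} (suc D) (λ v i → δ (U i) v * g v)) ⟩
    ∑ (suc D) (λ i → sum (λ v → δ (U i) v * g v)) + sumO g
      ≡⟨ cong (_+ sumO g) (∑-cong (suc D) (λ i _ → sum-δ (U i) g)) ⟩
    ∑ (suc D) (g ∘ U) + sumO g ∎
    where open ≡-Reasoning

  n≡ : n ≡ suc D + m
  n≡ = trans (sym (trans (sum-const n 1) (*-identityʳ n))) (trans (split (λ _ → 1))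
    (cong (_+ m) (trans (∑-const (suc D) 1) (*-identityʳ (suc D)))))

  sumO-∑-comm : ∀ N (g : Fin n → ℕ → ℕ) → ∑ N (λ i → sumO (λ v → g v i)) ≡ sumO (λ v → ∑ N (g v))
  sumO-∑-comm N g = trans (sym (sum-∑-comm {n} N (λ v i → ō v * g v i)))
    (sum-cong {n} (λ v → ∑-*ˡ N (ō v) (g v)))

  p s dout wt : Fin n → ℕ
  p v = ∑ (suc D) (λ i → a v (U i))
  s v = ∑ (suc D) (λ i → a v (U i) * ecc G (U i))
  dout v = sumO (a v)
  wt v = s v + (p v + dout v) * ecc G v

  dp : ℕ → ℕ
  dp i = p (U i)

  -- An edge between `U i` and a vertex `v` off the path contributes `ecc G (U i)` through the
  -- degree of `U i`. The step `cross` charges this to `v`, as `s v`, so that only the degrees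
  -- within the path remain on the path.
  decomposition : ξc G ≡ ∑ (suc D) (λ i → dp i * ecc G (U i)) + sumO wt
  decomposition = begin
    ξc G
      ≡⟨ ξc-sum G ⟩
    sum (λ v → sum (a v) * E v)
      ≡⟨ sum-cong {n} (λ v → cong (_* E v) (split (a v))) ⟩
    sum (λ v → (p v + dout v) * E v)
      ≡⟨ split (λ v → (p v + dout v) * E v) ⟩
    ∑ (suc D) (λ i → (dp i + dout (U i)) * E (U i)) + sumO own
      ≡⟨ cong (_+ sumO own) (trans (∑-cong (suc D) (λ i _ → *-distribʳ-+ (E (U i)) (dp i) (dout (U i))))
           (∑-+ (suc D) (λ i → dp i * E (U i)) (λ i → dout (U i) * E (U i)))) ⟩
    ∑ (suc D) (λ i → dp i * E (U i)) + ∑ (suc D) (λ i → dout (U i) * E (U i)) + sumO own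
      ≡⟨ cong (λ z → ∑ (suc D) (λ i → dp i * E (U i)) + z + sumO own) cross ⟩
    ∑ (suc D) (λ i → dp i * E (U i)) + sumO s + sumO own
      ≡⟨ +-assoc (∑ (suc D) (λ i → dp i * E (U i))) _ _ ⟩
    ∑ (suc D) (λ i → dp i * E (U i)) + (sumO s + sumO own)
      ≡⟨ cong (∑ (suc D) (λ i → dp i * E (U i)) +_) (sumO-+ s own) ⟨
    ∑ (suc D) (λ i → dp i * E (U i)) + sumO wt ∎
    where
    open ≡-Reasoning
    E = ecc G
    own : Fin n → ℕ
    own v = (p v + dout v) * E v
    cross : ∑ (suc D) (λ i → dout (U i) * E (U i)) ≡ sumO s
    cross = trans (∑-cong (suc D) λ i _ → trans (sym (sum-*ʳ {n} (E (U i)) (λ v → ō v * a (U i) v)))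
        (sum-cong {n} λ v → trans (*-assoc (ō v) _ _) (cong (λ z → ō v * (z * E (U i))) (a-sym (U i) v))))
      (sumO-∑-comm (suc D) (λ v i → a v (U i) * E (U i)))

-- Degrees and eccentricities within a path

consec : ℕ → ℕ → Bool
consec i j = (i ≡ᵇ suc j) ∨ (suc i ≡ᵇ j)

pathEcc : ℕ → ℕ → ℕ
pathEcc D i = i ⊔ (D ∸ i)

pathDeg : ℕ → ℕ → ℕ
pathDeg D i = ∑ (suc D) (λ j → 𝟙 (consec i j))

base : ℕ → ℕ
base D = ∑ (suc D) (λ i → pathDeg D i * pathEcc D i)

-- With D = 3 + k and m vertices off the path: the weight of a clique vertex of G_{n,D,k′} not joined (A) or joined (B) to u₂.
valA valB valM : ℕ → ℕ → ℕ
valA k m = (2 + k) + (3 + k) * (m + 2)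
valB k m = (2 + k) * (m + 2) + (pathEcc (3 + k) 0 + pathEcc (3 + k) 1 + pathEcc (3 + k) 2)
valM k m = valA k m ⊔ valB k m

≡ᵇ-true : ∀ {i j} → i ≡ j → (i ≡ᵇ j) ≡ true
≡ᵇ-true {i} {j} eq = Equivalence.to T-≡ (≡⇒≡ᵇ i j eq)

≡ᵇ-true⁻ : ∀ i j → (i ≡ᵇ j) ≡ true → i ≡ j
≡ᵇ-true⁻ i j eq = ≡ᵇ⇒≡ i j (Equivalence.from T-≡ eq)

≡ᵇ-sym : ∀ i j → (i ≡ᵇ j) ≡ (j ≡ᵇ i)
≡ᵇ-sym zero zero = refl
≡ᵇ-sym zero (suc j) = refl
≡ᵇ-sym (suc i) zero = refl
≡ᵇ-sym (suc i) (suc j) = ≡ᵇ-sym i j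

consec⁺ˡ : ∀ {i j} → i ≡ suc j → consec i j ≡ true
consec⁺ˡ {i} {j} eq = cong (_∨ (suc i ≡ᵇ j)) (≡ᵇ-true eq)

consec⁺ʳ : ∀ {i j} → suc i ≡ j → consec i j ≡ true
consec⁺ʳ {i} {j} eq = ∨-trueʳ (i ≡ᵇ suc j) (≡ᵇ-true eq)

consec⁻ : ∀ i j → consec i j ≡ true → i ≡ suc j ⊎ suc i ≡ j
consec⁻ i j eq with ∨-true {i ≡ᵇ suc j} eq
... | inj₁ e = inj₁ (≡ᵇ-true⁻ i (suc j) e)
... | inj₂ e = inj₂ (≡ᵇ-true⁻ (suc i) j e)

⇔-≡ : ∀ {b c : Bool} → (b ≡ true → c ≡ true) → (c ≡ true → b ≡ true) → b ≡ c
⇔-≡ {true} {c} f _ = sym (f refl)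
⇔-≡ {false} {false} _ _ = refl
⇔-≡ {false} {true} _ g = g refl

pathDeg≤2 : ∀ D i → pathDeg D i ≤ 2
pathDeg≤2 D i = begin
  ∑ (suc D) (λ j → 𝟙 (consec i j))                              ≤⟨ ∑-mono (suc D) (λ j _ → 𝟙-∨ (i ≡ᵇ suc j) (suc i ≡ᵇ j)) ⟩
  ∑ (suc D) (λ j → 𝟙 (i ≡ᵇ suc j) + 𝟙 (suc i ≡ᵇ j))             ≡⟨ ∑-+ (suc D) (λ j → 𝟙 (i ≡ᵇ suc j)) (λ j → 𝟙 (suc i ≡ᵇ j)) ⟩
  ∑ (suc D) (λ j → 𝟙 (i ≡ᵇ suc j)) + ∑ (suc D) (λ j → 𝟙 (suc i ≡ᵇ j)) ≤⟨ +-mono-≤ (∑-hit≤1 (suc D) i 1) (∑-hit≤1 (suc D) (suc i) 0) ⟩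
  2 ∎
  where
  open ≤-Reasoning
  𝟙-∨ : ∀ b c → 𝟙 (b ∨ c) ≤ 𝟙 b + 𝟙 c
  𝟙-∨ true c = s≤s z≤n
  𝟙-∨ false c = ≤-refl

module PathEcc (k : ℕ) where
  D = 3 + k
  D₁ = 2 + k
  o : ℕ → ℕ
  o = pathEcc D

  o≤D : ∀ {i} → i ≤ D → o i ≤ D
  o≤D {i} i≤D = ⊔-lub i≤D (m∸n≤m D i)

  o-mid : ∀ {i} → 1 ≤ i → i < D → o i ≤ D₁
  o-mid {suc i} _ (s≤s i<) = ⊔-lub i< (m∸n≤m D₁ i)

  o-mid₂ : ∀ {i} → 2 ≤ i → 2 + i ≤ D → o i ≤ 1 + k
  o-mid₂ {suc (suc i)} (s≤s (s≤s _)) (s≤s (s≤s i≤)) = ⊔-lub i≤ (m∸n≤m (1 + k) i)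

  o≥2 : ∀ i → 2 ≤ o i
  o≥2 zero = s≤s (s≤s z≤n)
  o≥2 (suc zero) = s≤s (s≤s z≤n)
  o≥2 (suc (suc i)) = ≤-trans (s≤s (s≤s z≤n)) (m≤m⊔n (2 + i) (1 + k ∸ i))

  -- Since `D ≥ 3`, two indices at most two apart are not both ends, and an inner index has `o` at
  -- most `D₁`.
  o-pair : ∀ {i j} → i < j → j ≤ 2 + i → j ≤ D → o i + o j ≤ D₁ + D
  o-pair {zero} {j} i<j j≤ j≤D = subst (_≤ D₁ + D) (+-comm (o j) D)
    (+-monoˡ-≤ D (o-mid i<j (≤-trans (s≤s j≤) (s≤s (s≤s (s≤s z≤n))))))
  o-pair {suc i} {j} i<j j≤ j≤D = +-mono-≤ (o-mid (s≤s z≤n) (≤-trans i<j j≤D)) (o≤D j≤D)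

  -- Away from the ends the values are at most `D₁`, `1 + k` and `D₁`, with sum one below
  -- `D + D₁ + (1 + k)`. The strictness is what later drives vertices of kind B to the ends.
  o-triple-mid : ∀ {i} → 1 ≤ i → 2 + i < D → o i + o (1 + i) + o (2 + i) < o 0 + o 1 + o 2
  o-triple-mid {i} 1≤i lt = ≤-trans
    (s≤s (+-mono-≤ (+-mono-≤ (o-mid 1≤i (<⇒≤ (<⇒≤ lt))) (o-mid₂ (s≤s 1≤i) lt)) (o-mid (s≤s z≤n) lt)))
    (subst (_≤ D + D₁ + o 2) (eq k) (+-monoʳ-≤ (D + D₁) (m≤n⊔m 2 (1 + k))))
    where
    eq : ∀ k → 3 + k + (2 + k) + (1 + k) ≡ 1 + (2 + k + (1 + k) + (2 + k))
    eq = solve-∀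

  o-triple-end : ∀ {i} → 2 + i ≡ D → o i + o (1 + i) + o (2 + i) ≡ o 0 + o 1 + o 2
  o-triple-end refl = begin
    ((1 + k) ⊔ (2 + k ∸ k)) + ((2 + k) ⊔ (1 + k ∸ k)) + ((3 + k) ⊔ (k ∸ k))
      ≡⟨ cong₂ _+_ (cong₂ _+_ (cong ((1 + k) ⊔_) (m+n∸n≡m 2 k)) (cong ((2 + k) ⊔_) (m+n∸n≡m 1 k))) (cong ((3 + k) ⊔_) (n∸n≡0 k)) ⟩
    ((1 + k) ⊔ 2) + ((2 + k) ⊔ 1) + (3 + k)
      ≡⟨ cong₂ (λ x y → x + y + (3 + k)) (⊔-comm (1 + k) 2) (⊔-comm (2 + k) 1) ⟩
    (2 ⊔ (1 + k)) + (2 + k) + (3 + k)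
      ≡⟨ eq (2 ⊔ (1 + k)) (2 + k) (3 + k) ⟩
    (3 + k) + (2 + k) + (2 ⊔ (1 + k)) ∎
    where
    open ≡-Reasoning
    eq : ∀ x y z → x + y + z ≡ z + y + x
    eq = solve-∀

  o-triple-cases : ∀ i → 2 + i ≤ D → (i ≡ 0 ⊎ 2 + i ≡ D) ⊎ (o i + o (1 + i) + o (2 + i) < o 0 + o 1 + o 2)
  o-triple-cases zero _ = inj₁ (inj₁ refl)
  o-triple-cases (suc i) le with m≤n⇒m<n∨m≡n le
  ... | inj₁ lt = inj₂ (o-triple-mid (s≤s z≤n) lt)
  ... | inj₂ eq = inj₁ (inj₂ eq)

  o-triple : ∀ {i} → 2 + i ≤ D → o i + o (1 + i) + o (2 + i) ≤ o 0 + o 1 + o 2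
  o-triple {i} le with o-triple-cases i le
  ... | inj₁ (inj₁ refl) = ≤-refl
  ... | inj₁ (inj₂ eq) = ≤-reflexive (o-triple-end eq)
  ... | inj₂ lt = <⇒≤ lt

-- The upper bound

module UpperBound {n : ℕ} (G : Graph n) (k : ℕ) (d<n : ∀ u w → dist G u w < n)
  (ecc≤D : ∀ v → ecc G v ≤ 3 + k) (U : ℕ → Fin n)
  (U-dist : ∀ {i j} → i ≤ j → j ≤ 3 + k → dist G (U i) (U j) ≡ j ∸ i) where

  open PathEcc k public
  open Metric G d<n public

  U-inj : ∀ {i j} → i ≤ D → j ≤ D → U i ≡ U j → i ≡ j
  U-inj {i} {j} i≤D j≤D eq with ≤-total i j
  ... | inj₁ i≤j = ≤-antisym i≤j (m∸n≡0⇒m≤n (trans (sym (U-dist i≤j j≤D)) (trans (cong (d (U i)) (sym eq)) (d-refl (U i)))))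
  ... | inj₂ j≤i = ≤-antisym (m∸n≡0⇒m≤n (trans (sym (U-dist j≤i i≤D)) (trans (cong (d (U j)) eq) (d-refl (U j))))) j≤i

  open Decomposition G D U U-inj public

  E : Fin n → ℕ
  E = ecc G

  d-U≤o : ∀ {i j} → i ≤ D → j ≤ D → d (U i) (U j) ≤ o i
  d-U≤o {i} {j} i≤D j≤D with ≤-total i j
  ... | inj₁ i≤j = subst (_≤ o i) (sym (U-dist i≤j j≤D)) (≤-trans (∸-monoˡ-≤ i j≤D) (m≤n⊔m i (D ∸ i)))
  ... | inj₂ j≤i = subst (_≤ o i) (sym (trans (d-sym (U i) (U j)) (U-dist j≤i i≤D))) (≤-trans (m∸n≤m i j) (m≤m⊔n i (D ∸ i)))

  o≤E : ∀ {i} → i ≤ D → o i ≤ E (U i)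
  o≤E {i} i≤D = ⊔-lub
    (subst (_≤ E (U i)) (trans (d-sym (U i) (U 0)) (U-dist z≤n i≤D)) (ecc-ub (U i) (U 0)))
    (subst (_≤ E (U i)) (U-dist i≤D ≤-refl) (ecc-ub (U i) (U D)))

  nbr-gap : ∀ {v i j} → adj G v (U i) ≡ true → adj G v (U j) ≡ true → i ≤ j → j ≤ D → j ≤ 2 + i
  nbr-gap {v} {i} {j} ei ej i≤j j≤D = begin
    j                                  ≡⟨ m∸n+n≡m i≤j ⟨
    j ∸ i + i                          ≡⟨ cong (_+ i) (U-dist i≤j j≤D) ⟨
    d (U i) (U j) + i                  ≤⟨ +-monoˡ-≤ i (d-tri (U i) v (U j)) ⟩
    d (U i) v + d v (U j) + i          ≤⟨ +-monoˡ-≤ i (+-mono-≤ (subst (_≤ 1) (d-sym v (U i)) (d-adj ei)) (d-adj ej)) ⟩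
    2 + i                              ∎
    where open ≤-Reasoning

  -- A shortest path has no chords: an edge bounds the distance, which is the difference of the
  -- indices, by one.
  adj-U : ∀ {i j} → i ≤ D → j ≤ D → adj G (U i) (U j) ≡ consec i j
  adj-U {i} {j} i≤D j≤D = ⇔-≡ (λ e → [ (λ i≤j → up i≤j j≤D e) , (λ j≤i → trans (consec-sym i j) (up j≤i i≤D (trans (adj-sym G (U j) (U i)) e))) ]′ (≤-total i j))
    λ c → [ (λ { refl → trans (adj-sym G (U i) (U j)) (next i≤D) }) , (λ { refl → next j≤D }) ]′ (consec⁻ i j c)
    where
    consec-sym : ∀ i j → consec i j ≡ consec j i
    consec-sym i j = trans (∨-comm (i ≡ᵇ suc j) (suc i ≡ᵇ j)) (cong₂ _∨_ (≡ᵇ-sym (suc i) j) (≡ᵇ-sym i (suc j)))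
    up : ∀ {i j} → i ≤ j → j ≤ D → adj G (U i) (U j) ≡ true → consec i j ≡ true
    up {i} {j} i≤j j≤D e with m≤n⇒m<n∨m≡n i≤j
    ... | inj₂ refl with trans (sym e) (adj-irr G (U i))
    ...   | ()
    up {i} {j} i≤j j≤D e | inj₁ i<j = consec⁺ʳ (≤-antisym i<j (subst (_≤ 1 + i) (m∸n+n≡m i≤j)
      (+-monoˡ-≤ i (subst (_≤ 1) (U-dist i≤j j≤D) (d-adj e)))))
    next : ∀ {i} → suc i ≤ D → adj G (U i) (U (suc i)) ≡ true
    next {i} i<D with d≤1⇒ (U i) (U (suc i)) (≤-reflexive (trans (U-dist (n≤1+n i) i<D) (m+n∸n≡m 1 i)))
    ... | inj₂ e = e
    ... | inj₁ eq = ⊥-elim (1+n≢n (sym (U-inj (<⇒≤ i<D) i<D eq)))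

  dp≡ : ∀ {i} → i ≤ D → dp i ≡ pathDeg D i
  dp≡ {i} i≤D = ∑-cong (suc D) λ j j≤D → cong 𝟙 (adj-U i≤D (s≤s⁻¹ j≤D))

  -- The two ends are `D ≥ 3` apart, so by `nbr-gap` no vertex is adjacent to both.
  ends⇒few : ∀ w → (∀ j → j ≤ D → adj G w (U j) ≡ true → j ≡ 0 ⊎ j ≡ D) → p w ≤ 1
  ends⇒few w ends = [ via 0 , via D ]′ (side (adj G w (U 0)) refl)
    where
    bound : ∀ c j → (adj G w (U j) ≡ true → j ≡ c) → a w (U j) ≤ 𝟙 (does (c ≟ j))
    bound c j h with adj G w (U j)
    ... | false = z≤n
    ... | true = ≤-reflexive (sym (cong 𝟙 (dec-true (c ≟ j) (sym (h refl)))))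
    via : ∀ c → (∀ j → j ≤ D → adj G w (U j) ≡ true → j ≡ c) → p w ≤ 1
    via c h = ≤-trans (∑-mono (suc D) λ j j≤D → bound c j (h j (s≤s⁻¹ j≤D))) (∑-hit≤1 (suc D) c 0)
    side : ∀ b → adj G w (U 0) ≡ b →
      (∀ j → j ≤ D → adj G w (U j) ≡ true → j ≡ 0) ⊎ (∀ j → j ≤ D → adj G w (U j) ≡ true → j ≡ D)
    side true e₀ = inj₁ λ j j≤D e → case ends j j≤D e of λ
      { (inj₁ eq) → eq
      ; (inj₂ refl) → case nbr-gap e₀ e z≤n j≤D of λ { (s≤s (s≤s ())) } }
    side false e₀ = inj₂ λ j j≤D e → case ends j j≤D e of λ
      { (inj₂ eq) → eq
      ; (inj₁ refl) → case trans (sym e) e₀ of λ () }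

  onP-cases : ∀ {P : Fin n → Set} → (∀ j → j ≤ D → P (U j)) → (∀ v → Off v → P v) → ∀ v → P v
  onP-cases {P} on off v with onP? v
  ... | yes (j , eq) = subst P eq (on (toℕ j) (s≤s⁻¹ (Fin.toℕ<n j)))
  ... | no ¬p = off v ¬p

  d-Off : ∀ {v c} → (∀ j → j ≤ D → d v (U j) ≤ c) → ∀ w → c < d v w → Off w
  d-Off {v} {c} le w lt (j , refl) = <⇒≱ lt (le (toℕ j) (s≤s⁻¹ (Fin.toℕ<n j)))

  beyond-Off : ∀ {i} z → i ≤ D → o i < d (U i) z → Off z
  beyond-Off z i≤D = d-Off (λ j j≤D → d-U≤o i≤D j≤D) z

  -- If `z` is adjacent to `U j`, then `U j` is at distance at least `o i` from `U i`; on the path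
  -- only an end is that far away, and `ends⇒few` applies.
  beyond-few : ∀ {i} z → i ≤ D → o i < d (U i) z → p z ≤ 1
  beyond-few {i} z i≤D lt = ends⇒few z λ j j≤D e → ends j j≤D (s≤s⁻¹ (≤-trans lt (≤-trans (d-tri (U i) (U j) z)
    (subst (d (U i) (U j) + d (U j) z ≤_) (+-comm (d (U i) (U j)) 1) (+-monoʳ-≤ _ (subst (_≤ 1) (d-sym z (U j)) (d-adj e)))))))
    where
    ends : ∀ j → j ≤ D → o i ≤ d (U i) (U j) → j ≡ 0 ⊎ j ≡ D
    ends j j≤D le with ≤-total i j
    ... | inj₁ i≤j = inj₂ (≤-antisym j≤D (subst₂ _≤_ (m∸n+n≡m i≤D) (m∸n+n≡m i≤j)
          (+-monoˡ-≤ i (≤-trans (m≤n⊔m i (D ∸ i)) (subst (o i ≤_) (U-dist i≤j j≤D) le)))))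
    ... | inj₂ j≤i = inj₁ (n≤0⇒n≡0 (+-cancelˡ-≤ (i ∸ j) j 0 (subst₂ _≤_ (sym (m∸n+n≡m j≤i)) (sym (+-identityʳ (i ∸ j)))
          (≤-trans (m≤m⊔n i (D ∸ i)) (subst (o i ≤_) (trans (d-sym (U i) (U j)) (U-dist j≤i i≤D)) le)))))

  -- The indicator of W.
  ω : Fin n → ℕ
  ω v = 𝟙 (p v ≤ᵇ 1)

  ω-few : ∀ {v} → p v ≤ 1 → ω v ≡ 1
  ω-few le = cong 𝟙 (Equivalence.to T-≡ (≤⇒≤ᵇ le))

  ω-many : ∀ {v} → 2 ≤ p v → ω v ≡ 0
  ω-many {v} le with p v ≤ᵇ 1 in eq
  ... | false = refl
  ... | true = ⊥-elim (<⇒≱ le (≤ᵇ⇒≤ (p v) 1 (Equivalence.from T-≡ eq)))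

  #W : ℕ
  #W = sumO ω

  -- A geodesic from `U i` to a farthest vertex meets every distance from `suc (o i)` to `E (U i)`.
  -- The vertices it has there belong to `W`, and their distances serve as distinct labels.
  excess≤#W : ∀ {i} → i ≤ D → E (U i) ≤ o i + #W
  excess≤#W {i} i≤D = ≤-trans (m≤n+m∸n (E (U i)) (o i)) (+-monoʳ-≤ (o i) (distinct-labels (E (U i) ∸ o i) (suc (o i)) (d (U i)) (λ v → ō v * ω v) layers
      λ v lt → ≤-reflexive (sym (cong₂ _*_ (ō-off (beyond-Off v i≤D lt)) (ω-few {v} (beyond-few v i≤D lt))))))
    where
    layers : ∀ s → s < E (U i) ∸ o i → ∃ λ v → d (U i) v ≡ suc (o i) + s
    layers s s< with ecc-far (U i)
    ... | w , eq with layer (U i) w (suc (o i) + s) (subst (suc (o i) + s ≤_) (sym eq)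
                        (subst₂ _≤_ (+-suc (o i) s) (m+[n∸m]≡n (o≤E i≤D)) (+-monoʳ-≤ (o i) s<)))
    ...   | v , dv , _ = v , dv

  -- The ends have `o i ≡ D`, which no eccentricity exceeds, so only the `D₁` inner vertices can
  -- have an excess, each with path degree at most two.
  path-part : ∑ (suc D) (λ i → dp i * E (U i)) ≤ base D + D₁ * (2 * #W)
  path-part = begin
    ∑ (suc D) g                                            ≡⟨ trans (∑-suc D g) (cong (g 0 +_) (∑-last D₁ (g ∘ suc))) ⟩
    g 0 + (∑ D₁ (g ∘ suc) + g D)                           ≤⟨ +-mono-≤ (end z≤n refl) (+-mono-≤ (∑-mono D₁ mid) (end ≤-refl oD)) ⟩
    h 0 + (∑ D₁ (λ i → h (suc i) + 2 * #W) + h D)          ≡⟨ cong (λ z → h 0 + (z + h D)) (trans (∑-+ D₁ (h ∘ suc) (λ _ → 2 * #W)) (cong (∑ D₁ (h ∘ suc) +_) (∑-const D₁ (2 * #W)))) ⟩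
    h 0 + (∑ D₁ (h ∘ suc) + D₁ * (2 * #W) + h D)           ≡⟨ rearrange (h 0) (∑ D₁ (h ∘ suc)) (D₁ * (2 * #W)) (h D) ⟩
    h 0 + (∑ D₁ (h ∘ suc) + h D) + D₁ * (2 * #W)           ≡⟨ cong (_+ D₁ * (2 * #W)) (trans (∑-suc D h) (cong (h 0 +_) (∑-last D₁ (h ∘ suc)))) ⟨
    base D + D₁ * (2 * #W)                                 ∎
    where
    open ≤-Reasoning
    g h : ℕ → ℕ
    g i = dp i * E (U i)
    h i = pathDeg D i * o i
    oD : o D ≡ D
    oD = m≥n⇒m⊔n≡m (m∸n≤m D D)
    rearrange : ∀ x y z w → x + (y + z + w) ≡ x + (y + w) + z
    rearrange = solve-∀
    end : ∀ {i} → i ≤ D → o i ≡ D → g i ≤ h i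
    end {i} i≤D eq = *-mono-≤ (≤-reflexive (dp≡ i≤D)) (subst (E (U i) ≤_) (sym eq) (ecc≤D (U i)))
    mid : ∀ i → i < D₁ → g (suc i) ≤ h (suc i) + 2 * #W
    mid i i< = begin
      dp (suc i) * E (U (suc i))                               ≤⟨ *-mono-≤ (≤-reflexive (dp≡ {suc i} si≤)) (excess≤#W {suc i} si≤) ⟩
      pathDeg D (suc i) * (o (suc i) + #W)                     ≡⟨ *-distribˡ-+ (pathDeg D (suc i)) (o (suc i)) #W ⟩
      h (suc i) + pathDeg D (suc i) * #W                       ≤⟨ +-monoʳ-≤ (h (suc i)) (*-monoˡ-≤ #W (pathDeg≤2 D (suc i))) ⟩
      h (suc i) + 2 * #W                                       ∎
      where
      si≤ : suc i ≤ D
      si≤ = s≤s (<⇒≤ i<)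

  -- The neighbours of v on the path lie in a window of three consecutive vertices.
  data View (v : Fin n) : Set where
    few    : p v ≤ 1 → View v
    -- The neighbours are recorded as a summation identity for every `h`: the constant 1 gives
    -- `p v`, `E ∘ U` gives `s v`, and the indicator of an index gives back an adjacency.
    pair   : ∀ i j → i < j → j ≤ 2 + i → j ≤ D →
             (∀ (h : ℕ → ℕ) → ∑ (suc D) (λ l → a v (U l) * h l) ≡ h i + h j) → View v
    triple : ∀ i → 2 + i ≤ D →
             (∀ (h : ℕ → ℕ) → ∑ (suc D) (λ l → a v (U l) * h l) ≡ h i + h (1 + i) + h (2 + i)) → View v

  view : ∀ v → View v
  view v with least (λ j → adj G v (U j)) (suc D)
  ... | inj₁ none = few (subst (_≤ 1) (sym (∑-zero (suc D) {λ j → a v (U j)} λ j lt → cong 𝟙 (none j lt))) z≤n)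
  ... | inj₂ (i , s≤s i≤D , ei , below) = result (b (1 + i)) (b (2 + i)) refl refl
    where
    -- Nothing is known about `U` beyond `D`, but the window above `i` may reach there; the bit is
    -- cut off at `D`.
    b : ℕ → Bool
    b j = (j ≤ᵇ D) ∧ adj G v (U j)
    b-in : ∀ {j} → j ≤ D → b j ≡ adj G v (U j)
    b-in {j} j≤D = cong (_∧ adj G v (U j)) (Equivalence.to T-≡ (≤⇒≤ᵇ j≤D))
    b-true : ∀ {j} → b j ≡ true → j ≤ D × adj G v (U j) ≡ true
    b-true {j} e = ≤ᵇ⇒≤ j D (Equivalence.from T-≡ (proj₁ (∧-true e))) , proj₂ (∧-true {j ≤ᵇ D} e)
    b-false : ∀ {j} → ¬ (b j ≡ true) → b j ≡ false
    b-false {j} h with b j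
    ... | true = ⊥-elim (h refl)
    ... | false = refl
    windowed : ∀ (h : ℕ → ℕ) → ∑ (suc D) (λ l → a v (U l) * h l) ≡ h i + 𝟙 (b (1 + i)) * h (1 + i) + 𝟙 (b (2 + i)) * h (2 + i)
    windowed h = trans (∑-cong (suc D) λ j j≤D → cong (λ z → 𝟙 z * h j) (sym (b-in (s≤s⁻¹ j≤D))))
      (trans (∑-window (suc D) i (λ j → 𝟙 (b j) * h j)
          (λ j j<i → cong (λ z → 𝟙 z * h j) (trans (b-in (≤-trans (<⇒≤ j<i) i≤D)) (below j j<i)))
          (λ j D<j → cong (λ z → 𝟙 z * h j) (b-false λ e → <⇒≱ D<j (proj₁ (b-true e))))
          (λ j far → cong (λ z → 𝟙 z * h j) (b-false λ e → <⇒≱ far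
             (nbr-gap ei (proj₂ (b-true e)) (≤-trans (m≤n+m i 3) far) (proj₁ (b-true e))))))
        (cong (λ z → z + 𝟙 (b (1 + i)) * h (1 + i) + 𝟙 (b (2 + i)) * h (2 + i))
          (trans (cong (λ z → 𝟙 z * h i) (trans (b-in i≤D) ei)) (+-identityʳ (h i)))))
    with-bits : ∀ {c₁ c₂} → b (1 + i) ≡ c₁ → b (2 + i) ≡ c₂ →
      ∀ (h : ℕ → ℕ) → ∑ (suc D) (λ l → a v (U l) * h l) ≡ h i + 𝟙 c₁ * h (1 + i) + 𝟙 c₂ * h (2 + i)
    with-bits refl refl = windowed
    result : ∀ c₁ c₂ → b (1 + i) ≡ c₁ → b (2 + i) ≡ c₂ → View v
    result true true e₁ e₂ = triple i (proj₁ (b-true e₂))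
      λ h → trans (with-bits e₁ e₂ h) (cong₂ _+_ (cong (h i +_) (+-identityʳ _)) (+-identityʳ _))
    result true false e₁ e₂ = pair i (1 + i) ≤-refl (n≤1+n _) (proj₁ (b-true e₁))
      λ h → trans (with-bits e₁ e₂ h) (trans (+-identityʳ _) (cong (h i +_) (+-identityʳ _)))
    result false true e₁ e₂ = pair i (2 + i) (n≤1+n _) ≤-refl (proj₁ (b-true e₂))
      λ h → trans (with-bits e₁ e₂ h) (cong₂ _+_ (+-identityʳ (h i)) (+-identityʳ (h (2 + i))))
    result false false e₁ e₂ = few (≤-reflexive (trans (sym (∑-cong (suc D) λ j _ → *-identityʳ (a v (U j)))) (with-bits e₁ e₂ (λ _ → 1))))

  bit : ∀ v {l} → l ≤ D → ∑ (suc D) (λ j → a v (U j) * 𝟙 (does (j ≟ l))) ≡ a v (U l)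
  bit v l≤D = ∑-pick (suc D) (λ j → a v (U j)) (s≤s l≤D)

  p-sum : ∀ v → ∑ (suc D) (λ l → a v (U l) * 1) ≡ p v
  p-sum v = ∑-cong (suc D) λ j _ → *-identityʳ (a v (U j))

  private
    hit : ∀ l → 𝟙 (does (l ≟ l)) ≡ 1
    hit l = cong 𝟙 (dec-true (l ≟ l) refl)

    a≥1⇒adj : ∀ {u v} → 1 ≤ a u v → adj G u v ≡ true
    a≥1⇒adj {u} {v} le with adj G u v
    ... | true = refl

  pair-adj : ∀ {v i j} → i ≤ D → j ≤ D → (∀ (h : ℕ → ℕ) → ∑ (suc D) (λ l → a v (U l) * h l) ≡ h i + h j) →
    adj G v (U i) ≡ true × adj G v (U j) ≡ true
  pair-adj {v} {i} {j} i≤D j≤D id₂ =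
    a≥1⇒adj (subst (1 ≤_) (trans (sym (id₂ _)) (bit v i≤D)) (≤-trans (≤-reflexive (sym (hit i))) (m≤m+n _ _))) ,
    a≥1⇒adj (subst (1 ≤_) (trans (sym (id₂ _)) (bit v j≤D)) (≤-trans (≤-reflexive (sym (hit j))) (m≤n+m _ _)))

  triple-adj : ∀ {v i} → 2 + i ≤ D → (∀ (h : ℕ → ℕ) → ∑ (suc D) (λ l → a v (U l) * h l) ≡ h i + h (1 + i) + h (2 + i)) →
    adj G v (U i) ≡ true × adj G v (U (1 + i)) ≡ true × adj G v (U (2 + i)) ≡ true
  triple-adj {v} {i} le id₃ =
    a≥1⇒adj (subst (1 ≤_) (trans (sym (id₃ _)) (bit v i≤D)) (≤-trans (≤-reflexive (sym (hit i))) (≤-trans (m≤m+n _ _) (m≤m+n _ _)))) ,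
    a≥1⇒adj (subst (1 ≤_) (trans (sym (id₃ _)) (bit v (<⇒≤ le))) (≤-trans (≤-reflexive (sym (hit (1 + i)))) (≤-trans (m≤n+m _ (𝟙 (does (i ≟ 1 + i)))) (m≤m+n _ _)))) ,
    a≥1⇒adj (subst (1 ≤_) (trans (sym (id₃ _)) (bit v le)) (≤-trans (≤-reflexive (sym (hit (2 + i)))) (m≤n+m _ _)))
    where
    i≤D : i ≤ D
    i≤D = <⇒≤ (<⇒≤ le)

  N : Fin n → Fin n → ℕ
  N v w = 𝟙 (not (does (v Fin.≟ w)) ∧ not (adj G v w))

  N-sym : ∀ v w → N v w ≡ N w v
  N-sym v w = cong₂ (λ x y → 𝟙 (not x ∧ not y)) (≟-sym v w) (adj-sym G v w)
    where
    ≟-sym : ∀ (v w : Fin n) → does (v Fin.≟ w) ≡ does (w Fin.≟ v)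
    ≟-sym v w with v Fin.≟ w
    ... | yes refl = sym (dec-true (v Fin.≟ v) refl)
    ... | no ne = sym (dec-false (w Fin.≟ v) (ne ∘ sym))

  far⇒N : ∀ {v w} → 2 ≤ d v w → N v w ≡ 1
  far⇒N {v} {w} far with v Fin.≟ w
  ... | yes refl = ⊥-elim (<⇒≱ far (≤-trans (≤-reflexive (d-refl v)) z≤n))
  ... | no _ with adj G v w in e
  ...   | true = ⊥-elim (<⇒≱ far (d-adj e))
  ...   | false = refl

  -- x v counts the non-neighbours of v off the path, y v those among them that lie in W.
  x y : Fin n → ℕ
  x v = sumO (N v)
  y v = sumO (λ w → ω w * N v w)

  dout+x : ∀ {v} → Off v → dout v + x v + 1 ≡ m
  dout+x {v} off = begin
    dout v + x v + 1                      ≡⟨ cong₂ _+_ (sumO-+ (a v) (N v)) (trans (sum-cong {n} (λ w → *-comm (ō w) (δ v w))) (trans (sum-δ v ō) (ō-off off))) ⟨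
    sumO (λ w → a v w + N v w) + sumO (δ v) ≡⟨ sumO-+ (λ w → a v w + N v w) (δ v) ⟨
    sumO (λ w → a v w + N v w + δ v w)    ≡⟨ sumO-cong (λ w _ → one w) ⟩
    m                                     ∎
    where
    open ≡-Reasoning
    one : ∀ w → a v w + N v w + δ v w ≡ 1
    one w with v Fin.≟ w
    ... | yes refl rewrite adj-irr G v = refl
    ... | no _ with adj G v w
    ...   | true = refl
    ...   | false = refl

  far⇒x≥1 : ∀ {v w} → Off w → 2 ≤ d v w → 1 ≤ x v
  far⇒x≥1 {v} {w} off far = subst (_≤ x v) (far⇒N far) (term≤sumO (N v) off)

  x≡0⇒close : ∀ {v} → x v ≡ 0 → ∀ {w} → Off w → d v w ≤ 1
  x≡0⇒close {v} x0 {w} off with d v w ≤? 1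
  ... | yes le = le
  ... | no nle with subst (1 ≤_) x0 (far⇒x≥1 off (≰⇒> nle))
  ...   | ()

  -- Through `v` every vertex off the path is within distance two of `U j`, and `o j` is at least
  -- two.
  x≡0⇒E≤o : ∀ {v j} → x v ≡ 0 → j ≤ D → adj G v (U j) ≡ true → E (U j) ≤ o j
  x≡0⇒E≤o {v} {j} x0 j≤D e with ecc-far (U j)
  ... | w , eq = subst (_≤ o j) eq (onP-cases {λ w → d (U j) w ≤ o j} (λ l → d-U≤o j≤D)
        (λ w off → ≤-trans (d-tri (U j) v w) (≤-trans (+-mono-≤ (subst (_≤ 1) (d-sym v (U j)) (d-adj e)) (x≡0⇒close x0 off)) (o≥2 j))) w)

  cases-x : ∀ v → Off v → (x v ≡ 0 × 1 + dout v ≡ m) ⊎ (1 ≤ x v × 2 + dout v ≤ m)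
  cases-x v off with x v in eq | dout+x off
  ... | zero | e = inj₁ (refl , trans (+-comm 1 (dout v)) (trans (cong (_+ 1) (sym (+-identityʳ (dout v)))) e))
  ... | suc z | e = inj₂ (s≤s z≤n , subst (2 + dout v ≤_) (trans (arith (dout v) z) e) (m≤m+n (2 + dout v) z))
    where
    arith : ∀ q z → 2 + q + z ≡ q + suc z + 1
    arith = solve-∀

  d-via : ∀ {v i} j → adj G v (U i) ≡ true → d v (U j) ≤ 1 + d (U i) (U j)
  d-via {v} {i} j e = ≤-trans (d-tri v (U i) (U j)) (+-monoˡ-≤ _ (d-adj e))

  d-left : ∀ {v i j} → adj G v (U i) ≡ true → j ≤ i → i ≤ D → d v (U j) ≤ 1 + (i ∸ j)
  d-left {v} {i} {j} e j≤i i≤D = subst (λ z → d v (U j) ≤ 1 + z) (trans (d-sym (U i) (U j)) (U-dist j≤i i≤D)) (d-via j e)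

  d-right : ∀ {v i j} → adj G v (U i) ≡ true → i ≤ j → j ≤ D → d v (U j) ≤ 1 + (j ∸ i)
  d-right {v} {i} {j} e i≤j j≤D = subst (λ z → d v (U j) ≤ 1 + z) (U-dist i≤j j≤D) (d-via j e)

  -- If v is adjacent to both U i and U (2 + i), it behaves like a twin of U (1 + i).
  module Twin {v : Fin n} {i : ℕ} (i≤ : 2 + i ≤ D) (eᵢ : adj G v (U i) ≡ true) (e₂ : adj G v (U (2 + i)) ≡ true) where

    private
      i≤1+k : i ≤ 1 + k
      i≤1+k = s≤s⁻¹ (s≤s⁻¹ i≤)

    twin-cases : ∀ j → j ≤ i ⊎ j ≡ 1 + i ⊎ 2 + i ≤ j
    twin-cases j with j ≤? i
    ... | yes le = inj₁ le
    ... | no nle with m≤n⇒m<n∨m≡n (≰⇒> nle)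
    ...   | inj₁ lt = inj₂ (inj₂ lt)
    ...   | inj₂ eq = inj₂ (inj₁ (sym eq))

    twin-d≤D₁ : ∀ j → j ≤ D → d v (U j) ≤ D₁
    twin-d≤D₁ j j≤D with twin-cases j
    ... | inj₁ j≤i = ≤-trans (d-left eᵢ j≤i (≤-trans (m≤n+m i 2) i≤)) (s≤s (≤-trans (m∸n≤m i j) i≤1+k))
    ... | inj₂ (inj₁ refl) = ≤-trans (d-right eᵢ (n≤1+n i) j≤D) (s≤s (≤-trans (≤-reflexive (m+n∸n≡m 1 i)) (s≤s z≤n)))
    ... | inj₂ (inj₂ le) = ≤-trans (d-right e₂ le j≤D) (s≤s (≤-trans (∸-monoˡ-≤ (2 + i) j≤D) (m∸n≤m (1 + k) i)))

    -- To the left the distance is at most `1 + (i ∸ j)` with `i ≤ 1 + k`, so `D₁` is reached at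
    -- index 0 only; the right side is symmetric. The second components say that this end lies
    -- outside the triple, so that the neighbour of `v` on that side is an inner vertex of the path.
    twin-far⇒end : adj G v (U (1 + i)) ≡ true → ∀ j → j ≤ D → D₁ ≤ d v (U j) → (j ≡ 0 × 1 ≤ i) ⊎ (j ≡ D × 2 + i < D)
    twin-far⇒end e₁ j j≤D far with twin-cases j
    ... | inj₁ j≤i = inj₁ (n≤0⇒n≡0 (+-cancelˡ-≤ (i ∸ j) j 0 (subst₂ _≤_ (sym (m∸n+n≡m j≤i)) (sym (+-identityʳ _)) (≤-trans i≤1+k 1+k≤))) , ≤-trans (s≤s z≤n) (≤-trans 1+k≤ (m∸n≤m i j)))
      where
      1+k≤ : 1 + k ≤ i ∸ j
      1+k≤ = s≤s⁻¹ (≤-trans far (d-left eᵢ j≤i (≤-trans (m≤n+m i 2) i≤)))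
    ... | inj₂ (inj₁ refl) with ≤-trans far (d-adj e₁)
    ...   | s≤s ()
    twin-far⇒end e₁ j j≤D far | inj₂ (inj₂ le) = inj₂ (≤-antisym j≤D D≤j , ≰⇒> λ D≤ → absurd D≤)
      where
      1+k≤ : 1 + k ≤ j ∸ (2 + i)
      1+k≤ = s≤s⁻¹ (≤-trans far (d-right e₂ le j≤D))
      D≤j : D ≤ j
      D≤j = begin
        2 + (1 + k)              ≤⟨ +-monoʳ-≤ 2 1+k≤ ⟩
        2 + (j ∸ (2 + i))        ≤⟨ +-monoˡ-≤ _ (m≤m+n 2 i) ⟩
        2 + i + (j ∸ (2 + i))    ≡⟨ m+[n∸m]≡n le ⟩
        j                        ∎
        where open ≤-Reasoning
      absurd : D ≤ 2 + i → ⊥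
      absurd D≤ with ≤-trans 1+k≤ (≤-reflexive (m≤n⇒m∸n≡0 (≤-trans j≤D D≤)))
      ... | ()

  A B M : ℕ
  A = valA k m
  B = valB k m
  M = valM k m

  A≤M : A ≤ M
  A≤M = m≤m⊔n A B

  B≤M : B ≤ M
  B≤M = m≤n⊔m A B

  penalty : ℕ
  penalty = D₁ + D

  -- The weight is at most `D` for the path neighbour plus `(1 + dout v) * D`. As `m` equals
  -- `dout v + x v + 1`, what is missing to `A` is exactly `D₁ + D + D * x v`.
  few-bound : ∀ {v} → Off v → p v ≤ 1 → wt v + (penalty + D * x v) ≤ A
  few-bound {v} off p≤1 = begin
    s v + (p v + dout v) * E v + (penalty + D * x v)
      ≤⟨ +-monoˡ-≤ _ (+-mono-≤ (≤-trans s≤ (*-monoˡ-≤ D p≤1)) (*-mono-≤ (+-monoˡ-≤ (dout v) p≤1) (ecc≤D v))) ⟩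
    1 * D + (1 + dout v) * D + (penalty + D * x v)
      ≡⟨ arith D D₁ (dout v) (x v) ⟩
    D₁ + D * (dout v + x v + 1 + 2)
      ≡⟨ cong (λ z → D₁ + D * (z + 2)) (dout+x off) ⟩
    A ∎
    where
    open ≤-Reasoning
    s≤ : s v ≤ p v * D
    s≤ = subst (s v ≤_) (∑-*ʳ (suc D) D (λ i → a v (U i))) (∑-mono (suc D) λ i _ → *-monoʳ-≤ (a v (U i)) (ecc≤D (U i)))
    arith : ∀ D D₁ q x → 1 * D + (1 + q) * D + (D₁ + D + D * x) ≡ D₁ + D * (q + x + 1 + 2)
    arith = solve-∀

  wt-pair : ∀ {v i j} → (∀ (h : ℕ → ℕ) → ∑ (suc D) (λ l → a v (U l) * h l) ≡ h i + h j) →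
    wt v ≡ E (U i) + E (U j) + (2 + dout v) * E v
  wt-pair {v} id₂ = cong₂ (λ x y → x + (y + dout v) * E v) (id₂ (E ∘ U)) (trans (sym (p-sum v)) (id₂ (λ _ → 1)))

  wt-triple : ∀ {v i} → (∀ (h : ℕ → ℕ) → ∑ (suc D) (λ l → a v (U l) * h l) ≡ h i + h (1 + i) + h (2 + i)) →
    wt v ≡ E (U i) + E (U (1 + i)) + E (U (2 + i)) + (3 + dout v) * E v
  wt-triple {v} id₃ = cong₂ (λ x y → x + (y + dout v) * E v) (id₃ (E ∘ U)) (trans (sym (p-sum v)) (id₃ (λ _ → 1)))

  A-form : D₁ + D + (1 + m) * D ≡ A
  A-form = arith D D₁ m
    where
    arith : ∀ D D₁ m → D₁ + D + (1 + m) * D ≡ D₁ + D * (m + 2)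
    arith = solve-∀

  B-form : o 0 + o 1 + o 2 + (2 + m) * D₁ ≡ B
  B-form = arith D₁ m (o 0 + o 1 + o 2)
    where
    arith : ∀ D₁ m s → s + (2 + m) * D₁ ≡ D₁ * (m + 2) + s
    arith = solve-∀

  -- If `v` is adjacent to all other vertices off the path, the path neighbours have eccentricity
  -- `o`. Otherwise the lost degree saves `D`, more than is lost by bounding both eccentricities by
  -- `D`.
  pair-bound : ∀ {v i j} → Off v → i < j → j ≤ 2 + i → j ≤ D →
    (∀ (h : ℕ → ℕ) → ∑ (suc D) (λ l → a v (U l) * h l) ≡ h i + h j) → wt v ≤ A
  pair-bound {v} {i} {j} off i<j j≤2+i j≤D id₂ with cases-x v off
  ... | inj₁ (x0 , eq) = begin
    wt v                                          ≡⟨ wt-pair id₂ ⟩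
    E (U i) + E (U j) + (1 + (1 + dout v)) * E v  ≤⟨ +-mono-≤ (+-mono-≤ (x≡0⇒E≤o x0 i≤D (proj₁ es)) (x≡0⇒E≤o x0 j≤D (proj₂ es)))
                                                       (*-mono-≤ (≤-reflexive (cong suc eq)) (ecc≤D v)) ⟩
    o i + o j + (1 + m) * D                       ≤⟨ +-monoˡ-≤ _ (o-pair i<j j≤2+i j≤D) ⟩
    D₁ + D + (1 + m) * D                          ≡⟨ A-form ⟩
    A                                             ∎
    where
    open ≤-Reasoning
    i≤D = ≤-trans (<⇒≤ i<j) j≤D
    es = pair-adj i≤D j≤D id₂
  ... | inj₂ (_ , le) = begin
    wt v                                      ≡⟨ wt-pair id₂ ⟩
    E (U i) + E (U j) + (2 + dout v) * E v    ≤⟨ +-mono-≤ (+-mono-≤ (ecc≤D (U i)) (ecc≤D (U j))) (*-mono-≤ le (ecc≤D v)) ⟩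
    D + D + m * D                             ≤⟨ m≤n+m _ D₁ ⟩
    D₁ + (D + D + m * D)                      ≡⟨ arith D D₁ m ⟩
    A                                         ∎
    where
    open ≤-Reasoning
    arith : ∀ D D₁ m → D₁ + (D + D + m * D) ≡ D₁ + D * (m + 2)
    arith = solve-∀

  module Triple {v : Fin n} {i : ℕ} (off : Off v) (i≤ : 2 + i ≤ D)
    (id₃ : ∀ (h : ℕ → ℕ) → ∑ (suc D) (λ l → a v (U l) * h l) ≡ h i + h (1 + i) + h (2 + i)) where

    private
      e₀ = proj₁ (triple-adj i≤ id₃)
      e₁ = proj₁ (proj₂ (triple-adj i≤ id₃))
      e₂ = proj₂ (proj₂ (triple-adj i≤ id₃))
    open Twin i≤ e₀ e₂

    i≤D : i ≤ D
    i≤D = ≤-trans (m≤n+m i 2) i≤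

    far-off : ∀ {w} → d v w ≡ D → Off w
    far-off {w} far = d-Off twin-d≤D₁ w (≤-reflexive (sym far))

    -- A path neighbour of `w` is at distance at least `D₁` from `v`, hence an end of the path.
    far-few : ∀ {w} → d v w ≡ D → p w ≤ 1
    far-few {w} far = ends⇒few w λ j j≤D e → [ inj₁ ∘ proj₁ , inj₂ ∘ proj₁ ]′
      (twin-far⇒end e₁ j j≤D (s≤s⁻¹ (≤-trans (≤-reflexive (sym far)) (≤-trans (d-tri v (U j) w)
        (subst (d v (U j) + d (U j) w ≤_) (+-comm (d v (U j)) 1) (+-monoʳ-≤ _ (subst (_≤ 1) (d-sym w (U j)) (d-adj e))))))))

    far-N : ∀ {w} → d v w ≡ D → N v w ≡ 1
    far-N far = far⇒N (≤-trans (s≤s (s≤s z≤n)) (≤-reflexive (sym far)))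

    far-y : ∀ {w} → d v w ≡ D → 1 ≤ y v
    far-y {w} far = subst (_≤ y v) (cong₂ _*_ (ω-few {w} (far-few far)) (far-N far)) (term≤sumO (λ w → ω w * N v w) (far-off far))

    -- A middle neighbour of v of eccentricity D, but not because of w, yields a second non-neighbour of v.
    second : ∀ {w l} → Off w → N v w ≡ 1 → 1 ≤ l → l < D → adj G v (U l) ≡ true → d (U l) w ≤ D₁ → E (U l) ≤ D₁ ⊎ 2 ≤ x v
    second {w} {l} offw Nw 1≤l l<D e near with E (U l) ≤? D₁
    ... | yes le = inj₁ le
    ... | no nle with ecc-far (U l)
    ...   | z , eq = inj₂ (subst₂ (λ b c → b + c ≤ x v) Nw (far⇒N z-far) (two-terms≤sumO (N v) offw offz w≢z))
      where
      D≤ : D ≤ d (U l) z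
      D≤ = ≤-trans (≰⇒> nle) (≤-reflexive (sym eq))
      offz : Off z
      offz = beyond-Off z (<⇒≤ l<D) (≤-trans (s≤s (o-mid 1≤l l<D)) D≤)
      w≢z : w ≢ z
      w≢z refl = <⇒≱ D≤ near
      z-far : 2 ≤ d v z
      z-far = s≤s⁻¹ (≤-trans (s≤s (s≤s (s≤s z≤n))) (≤-trans D≤ (≤-trans (d-tri (U l) v z) (+-monoˡ-≤ _ (subst (_≤ 1) (d-sym v (U l)) (d-adj e))))))

    S : ℕ
    S = E (U i) + E (U (1 + i)) + E (U (2 + i))

    S≤3D : S ≤ D + D + D
    S≤3D = +-mono-≤ (+-mono-≤ (ecc≤D _) (ecc≤D _)) (ecc≤D _)

    -- Let `z` be the last vertex but one on a geodesic from `v` to `w`. Off the path it is itself a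
    -- second non-neighbour. On the path it is an end outside the triple; the outermost neighbour of
    -- `v` on that side is then within `D₁` of `w`, and `second` applies to it.
    far-cases : ∀ {w} → d v w ≡ D → S ≤ D + D + D₁ ⊎ 2 ≤ x v
    far-cases {w} far with layer v w D₁ (≤-trans (n≤1+n D₁) (≤-reflexive (sym far)))
    ... | z , dz , dzw with onP? z
    ...   | no offz = inj₂ (subst₂ (λ b c → b + c ≤ x v) (far-N far) (far⇒N (≤-trans (s≤s (s≤s z≤n)) (≤-reflexive (sym dz))))
              (two-terms≤sumO (N v) (far-off far) offz λ { refl → 1+n≢n (trans (sym far) dz) }))
    ...   | yes (j , refl) = case twin-far⇒end e₁ (toℕ j) (s≤s⁻¹ (Fin.toℕ<n j)) (≤-reflexive (sym dz)) of λ
      { (inj₁ (j0 , 1≤i)) → case second (far-off far) (far-N far) 1≤i (≤-trans (n≤1+n _) i≤) e₀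
            (≤-trans (step-to i j0) (s≤s (≤-trans (≤-reflexive (trans (d-sym (U i) (U 0)) (U-dist z≤n i≤D))) (s≤s⁻¹ (s≤s⁻¹ i≤))))) of λ
          { (inj₁ le) → inj₁ (≤-trans (+-mono-≤ (+-mono-≤ le (ecc≤D _)) (ecc≤D _)) (≤-reflexive (rot D₁ D)))
          ; (inj₂ le) → inj₂ le }
      ; (inj₂ (jD , lt)) → case second (far-off far) (far-N far) (s≤s z≤n) lt e₂
            (≤-trans (step-to (2 + i) jD) (s≤s (≤-trans (≤-reflexive (U-dist i≤ ≤-refl)) (m∸n≤m (1 + k) i)))) of λ
          { (inj₁ le) → inj₁ (+-mono-≤ (+-mono-≤ (ecc≤D _) (ecc≤D _)) le)
          ; (inj₂ le) → inj₂ le } }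
      where
      rot : ∀ x y → x + y + y ≡ y + y + x
      rot = solve-∀
      adjacent : d (U (toℕ j)) w ≡ 1
      adjacent = trans dzw (trans (cong (_∸ D₁) far) (m+n∸n≡m 1 D₁))
      step-to : ∀ l {c} → toℕ j ≡ c → d (U l) w ≤ 1 + d (U l) (U c)
      step-to l refl = ≤-trans (d-tri (U l) (U (toℕ j)) w) (≤-reflexive (trans (cong (d (U l) (U (toℕ j)) +_) adjacent) (+-comm _ 1)))

    -- A vertex at distance `D` makes `y v` positive, so an excess of `D` over `A` is allowed. One
    -- non-neighbour together with `S ≤ D + D + D` would give one too much; either alternative of
    -- `far-cases` saves that one.
    bound-D : E v ≡ D → wt v ≤ A + D * y v
    bound-D eq with ecc-far v
    ... | w , dw = ≤-trans inner (+-monoʳ-≤ A (subst (_≤ D * y v) (*-identityʳ D) (*-monoʳ-≤ D (far-y far))))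
      where
      far : d v w ≡ D
      far = trans dw eq
      open ≤-Reasoning
      arith₁ : ∀ D D₁ m → D + D + D₁ + (1 + m) * D ≡ D₁ + D * (m + 2) + D
      arith₁ = solve-∀
      arith₂ : ∀ D D₁ m → D₁ + (D + D + D + m * D) ≡ D₁ + D * (m + 2) + D
      arith₂ = solve-∀
      arith₃ : ∀ q x → 3 + q + x ≡ q + (2 + x) + 1
      arith₃ = solve-∀
      3+dout≤m : 2 ≤ x v → 3 + dout v ≤ m
      3+dout≤m 2≤x = begin
        3 + dout v                     ≤⟨ m≤m+n _ (x v ∸ 2) ⟩
        3 + dout v + (x v ∸ 2)         ≡⟨ arith₃ (dout v) (x v ∸ 2) ⟩
        dout v + (2 + (x v ∸ 2)) + 1   ≡⟨ cong (λ z → dout v + z + 1) (m+[n∸m]≡n 2≤x) ⟩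
        dout v + x v + 1               ≡⟨ dout+x off ⟩
        m                              ∎
      2+dout≤m : 2 + dout v ≤ m
      2+dout≤m with cases-x v off
      ... | inj₂ (_ , le) = le
      ... | inj₁ (x0 , _) with subst (1 ≤_) x0 (subst (_≤ x v) (far-N far) (term≤sumO (N v) (far-off far)))
      ...   | ()
      inner : wt v ≤ A + D
      inner with far-cases far
      ... | inj₁ S≤ = begin
        wt v                           ≡⟨ wt-triple id₃ ⟩
        S + (3 + dout v) * E v         ≤⟨ +-mono-≤ S≤ (*-mono-≤ (s≤s 2+dout≤m) (ecc≤D v)) ⟩
        D + D + D₁ + (1 + m) * D       ≡⟨ arith₁ D D₁ m ⟩
        A + D                          ∎
      ... | inj₂ 2≤x = begin
        wt v                           ≡⟨ wt-triple id₃ ⟩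
        S + (3 + dout v) * E v         ≤⟨ +-mono-≤ S≤3D (*-mono-≤ (3+dout≤m 2≤x) (ecc≤D v)) ⟩
        D + D + D + m * D              ≤⟨ m≤n+m _ D₁ ⟩
        D₁ + (D + D + D + m * D)       ≡⟨ arith₂ D D₁ m ⟩
        A + D                          ∎

    -- A non-neighbour saves `D₁`, which pays for replacing all three path eccentricities by `D`:
    -- three times `D` is `D + D₁ + 2 + D₁`, and `o 2` is at least two.
    bound-D₁ : E v ≤ D₁ → wt v ≤ B
    bound-D₁ le with cases-x v off
    ... | inj₁ (x0 , eq) = begin
      wt v                                             ≡⟨ wt-triple id₃ ⟩
      S + (2 + (1 + dout v)) * E v                     ≤⟨ +-mono-≤ (+-mono-≤ (+-mono-≤ (x≡0⇒E≤o x0 i≤D e₀) (x≡0⇒E≤o x0 (<⇒≤ i≤) e₁)) (x≡0⇒E≤o x0 i≤ e₂))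
                                                            (*-mono-≤ (≤-reflexive (cong (2 +_) eq)) le) ⟩
      o i + o (1 + i) + o (2 + i) + (2 + m) * D₁       ≤⟨ +-monoˡ-≤ _ (o-triple i≤) ⟩
      o 0 + o 1 + o 2 + (2 + m) * D₁                   ≡⟨ B-form ⟩
      B                                                ∎
      where open ≤-Reasoning
    ... | inj₂ (_ , 2≤) = begin
      wt v                                             ≡⟨ wt-triple id₃ ⟩
      S + (3 + dout v) * E v                           ≤⟨ +-mono-≤ S≤3D (*-mono-≤ (s≤s 2≤) le) ⟩
      D + D + D + (1 + m) * D₁                         ≡⟨ arith k m ⟩
      D + D₁ + 2 + (2 + m) * D₁                        ≤⟨ +-monoˡ-≤ _ (+-monoʳ-≤ (D + D₁) (o≥2 2)) ⟩
      o 0 + o 1 + o 2 + (2 + m) * D₁                   ≡⟨ B-form ⟩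
      B                                                ∎
      where
      open ≤-Reasoning
      arith : ∀ k m → 3 + k + (3 + k) + (3 + k) + (1 + m) * (2 + k) ≡ 3 + k + (2 + k) + 2 + (2 + m) * (2 + k)
      arith = solve-∀

  E-cases : ∀ v → E v ≡ D ⊎ E v ≤ D₁
  E-cases v with m≤n⇒m<n∨m≡n (ecc≤D v)
  ... | inj₁ lt = inj₂ (s≤s⁻¹ lt)
  ... | inj₂ eq = inj₁ eq

  -- Each w ∈ W gives D to every non-neighbour of w off the path; y v counts the gifts v receives.
  vertex-bound : ∀ v → Off v → wt v + ω v * (penalty + D * x v) ≤ M + D * y v
  vertex-bound v off with view v
  ... | few le = ≤-trans (subst (λ z → wt v + z * (penalty + D * x v) ≤ A) (sym (ω-few {v} le))
          (subst (λ z → wt v + z ≤ A) (sym (+-identityʳ (penalty + D * x v))) (few-bound off le)))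
        (≤-trans A≤M (m≤m+n M _))
  ... | pair i j i<j j≤2+i j≤D id₂ = ≤-trans (≤-reflexive (trans (cong (λ z → wt v + z * (penalty + D * x v))
          (ω-many {v} (≤-reflexive (sym (trans (sym (p-sum v)) (id₂ (λ _ → 1))))))) (+-identityʳ (wt v))))
        (≤-trans (pair-bound off i<j j≤2+i j≤D id₂) (≤-trans A≤M (m≤m+n M _)))
  ... | triple i i≤ id₃ = ≤-trans (≤-reflexive (trans (cong (λ z → wt v + z * (penalty + D * x v))
          (ω-many {v} (≤-trans (n≤1+n 2) (≤-reflexive (sym (trans (sym (p-sum v)) (id₃ (λ _ → 1)))))))) (+-identityʳ (wt v))))
        ([ (λ eq → ≤-trans (bound-D eq) (+-monoˡ-≤ _ A≤M)) , (λ le → ≤-trans (bound-D₁ le) (≤-trans B≤M (m≤m+n M _))) ]′ (E-cases v))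
        where open Triple off i≤ id₃

  -- Gifts received equal gifts given, because non-adjacency is symmetric; the two totals cancel in
  -- `off-part`.
  double-count : sumO y ≡ sumO (λ w → ω w * x w)
  double-count = begin
    sumO (λ v → sumO (λ w → ω w * N v w))
      ≡⟨ sum-cong {n} (λ v → sum-*ˡ {n} (ō v) (λ w → ō w * (ω w * N v w))) ⟨
    sum (λ v → sum (λ w → ō v * (ō w * (ω w * N v w))))
      ≡⟨ ∑-comm {n} {n} (λ v w → ō v * (ō w * (ω w * N v w))) ⟩
    sum (λ w → sum (λ v → ō v * (ō w * (ω w * N v w))))
      ≡⟨ sum-cong {n} (λ w → sum-cong {n} (λ v → trans (arith (ō v) (ō w) (ω w) (N v w)) (cong (λ z → ō w * ω w * (ō v * z)) (N-sym v w)))) ⟩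
    sum (λ w → sum (λ v → ō w * ω w * (ō v * N w v)))
      ≡⟨ sum-cong {n} (λ w → trans (sum-*ˡ {n} (ō w * ω w) (λ v → ō v * N w v)) (*-assoc (ō w) (ω w) (x w))) ⟩
    sumO (λ w → ω w * x w) ∎
    where
    open ≡-Reasoning
    arith : ∀ a b c z → a * (b * (c * z)) ≡ b * c * (a * z)
    arith = solve-∀

  off-part : sumO wt + penalty * #W ≤ m * M
  off-part = +-cancelʳ-≤ (D * sumO y) _ _ (begin
    sumO wt + penalty * #W + D * sumO y
      ≡⟨ cong (λ z → sumO wt + penalty * #W + D * z) double-count ⟩
    sumO wt + penalty * #W + D * sumO (λ w → ω w * x w)
      ≡⟨ cong₂ (λ b c → sumO wt + b + c) (sumO-*ˡ penalty ω) (sumO-*ˡ D (λ w → ω w * x w)) ⟨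
    sumO wt + sumO (λ v → penalty * ω v) + sumO (λ v → D * (ω v * x v))
      ≡⟨ trans (sumO-+ (λ v → wt v + penalty * ω v) (λ v → D * (ω v * x v))) (cong (_+ sumO (λ v → D * (ω v * x v))) (sumO-+ wt (λ v → penalty * ω v))) ⟨
    sumO (λ v → wt v + penalty * ω v + D * (ω v * x v))
      ≤⟨ sumO-mono (λ v off → ≤-trans (≤-reflexive (arith (wt v) penalty (ω v) D (x v))) (vertex-bound v off)) ⟩
    sumO (λ v → M + D * y v)
      ≡⟨ trans (sumO-+ (λ _ → M) (λ v → D * y v)) (cong₂ _+_ (sumO-const M) (sumO-*ˡ D y)) ⟩
    m * M + D * sumO y ∎)
    where
    open ≤-Reasoning
    arith : ∀ w p o d x → w + p * o + d * (o * x) ≡ w + o * (p + d * x)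
    arith = solve-∀

  -- The excess on the path costs `2 * D₁` per element of `W`, and `penalty` is one more than that.
  -- The unit left over is the `#W` on the left, which makes `W` empty in the case of equality.
  main-bound : ξc G + #W ≤ base D + m * M
  main-bound = begin
    ξc G + #W                                                   ≡⟨ cong (_+ #W) decomposition ⟩
    ∑ (suc D) (λ i → dp i * E (U i)) + sumO wt + #W             ≤⟨ +-monoˡ-≤ #W (+-monoˡ-≤ (sumO wt) path-part) ⟩
    base D + D₁ * (2 * #W) + sumO wt + #W                       ≡⟨ arith k (base D) (sumO wt) #W ⟩
    base D + (sumO wt + penalty * #W)                           ≤⟨ +-monoʳ-≤ (base D) off-part ⟩
    base D + m * M                                              ∎
    where
    open ≤-Reasoning
    arith : ∀ k b s w → b + (2 + k) * (2 * w) + s + w ≡ b + (s + (2 + k + (3 + k)) * w)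
    arith = solve-∀

  -- Equality: the vertices off the path

  data Kind (v : Fin n) : Set where
    -- `i ≡ 0` puts the window at the start of the path, the alternative at its end. A vertex of
    -- weight `M` cannot be of the lighter kind; the comparison of `A` and `B` is kept because it
    -- decides later which kinds occur.
    kindA : ∀ i → i ≡ 0 ⊎ 1 + i ≡ D → (∀ (h : ℕ → ℕ) → ∑ (suc D) (λ l → a v (U l) * h l) ≡ h i + h (1 + i)) →
            E v ≡ D → B ≤ A → Kind v
    kindB : ∀ i → i ≡ 0 ⊎ 2 + i ≡ D → (∀ (h : ℕ → ℕ) → ∑ (suc D) (λ l → a v (U l) * h l) ≡ h i + h (1 + i) + h (2 + i)) →
            A ≤ B → Kind v

  module Equality (tight : base D + m * M ≤ ξc G) where

    #W≡0 : #W ≡ 0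
    #W≡0 = n≤0⇒n≡0 (+-cancelˡ-≤ (ξc G) #W 0 (≤-trans main-bound (≤-trans tight (≤-reflexive (sym (+-identityʳ (ξc G)))))))

    E≡o : ∀ {i} → i ≤ D → E (U i) ≡ o i
    E≡o {i} i≤D = ≤-antisym (≤-trans (excess≤#W i≤D) (≤-reflexive (trans (cong (o i +_) #W≡0) (+-identityʳ (o i))))) (o≤E i≤D)

    not-few : ∀ {v} → Off v → ¬ (p v ≤ 1)
    not-few {v} off le = n≮0 (subst (1 ≤_) #W≡0 (subst (_≤ #W) (ω-few {v} le) (term≤sumO ω off)))

    y≡0 : ∀ v → y v ≡ 0
    y≡0 v = n≤0⇒n≡0 (subst (y v ≤_) #W≡0 (sumO-mono λ w _ →
      ≤-trans (*-monoʳ-≤ (ω w) (𝟙-≤1 (not (does (v Fin.≟ w)) ∧ not (adj G v w)))) (≤-reflexive (*-identityʳ (ω w)))))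

    wt≤M : ∀ v → Off v → wt v ≤ M
    wt≤M v off = ≤-trans (m≤m+n (wt v) _) (≤-trans (vertex-bound v off)
      (≤-reflexive (trans (cong (λ z → M + D * z) (y≡0 v)) (trans (cong (M +_) (*-zeroʳ D)) (+-identityʳ M)))))

    wt≡M : ∀ v → Off v → wt v ≡ M
    wt≡M = sumO-tight wt≤M (+-cancelˡ-≤ (base D) _ _ (begin
      base D + sumO (λ _ → M)                             ≡⟨ cong (base D +_) (sumO-const M) ⟩
      base D + m * M                                      ≤⟨ tight ⟩
      ξc G                                                ≡⟨ decomposition ⟩
      ∑ (suc D) (λ i → dp i * E (U i)) + sumO wt          ≤⟨ +-monoˡ-≤ (sumO wt) path-part ⟩
      base D + D₁ * (2 * #W) + sumO wt                    ≡⟨ cong (λ z → base D + D₁ * (2 * z) + sumO wt) #W≡0 ⟩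
      base D + D₁ * 0 + sumO wt                           ≡⟨ cong (λ z → z + sumO wt) (trans (cong (base D +_) (*-zeroʳ D₁)) (+-identityʳ _)) ⟩
      base D + sumO wt                                    ∎))
      where open ≤-Reasoning

    -- Weight `M` leaves no slack: a non-neighbour off the path loses `D`, eccentricity at most `D₁`
    -- loses `1 + m`, and two consecutive inner indices stay below `D₁ + D`.
    kind-pair : ∀ {v i j} → Off v → i < j → j ≤ 2 + i → j ≤ D →
      (∀ (h : ℕ → ℕ) → ∑ (suc D) (λ l → a v (U l) * h l) ≡ h i + h j) → x v ≡ 0 × Kind v
    kind-pair {v} {i} {j} off i<j j≤2+i j≤D id₂ with cases-x v off
    ... | inj₂ (_ , le) = ⊥-elim (<⇒≱ wt< A≤wt)
      where
      open ≤-Reasoning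
      A≤wt : A ≤ wt v
      A≤wt = ≤-trans A≤M (≤-reflexive (sym (wt≡M v off)))
      arith : ∀ D D₁ m → D₁ + D + m * D + D ≡ D₁ + D + (1 + m) * D
      arith = solve-∀
      wt< : wt v < A
      wt< = begin-strict
        wt v                                        ≡⟨ wt-pair id₂ ⟩
        E (U i) + E (U j) + (2 + dout v) * E v      ≤⟨ +-mono-≤ (≤-trans (≤-reflexive (cong₂ _+_ (E≡o (≤-trans (<⇒≤ i<j) j≤D)) (E≡o j≤D))) (o-pair i<j j≤2+i j≤D)) (*-mono-≤ le (ecc≤D v)) ⟩
        D₁ + D + m * D                              <⟨ m<m+n _ (s≤s z≤n) ⟩
        D₁ + D + m * D + D                          ≡⟨ arith D D₁ m ⟩
        D₁ + D + (1 + m) * D                        ≡⟨ A-form ⟩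
        A                                           ∎
    ... | inj₁ (x0 , eq) = x0 , subst-j (m≤n⇒m<n∨m≡n i<j)
      where
      open ≤-Reasoning
      i≤D = ≤-trans (<⇒≤ i<j) j≤D
      A≤wt : A ≤ wt v
      A≤wt = ≤-trans A≤M (≤-reflexive (sym (wt≡M v off)))
      B≤A : B ≤ A
      B≤A = ≤-trans B≤M (≤-trans (≤-reflexive (sym (wt≡M v off))) (pair-bound off i<j j≤2+i j≤D id₂))
      wt-o : wt v ≡ o i + o j + (1 + m) * E v
      wt-o = trans (wt-pair id₂) (cong₂ _+_ (cong₂ _+_ (E≡o i≤D) (E≡o j≤D)) (cong (λ z → (1 + z) * E v) eq))
      Ev≡D : E v ≡ D
      Ev≡D with E-cases v
      ... | inj₁ e = e
      ... | inj₂ le = ⊥-elim (<⇒≱ wt< A≤wt)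
        where
        wt< : wt v < A
        wt< = begin-strict
          wt v                                 ≡⟨ wt-o ⟩
          o i + o j + (1 + m) * E v            ≤⟨ +-mono-≤ (o-pair i<j j≤2+i j≤D) (*-monoʳ-≤ (1 + m) le) ⟩
          D₁ + D + (1 + m) * D₁                <⟨ +-monoʳ-< (D₁ + D) (*-monoʳ-< (1 + m) ≤-refl) ⟩
          D₁ + D + (1 + m) * D                 ≡⟨ A-form ⟩
          A                                    ∎
      es = pair-adj i≤D j≤D id₂
      o-sum : D₁ + D ≤ o i + o j
      o-sum = +-cancelʳ-≤ ((1 + m) * D) _ _ (≤-trans (≤-reflexive A-form) (≤-trans A≤wt
        (≤-reflexive (trans wt-o (cong (λ z → o i + o j + (1 + m) * z) Ev≡D)))))
      subst-j : suc i < j ⊎ suc i ≡ j → Kind v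
      subst-j (inj₂ refl) = kindA i (end i o-sum (m≤n⇒m<n∨m≡n j≤D)) id₂ Ev≡D B≤A
        where
        end : ∀ i → D₁ + D ≤ o i + o (suc i) → 1 + i < D ⊎ 1 + i ≡ D → i ≡ 0 ⊎ 1 + i ≡ D
        end zero _ _ = inj₁ refl
        end (suc i) _ (inj₂ e) = inj₂ e
        end (suc i) le (inj₁ lt) = ⊥-elim (<⇒≱ (≤-trans (s≤s (+-mono-≤ (o-mid (s≤s z≤n) (<⇒≤ lt)) (o-mid (s≤s z≤n) lt)))
          (≤-reflexive (sym (+-suc D₁ D₁)))) le)
      -- With a gap of two `v` is a twin of `U (1 + i)`, which brings every vertex within `D₁` of
      -- it, against `Ev≡D`.
      subst-j (inj₁ lt) with ≤-antisym j≤2+i lt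
      ... | refl with ecc-far v
      ...   | w , far = ⊥-elim (<⇒≱ (≤-reflexive (sym (trans far Ev≡D))) (onP-cases {λ w → d v w ≤ D₁} twin-d≤D₁
              (λ w off′ → ≤-trans (x≡0⇒close x0 off′) (s≤s z≤n)) w))
        where open Twin j≤D (proj₁ es) (proj₂ es)

    -- Eccentricity `D` would require an element of the empty `W`. Otherwise a non-neighbour off the
    -- path loses `D₁`, and a triple away from both ends is strictly lighter, so neither reaches
    -- `B`.
    kind-triple : ∀ {v i} → Off v → 2 + i ≤ D →
      (∀ (h : ℕ → ℕ) → ∑ (suc D) (λ l → a v (U l) * h l) ≡ h i + h (1 + i) + h (2 + i)) → x v ≡ 0 × Kind v
    kind-triple {v} {i} off i≤ id₃ = [ absurd , (λ le → go le (cases-x v off)) ]′ (E-cases v)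
      where
      open ≤-Reasoning
      B≤wt : B ≤ wt v
      B≤wt = ≤-trans B≤M (≤-reflexive (sym (wt≡M v off)))
      A≤B : E v ≤ D₁ → A ≤ B
      A≤B le = ≤-trans A≤M (≤-trans (≤-reflexive (sym (wt≡M v off))) (Triple.bound-D₁ off i≤ id₃ le))
      absurd : ∀ {C : Set} → E v ≡ D → C
      absurd eq = ⊥-elim (n≮0 (subst (1 ≤_) (y≡0 v)
        (Triple.far-y off i≤ id₃ {proj₁ (ecc-far v)} (trans (proj₂ (ecc-far v)) eq))))
      O = o i + o (1 + i) + o (2 + i)
      wt-o : wt v ≡ O + (3 + dout v) * E v
      wt-o = trans (wt-triple id₃) (cong (_+ (3 + dout v) * E v)
        (cong₂ _+_ (cong₂ _+_ (E≡o (≤-trans (m≤n+m i 2) i≤)) (E≡o (<⇒≤ i≤))) (E≡o i≤)))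
      go : E v ≤ D₁ → (x v ≡ 0 × 1 + dout v ≡ m) ⊎ (1 ≤ x v × 2 + dout v ≤ m) → x v ≡ 0 × Kind v
      go le (inj₂ (_ , 2≤)) = ⊥-elim (<⇒≱ wt< B≤wt)
        where
        wt< : wt v < B
        wt< = begin-strict
          wt v                                 ≡⟨ wt-o ⟩
          O + (3 + dout v) * E v               ≤⟨ +-mono-≤ (o-triple i≤) (*-mono-≤ (s≤s 2≤) le) ⟩
          o 0 + o 1 + o 2 + (1 + m) * D₁       <⟨ +-monoʳ-< (o 0 + o 1 + o 2) (*-monoˡ-< D₁ {1 + m} {2 + m} ≤-refl) ⟩
          o 0 + o 1 + o 2 + (2 + m) * D₁       ≡⟨ B-form ⟩
          B                                    ∎
      go le (inj₁ (x0 , eq)) with o-triple-cases i i≤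
      ... | inj₁ end = x0 , kindB i end id₃ (A≤B le)
      ... | inj₂ lt = ⊥-elim (<⇒≱ wt< B≤wt)
        where
        wt< : wt v < B
        wt< = begin-strict
          wt v                                 ≡⟨ wt-o ⟩
          O + (3 + dout v) * E v               <⟨ +-mono-<-≤ lt (*-mono-≤ (≤-reflexive (cong (2 +_) eq)) le) ⟩
          o 0 + o 1 + o 2 + (2 + m) * D₁       ≡⟨ B-form ⟩
          B                                    ∎

    kind : ∀ v → Off v → x v ≡ 0 × Kind v
    kind v off with view v
    ... | few le = ⊥-elim (not-few off le)
    ... | pair i j i<j j≤2+i j≤D id₂ = kind-pair off i<j j≤2+i j≤D id₂
    ... | triple i i≤ id₃ = kind-triple off i≤ id₃

-- Graphs determined by vertex classes

-- inj₁ j is the class of u_j; inj₂ (s , b) is the class of the vertices off the path joined to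
-- its first (s = false) or last (s = true) two (b = false) or three (b = true) vertices.
Class : Set
Class = ℕ ⊎ (Bool × Bool)

_≟ᶜ_ : DecidableEquality Class
_≟ᶜ_ = Sum.≡-dec _≟_ (Product.≡-dec Bool._≟_ Bool._≟_)

joined : ℕ → Bool × Bool → ℕ → Bool
joined D (s , b) j = (if s then D ∸ j else j) ≤ᵇ (if b then 2 else 1)

classAdj : ℕ → Class → Class → Bool
classAdj D (inj₁ i) (inj₁ j) = consec i j
classAdj D (inj₁ i) (inj₂ τ) = joined D τ i
classAdj D (inj₂ τ) (inj₁ j) = joined D τ j
classAdj D (inj₂ _) (inj₂ _) = true

record Layout {n} (G : Graph n) (D : ℕ) : Set where
  field
    U      : ℕ → Fin n
    κ      : Fin n → Class
    κ-U    : ∀ {j} → j ≤ D → κ (U j) ≡ inj₁ j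
    κ-path : ∀ {v j} → κ v ≡ inj₁ j → j ≤ D × U j ≡ v
    -- `classAdj` joins any two classes off the path, a class with itself included, whereas graphs
    -- have no loops; hence `u ≢ v`.
    adj-κ  : ∀ {u v} → u ≢ v → adj G u v ≡ classAdj D (κ u) (κ v)

  count : Bool × Bool → ℕ
  count τ = sum (λ v → 𝟙 (does (κ v ≟ᶜ inj₂ τ)))

  U-inj : ∀ {i j} → i ≤ D → j ≤ D → U i ≡ U j → i ≡ j
  U-inj i≤D j≤D eq = Sum.inj₁-injective (trans (sym (κ-U i≤D)) (trans (cong κ eq) (κ-U j≤D)))

  path-count : ∀ {j} → j ≤ D → sum (λ v → 𝟙 (does (κ v ≟ᶜ inj₁ j))) ≡ 1
  path-count {j} j≤D = trans (sum-cong {n} λ v → cong 𝟙 (pt v)) (sum-δ₁ (U j))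
    where
    pt : ∀ v → does (κ v ≟ᶜ inj₁ j) ≡ does (U j Fin.≟ v)
    pt v with U j Fin.≟ v
    ... | yes refl = dec-true (κ (U j) ≟ᶜ inj₁ j) (κ-U j≤D)
    ... | no ne = dec-false (κ v ≟ᶜ inj₁ j) (ne ∘ proj₂ ∘ κ-path)

  path-count-none : ∀ {j} → ¬ j ≤ D → sum (λ v → 𝟙 (does (κ v ≟ᶜ inj₁ j))) ≡ 0
  path-count-none {j} j≰D = sum-zero {n} λ v → cong 𝟙 (dec-false (κ v ≟ᶜ inj₁ j) (j≰D ∘ proj₁ ∘ κ-path))

  count-∃ : ∀ {τ} → 1 ≤ count τ → ∃ λ v → κ v ≡ inj₂ τ
  count-∃ {τ} le with sum>0⇒∃ (λ v → does (κ v ≟ᶜ inj₂ τ)) le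
  ... | v , eq with κ v ≟ᶜ inj₂ τ
  ...   | yes e = v , e

  order : n ≡ suc D + (count (false , false) + count (false , true) + count (true , false) + count (true , true))
  order = begin
    n
      ≡⟨ trans (sum-const n 1) (*-identityʳ n) ⟨
    sum {n} (λ _ → 1)
      ≡⟨ sum-cong {n} (λ v → one (κ v) (λ eq → proj₁ (κ-path eq))) ⟨
    sum (λ v → P v + (T₀ v + T₁ v + T₂ v + T₃ v))
      ≡⟨ ∑-distrib-+ P (λ v → T₀ v + T₁ v + T₂ v + T₃ v) ⟩
    sum P + sum (λ v → T₀ v + T₁ v + T₂ v + T₃ v)
      ≡⟨ cong₂ _+_ (trans (sum-∑-comm {n} (suc D) (λ v j → 𝟙 (does (κ v ≟ᶜ inj₁ j))))
           (trans (∑-cong (suc D) λ j j≤D → path-count (s≤s⁻¹ j≤D)) (trans (∑-const (suc D) 1) (*-identityʳ (suc D)))))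
         (trans (∑-distrib-+ (λ v → T₀ v + T₁ v + T₂ v) T₃) (cong (_+ sum T₃)
           (trans (∑-distrib-+ (λ v → T₀ v + T₁ v) T₂) (cong (_+ sum T₂) (∑-distrib-+ T₀ T₁))))) ⟩
    suc D + (sum T₀ + sum T₁ + sum T₂ + sum T₃) ∎
    where
    open ≡-Reasoning
    P T₀ T₁ T₂ T₃ : Fin n → ℕ
    P v = ∑ (suc D) (λ j → 𝟙 (does (κ v ≟ᶜ inj₁ j)))
    T₀ v = 𝟙 (does (κ v ≟ᶜ inj₂ (false , false)))
    T₁ v = 𝟙 (does (κ v ≟ᶜ inj₂ (false , true)))
    T₂ v = 𝟙 (does (κ v ≟ᶜ inj₂ (true , false)))
    T₃ v = 𝟙 (does (κ v ≟ᶜ inj₂ (true , true)))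
    one : ∀ c → (∀ {j} → c ≡ inj₁ j → j ≤ D) → ∑ (suc D) (λ j → 𝟙 (does (c ≟ᶜ inj₁ j))) +
      (𝟙 (does (c ≟ᶜ inj₂ (false , false))) + 𝟙 (does (c ≟ᶜ inj₂ (false , true))) +
       𝟙 (does (c ≟ᶜ inj₂ (true , false))) + 𝟙 (does (c ≟ᶜ inj₂ (true , true)))) ≡ 1
    one (inj₁ i) h = trans (+-identityʳ _) (trans (∑-cong (suc D) λ j _ → trans (cong 𝟙 (≡ᵇ-sym i j)) (sym (+-identityʳ _)))
      (∑-pick (suc D) (λ _ → 1) (s≤s (h refl))))
    one (inj₂ (s , b)) h = trans (cong (_+ _) (∑-zero (suc D) λ j _ → refl)) (types s b)
      where
      types : ∀ s b → 𝟙 (does (inj₂ {A = ℕ} (s , b) ≟ᶜ inj₂ (false , false))) + 𝟙 (does (inj₂ {A = ℕ} (s , b) ≟ᶜ inj₂ (false , true))) +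
       𝟙 (does (inj₂ {A = ℕ} (s , b) ≟ᶜ inj₂ (true , false))) + 𝟙 (does (inj₂ {A = ℕ} (s , b) ≟ᶜ inj₂ (true , true))) ≡ 1
      types false false = refl
      types false true = refl
      types true false = refl
      types true true = refl

-- Adjacency of distinct vertices depends on their classes only, so every class-preserving bijection
-- is an isomorphism. Each path class has exactly one vertex, which leaves the four values of
-- `count` to compare.
layout-iso : ∀ {n D} {G H : Graph n} (L : Layout G D) (L′ : Layout H D) →
  (∀ τ → Layout.count L τ ≡ Layout.count L′ τ) → G ≅ H
layout-iso {n} {D} {G} {H} L L′ same = π , pres
  where
  module L = Layout L
  module L′ = Layout L′
  counts : ∀ c → sum (λ v → 𝟙 (does (L.κ v ≟ᶜ c))) ≡ sum (λ v → 𝟙 (does (L′.κ v ≟ᶜ c)))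
  counts (inj₁ j) with j ≤? D
  ... | yes j≤D = trans (L.path-count j≤D) (sym (L′.path-count j≤D))
  ... | no j≰D = trans (L.path-count-none j≰D) (sym (L′.path-count-none j≰D))
  counts (inj₂ τ) = same τ
  matched = match-colours _≟ᶜ_ n L.κ L′.κ counts
  π = proj₁ matched
  open Inverse π using (to; from; strictlyInverseʳ)
  pres : ∀ u v → adj H (to u) (to v) ≡ adj G u v
  pres u v with u Fin.≟ v
  ... | yes refl = trans (adj-irr H (to u)) (sym (adj-irr G u))
  ... | no ne = trans (L′.adj-κ (λ eq → ne (trans (sym (strictlyInverseʳ u)) (trans (cong from eq) (strictlyInverseʳ v)))))
      (trans (cong₂ (classAdj D) (proj₂ matched u) (proj₂ matched v)) (sym (L.adj-κ ne)))

flipClass : ℕ → Class → Class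
flipClass D (inj₁ j) = inj₁ (D ∸ j)
flipClass D (inj₂ (s , b)) = inj₂ (not s , b)

consec-flip : ∀ {D i j} → i ≤ D → j ≤ D → consec (D ∸ i) (D ∸ j) ≡ consec i j
consec-flip {D} {i} {j} i≤D j≤D = ⇔-≡
  (λ c → subst₂ (λ x y → consec x y ≡ true) (m∸[m∸n]≡n i≤D) (m∸[m∸n]≡n j≤D) (go (m∸n≤m D i) (m∸n≤m D j) c))
  (go i≤D j≤D)
  where
  go : ∀ {i j} → i ≤ D → j ≤ D → consec i j ≡ true → consec (D ∸ i) (D ∸ j) ≡ true
  go {i} {j} i≤D j≤D c with consec⁻ i j c
  ... | inj₁ refl = consec⁺ʳ (sym (+-∸-assoc 1 i≤D))
  ... | inj₂ refl = consec⁺ˡ (+-∸-assoc 1 j≤D)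

-- Reading the path backwards lets statements about one end serve for the other.
flipLayout : ∀ {n D} {G : Graph n} → Layout G D → Layout G D
flipLayout {n} {D} {G} L = record
  { U = λ j → U (D ∸ j)
  ; κ = λ v → flipClass D (κ v)
  ; κ-U = λ {j} j≤D → trans (cong (flipClass D) (κ-U (m∸n≤m D j))) (cong inj₁ (m∸[m∸n]≡n j≤D))
  ; κ-path = λ {v} {j} → path v j
  ; adj-κ = λ {u} {v} ne → trans (adj-κ ne) (sym (flip-adj (κ u) (κ v) (proj₁ ∘ κ-path) (proj₁ ∘ κ-path)))
  }
  where
  open Layout L
  path : ∀ v j → flipClass D (κ v) ≡ inj₁ j → j ≤ D × U (D ∸ j) ≡ v
  path v j eq with κ v in e
  path v j refl | inj₁ i = m∸n≤m D i , trans (cong U (m∸[m∸n]≡n (proj₁ (κ-path e)))) (proj₂ (κ-path e))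
  flip-joined : ∀ s b {j} → j ≤ D → joined D (not s , b) (D ∸ j) ≡ joined D (s , b) j
  flip-joined false b j≤D = cong (_≤ᵇ (if b then 2 else 1)) (m∸[m∸n]≡n j≤D)
  flip-joined true b j≤D = refl
  flip-adj : ∀ c c′ → (∀ {j} → c ≡ inj₁ j → j ≤ D) → (∀ {j} → c′ ≡ inj₁ j → j ≤ D) →
    classAdj D (flipClass D c) (flipClass D c′) ≡ classAdj D c c′
  flip-adj (inj₁ i) (inj₁ j) h h′ = consec-flip (h refl) (h′ refl)
  flip-adj (inj₁ i) (inj₂ (s , b)) h h′ = flip-joined s b (h refl)
  flip-adj (inj₂ (s , b)) (inj₁ j) h h′ = flip-joined s b (h′ refl)
  flip-adj (inj₂ _) (inj₂ _) h h′ = refl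

flip-count : ∀ {n D} {G : Graph n} (L : Layout G D) s b →
  Layout.count (flipLayout L) (s , b) ≡ Layout.count L (not s , b)
flip-count {n} {D} L s b = sum-cong {n} λ v → cong 𝟙 (pt (Layout.κ L v) s)
  where
  pt : ∀ c s → does (flipClass D c ≟ᶜ inj₂ (s , b)) ≡ does (c ≟ᶜ inj₂ (not s , b))
  pt (inj₁ j) s = refl
  pt (inj₂ (false , _)) false = refl
  pt (inj₂ (false , _)) true = refl
  pt (inj₂ (true , _)) false = refl
  pt (inj₂ (true , _)) true = refl

module Walks {n : ℕ} {G : Graph n} {D : ℕ} (L : Layout G D) where
  open Layout L

  adj-class : ∀ {u v c c′} → κ u ≡ c → κ v ≡ c′ → c ≢ c′ → classAdj D c c′ ≡ true → adj G u v ≡ true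
  adj-class {u} {v} refl refl ne e = trans (adj-κ (ne ∘ cong κ)) e

  Reach-off : ∀ {u v τ τ′} → κ u ≡ inj₂ τ → κ v ≡ inj₂ τ′ → Reach G 1 u v
  Reach-off {u} {v} eu ev with u Fin.≟ v
  ... | yes refl = nil
  ... | no ne = cons (trans (adj-κ ne) (cong₂ (classAdj D) eu ev)) nil

  Reach-up : ∀ i k → k + i ≤ D → Reach G k (U i) (U (k + i))
  Reach-up i zero le = nil
  Reach-up i (suc k) le = Reach-snoc (Reach-up i k (<⇒≤ le))
    (adj-class (κ-U (<⇒≤ le)) (κ-U le) (λ eq → 1+n≢n (sym (Sum.inj₁-injective eq))) (consec⁺ʳ {k + i} refl))

  Reach-path : ∀ {i j} → i ≤ j → j ≤ D → Reach G (j ∸ i) (U i) (U j)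
  Reach-path {i} {j} i≤j j≤D = subst (λ z → Reach G (j ∸ i) (U i) (U z)) (m∸n+n≡m i≤j)
    (Reach-up i (j ∸ i) (≤-trans (≤-reflexive (m∸n+n≡m i≤j)) j≤D))

  adj-joined : ∀ {v τ j} → κ v ≡ inj₂ τ → j ≤ D → joined D τ j ≡ true → adj G v (U j) ≡ true
  adj-joined ev j≤D = adj-class ev (κ-U j≤D) (λ ())

  class-cases : ∀ {P : Fin n → Set} → (∀ j → j ≤ D → P (U j)) → (∀ v τ → κ v ≡ inj₂ τ → P v) → ∀ v → P v
  class-cases {P} on off v with κ v in e
  ... | inj₁ j = subst P (proj₂ (κ-path e)) (on j (proj₁ (κ-path e)))
  ... | inj₂ τ = off v τ e

  -- A detour through the other side brings v close to the far end of the path.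
  opposite-ecc : ∀ {v w b} → 3 ≤ D → κ v ≡ inj₂ (false , false) → κ w ≡ inj₂ (true , b) → ecc G v ≤ D ∸ 1
  opposite-ecc {v} {w} {b} 3≤D ev ew = maxOver≤ (dist G v) (class-cases {λ z → dist G v z ≤ D ∸ 1} on
      (λ z τ ez → ≤-trans (dist≤ G v z (Reach-off ev ez)) (≤-trans (s≤s z≤n) 2≤)))
    where
    2≤ : 2 ≤ D ∸ 1
    2≤ = ∸-monoˡ-≤ 1 3≤D
    end : joined D (true , b) D ≡ true
    end rewrite n∸n≡0 D = refl
    on : ∀ j → j ≤ D → dist G v (U j) ≤ D ∸ 1
    on j j≤D with m≤n⇒m<n∨m≡n j≤D
    ... | inj₂ refl = ≤-trans (dist≤ G v (U j) (Reach-snoc (Reach-off ev ew) (adj-joined ew ≤-refl end))) 2≤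
    on zero j≤D | inj₁ _ = ≤-trans (dist≤ G v (U 0) (cons (adj-joined ev z≤n refl) nil)) (≤-trans (s≤s z≤n) 2≤)
    on (suc j) j≤D | inj₁ lt = ≤-trans
      (dist≤ G v (U (suc j)) (cons (adj-joined ev (≤-trans (s≤s z≤n) j≤D) refl) (Reach-path (s≤s z≤n) j≤D)))
      (∸-monoˡ-≤ 1 lt)

  -- The walk goes through `v` and `w`, which are equal or adjacent. On a path of length `D` this
  -- forces `D = 3`.
  opposite-short : ∀ {v w b b′} → κ v ≡ inj₂ (false , b) → κ w ≡ inj₂ (true , b′) → dist G (U 0) (U D) ≤ 3
  opposite-short {v} {w} {b} {b′} ev ew = dist≤ G (U 0) (U D)
    (Reach-trans (Reach-sym (cons {k = 0} (adj-joined ev z≤n start) nil)) (Reach-snoc (Reach-off ev ew) (adj-joined ew ≤-refl end)))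
    where
    start : joined D (false , b) 0 ≡ true
    start = refl
    end : joined D (true , b′) D ≡ true
    end rewrite n∸n≡0 D = refl

-- From equality to a layout

pair-bits : ∀ j → 𝟙 (does (0 ≟ j)) + 𝟙 (does (1 ≟ j)) ≡ 𝟙 (j ≤ᵇ 1)
pair-bits 0 = refl
pair-bits 1 = refl
pair-bits (suc (suc j)) = refl

triple-bits : ∀ j → 𝟙 (does (0 ≟ j)) + 𝟙 (does (1 ≟ j)) + 𝟙 (does (2 ≟ j)) ≡ 𝟙 (j ≤ᵇ 2)
triple-bits 0 = refl
triple-bits 1 = refl
triple-bits 2 = refl
triple-bits (suc (suc (suc j))) = refl

≟-flip : ∀ {D i l j} → l + i ≡ D → j ≤ D → does (i ≟ j) ≡ does (l ≟ D ∸ j)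
≟-flip {D} {i} {l} {j} li j≤D = ⇔-≡
  (λ e → ≡ᵇ-true {l} (trans (sym (m+n∸n≡m l i)) (cong₂ _∸_ li (≡ᵇ-true⁻ i j e))))
  (λ e → ≡ᵇ-true {i} (+-cancelˡ-≡ l i j (trans li (trans (sym (m∸n+n≡m j≤D)) (cong (_+ j) (sym (≡ᵇ-true⁻ l (D ∸ j) e)))))))

module EqualityLayout {n : ℕ} (G : Graph n) (k : ℕ) (d<n : ∀ u w → dist G u w < n)
  (ecc≤D : ∀ v → ecc G v ≤ 3 + k) (U : ℕ → Fin n)
  (U-dist : ∀ {i j} → i ≤ j → j ≤ 3 + k → dist G (U i) (U j) ≡ j ∸ i)
  (tight : base (3 + k) + UpperBound.m G k d<n ecc≤D U U-dist * UpperBound.M G k d<n ecc≤D U U-dist ≤ ξc G) where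

  open UpperBound G k d<n ecc≤D U U-dist
  open Equality tight

  typeOf : ∀ {v} → Kind v → Bool × Bool
  typeOf (kindA _ (inj₁ _) _ _ _) = false , false
  typeOf (kindA _ (inj₂ _) _ _ _) = true , false
  typeOf (kindB _ (inj₁ _) _ _) = false , true
  typeOf (kindB _ (inj₂ _) _ _) = true , true

  -- The decision is an argument, so that proofs about `κ` can match on it directly.
  class : ∀ v → Dec (OnP v) → Class
  class v (yes (j , _)) = inj₁ (toℕ j)
  class v (no off) = inj₂ (typeOf (proj₂ (kind v off)))

  κ : Fin n → Class
  κ v = class v (onP? v)

  class-off : ∀ {v τ} (q : Dec (OnP v)) → class v q ≡ inj₂ τ → Σ (Off v) λ off → typeOf (proj₂ (kind v off)) ≡ τ
  class-off (no off) refl = off , refl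

  kind-joined : ∀ {v j} (K : Kind v) → j ≤ D → adj G v (U j) ≡ joined D (typeOf K) j
  kind-joined {v} {j} (kindA i (inj₁ refl) id₂ _ _) j≤D =
    𝟙-inj (trans (sym (bit v j≤D)) (trans (id₂ _) (pair-bits j)))
  kind-joined {v} {j} (kindA i (inj₂ e) id₂ _ _) j≤D =
    𝟙-inj (trans (sym (bit v j≤D)) (trans (id₂ _) (trans
      (cong₂ _+_ (cong 𝟙 (≟-flip {l = 1} e j≤D)) (cong 𝟙 (≟-flip {l = 0} e j≤D)))
      (trans (+-comm (𝟙 (does (1 ≟ D ∸ j))) _) (pair-bits (D ∸ j))))))
  kind-joined {v} {j} (kindB i (inj₁ refl) id₃ _) j≤D =
    𝟙-inj (trans (sym (bit v j≤D)) (trans (id₃ _) (triple-bits j)))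
  kind-joined {v} {j} (kindB i (inj₂ e) id₃ _) j≤D =
    𝟙-inj (trans (sym (bit v j≤D)) (trans (id₃ _) (trans
      (cong₂ _+_ (cong₂ _+_ (cong 𝟙 (≟-flip {l = 2} e j≤D)) (cong 𝟙 (≟-flip {l = 1} (trans (+-suc 0 (1 + i)) e) j≤D))) (cong 𝟙 (≟-flip {l = 0} e j≤D)))
      (trans (rot (𝟙 (does (2 ≟ D ∸ j))) (𝟙 (does (1 ≟ D ∸ j))) (𝟙 (does (0 ≟ D ∸ j)))) (triple-bits (D ∸ j))))))
    where
    rot : ∀ x y z → x + y + z ≡ z + y + x
    rot = solve-∀

  class-adj : ∀ {u v} (q : Dec (OnP u)) (q′ : Dec (OnP v)) → u ≢ v → adj G u v ≡ classAdj D (class u q) (class v q′)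
  class-adj (yes (i , refl)) (yes (j , refl)) _ = adj-U (s≤s⁻¹ (Fin.toℕ<n i)) (s≤s⁻¹ (Fin.toℕ<n j))
  class-adj {u} {v} (yes (i , refl)) (no off) _ = trans (adj-sym G u v) (kind-joined (proj₂ (kind v off)) (s≤s⁻¹ (Fin.toℕ<n i)))
  class-adj {u} (no off) (yes (j , refl)) _ = kind-joined (proj₂ (kind u off)) (s≤s⁻¹ (Fin.toℕ<n j))
  class-adj {u} {v} (no off) (no off′) ne with d≤1⇒ u v (x≡0⇒close (proj₁ (kind u off)) off′)
  ... | inj₁ eq = ⊥-elim (ne eq)
  ... | inj₂ e = e

  layout : Layout G D
  layout = record
    { U = U
    ; κ = κ
    ; κ-U = λ {j} j≤D → on j j≤D (onP? (U j))
    ; κ-path = λ {v} → path (onP? v)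
    ; adj-κ = λ {u} {v} → class-adj (onP? u) (onP? v)
    }
    where
    on : ∀ j → j ≤ D → (q : Dec (OnP (U j))) → class (U j) q ≡ inj₁ j
    on j j≤D (yes (i , eq)) = cong inj₁ (U-inj (s≤s⁻¹ (Fin.toℕ<n i)) j≤D eq)
    on j j≤D (no off) = ⊥-elim (off (onP j≤D))
    path : ∀ {v j} (q : Dec (OnP v)) → class v q ≡ inj₁ j → j ≤ D × U j ≡ v
    path (yes (i , eq)) refl = s≤s⁻¹ (Fin.toℕ<n i) , eq

  typeA-facts : ∀ {v s} → κ v ≡ inj₂ (s , false) → E v ≡ D × B ≤ A
  typeA-facts {v} e with class-off (onP? v) e
  ... | off , t = facts (proj₂ (kind v off)) t
    where
    facts : ∀ {s} (K : Kind v) → typeOf K ≡ (s , false) → E v ≡ D × B ≤ A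
    facts (kindA _ _ _ E≡D B≤A) _ = E≡D , B≤A
    facts (kindB _ (inj₁ _) _ _) ()
    facts (kindB _ (inj₂ _) _ _) ()

  typeB-facts : ∀ {v s} → κ v ≡ inj₂ (s , true) → A ≤ B
  typeB-facts {v} e with class-off (onP? v) e
  ... | off , t = facts (proj₂ (kind v off)) t
    where
    facts : ∀ {s} (K : Kind v) → typeOf K ≡ (s , true) → A ≤ B
    facts (kindB _ _ _ A≤B) _ = A≤B
    facts (kindA _ (inj₁ _) _ _ _) ()
    facts (kindA _ (inj₂ _) _ _ _) ()

-- The exact index when everything is attached at the start of the path

module OneSided {n : ℕ} {G : Graph n} {k : ℕ} (L : Layout G (3 + k))
  (near : ∀ {v s b} → Layout.κ L v ≡ inj₂ (s , b) → s ≡ false) where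

  open Layout L
  open Walks L
  open PathEcc k

  -- A potential that grows by at most one along an edge and so bounds distances from below.
  -- Vertices reaching only to `U 1` get 0 and those reaching to `U 2` get 1, which makes the bound
  -- sharp for the distance to `U D`.
  h : Class → ℕ
  h (inj₁ j) = j
  h (inj₂ (_ , b)) = 𝟙 b

  h-edge : ∀ c c′ → (∀ {s b} → c ≡ inj₂ (s , b) → s ≡ false) → (∀ {s b} → c′ ≡ inj₂ (s , b) → s ≡ false) →
    classAdj D c c′ ≡ true → h c′ ≤ suc (h c)
  h-edge (inj₁ i) (inj₁ j) _ _ e with consec⁻ i j e
  ... | inj₁ refl = ≤-trans (n≤1+n j) (n≤1+n (suc j))
  ... | inj₂ refl = ≤-refl
  h-edge (inj₁ i) (inj₂ (s , b)) _ _ e = ≤-trans (𝟙-≤1 b) (s≤s z≤n)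
  h-edge (inj₂ (s , b)) (inj₁ j) q _ e with q refl
  h-edge (inj₂ (.false , false)) (inj₁ j) q _ e | refl = ≤ᵇ⇒≤ j 1 (Equivalence.from T-≡ e)
  h-edge (inj₂ (.false , true)) (inj₁ j) q _ e | refl = ≤ᵇ⇒≤ j 2 (Equivalence.from T-≡ e)
  h-edge (inj₂ (s , b)) (inj₂ (s′ , b′)) _ _ e = ≤-trans (𝟙-≤1 b′) (s≤s z≤n)

  h-Reach : ∀ {l u w} → Reach G l u w → h (κ w) ≤ l + h (κ u)
  h-Reach {l} {u} nil = m≤n+m (h (κ u)) l
  h-Reach {suc l} {u} (cons {v = v} e r) = ≤-trans (h-Reach r) (≤-trans
    (+-monoʳ-≤ l (h-edge (κ u) (κ v) near near (trans (sym (adj-κ u≢v)) e))) (≤-reflexive (+-suc l (h (κ u)))))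
    where
    u≢v : u ≢ v
    u≢v refl = case trans (sym e) (adj-irr G u) of λ ()

  joined-near : ∀ {v τ j} → κ v ≡ inj₂ τ → j ≤ 1 → adj G v (U j) ≡ true
  joined-near {v} {s , b} {j} ev j≤1 with near ev
  joined-near {v} {.false , false} {j} ev j≤1 | refl = adj-joined ev (≤-trans j≤1 (s≤s z≤n)) (Equivalence.to T-≡ (≤⇒≤ᵇ j≤1))
  joined-near {v} {.false , true} {j} ev j≤1 | refl = adj-joined ev (≤-trans j≤1 (s≤s z≤n)) (Equivalence.to T-≡ (≤⇒≤ᵇ (m≤n⇒m≤1+n j≤1)))

  -- `U 0` and `U 1` are both neighbours, so for `j ≥ 1` the walk enters the path at `U 1` and has
  -- length `j`.
  Reach-off-path : ∀ {v τ} → κ v ≡ inj₂ τ → ∀ j → j ≤ D → Reach G (1 ⊔ j) v (U j)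
  Reach-off-path ev zero _ = cons (joined-near ev z≤n) nil
  Reach-off-path ev (suc j) j≤D = cons (joined-near ev ≤-refl) (Reach-path (s≤s z≤n) j≤D)

  dist-U : ∀ {i} → i ≤ D → ∀ w → dist G (U i) w ≤ o i
  dist-U {i} i≤D = class-cases {λ w → dist G (U i) w ≤ o i} on off
    where
    on : ∀ j → j ≤ D → dist G (U i) (U j) ≤ o i
    on j j≤D with ≤-total i j
    ... | inj₁ i≤j = ≤-trans (dist≤ G (U i) (U j) (Reach-path i≤j j≤D)) (≤-trans (∸-monoˡ-≤ i j≤D) (m≤n⊔m i (D ∸ i)))
    ... | inj₂ j≤i = ≤-trans (dist≤ G (U i) (U j) (Reach-sym (Reach-path j≤i i≤D))) (≤-trans (m∸n≤m i j) (m≤m⊔n i (D ∸ i)))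
    off : ∀ v τ → κ v ≡ inj₂ τ → dist G (U i) v ≤ o i
    off v τ ev = ≤-trans (dist≤ G (U i) v (Reach-sym (Reach-off-path ev i i≤D)))
      (⊔-lub (≤-trans (s≤s z≤n) (o≥2 i)) (m≤m⊔n i (D ∸ i)))

  dist-A : ∀ {v τ} → κ v ≡ inj₂ τ → ∀ w → dist G v w ≤ D
  dist-A {v} ev = class-cases {λ w → dist G v w ≤ D}
    (λ j j≤D → ≤-trans (dist≤ G v (U j) (Reach-off-path ev j j≤D)) (⊔-lub (s≤s z≤n) j≤D))
    (λ w τ′ ew → ≤-trans (dist≤ G v w (Reach-off ev ew)) (s≤s z≤n))

  dist-B : ∀ {v} → κ v ≡ inj₂ (false , true) → ∀ w → dist G v w ≤ D₁
  dist-B {v} ev = class-cases {λ w → dist G v w ≤ D₁} on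
    (λ w τ′ ew → ≤-trans (dist≤ G v w (Reach-off ev ew)) (s≤s z≤n))
    where
    on : ∀ j → j ≤ D → dist G v (U j) ≤ D₁
    on zero j≤D = ≤-trans (dist≤ G v (U 0) (Reach-off-path ev 0 j≤D)) (s≤s z≤n)
    on (suc zero) j≤D = ≤-trans (dist≤ G v (U 1) (Reach-off-path ev 1 j≤D)) (s≤s z≤n)
    on (suc (suc j)) j≤D = ≤-trans (dist≤ G v (U (2 + j))
      (cons (adj-joined ev (≤-trans (s≤s (s≤s z≤n)) j≤D) refl) (Reach-path (s≤s (s≤s z≤n)) j≤D)))
      (s≤s (s≤s⁻¹ (s≤s⁻¹ j≤D)))

  D<n : D < n
  D<n = subst (D <_) (sym order) (m≤m+n (suc D) _)

  dist≤D : ∀ u w → dist G u w ≤ D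
  dist≤D = class-cases {λ u → ∀ w → dist G u w ≤ D} (λ j j≤D w → ≤-trans (dist-U j≤D w) (o≤D j≤D)) (λ v τ ev → dist-A ev)

  d<n : ∀ u w → dist G u w < n
  d<n u w = ≤-trans (s≤s (dist≤D u w)) D<n

  dist≥ : ∀ u w → h (κ w) ≤ dist G u w + h (κ u)
  dist≥ u w = h-Reach (dist-Reach G (d<n u w))

  U-dist : ∀ {i j} → i ≤ j → j ≤ D → dist G (U i) (U j) ≡ j ∸ i
  U-dist {i} {j} i≤j j≤D = ≤-antisym (dist≤ G (U i) (U j) (Reach-path i≤j j≤D))
    (m≤n+o⇒m∸n≤o j i (subst₂ (λ x y → h x ≤ y) (κ-U j≤D) (trans (cong (λ c → dist G (U i) (U j) + h c) (κ-U (≤-trans i≤j j≤D)))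
      (+-comm (dist G (U i) (U j)) i)) (dist≥ (U i) (U j))))

  ecc≤D : ∀ v → ecc G v ≤ D
  ecc≤D v = maxOver≤ (dist G v) (dist≤D v)

  -- The decomposition made for the upper bound also yields the exact value, once all eccentricities
  -- are known.
  open UpperBound G k d<n ecc≤D U U-dist hiding (D; D₁; o; o≤D; o-mid; o-mid₂; o≥2; o-pair; o-triple; U-inj)

  off-class : ∀ {v} → Off v → ∃ λ b → κ v ≡ inj₂ (false , b)
  off-class {v} off with κ v in e
  ... | inj₁ j = ⊥-elim (off≢ (proj₁ (κ-path e)) off (proj₂ (κ-path e)))
  ... | inj₂ (s , b) with near e
  ...   | refl = b , refl

  on-class : ∀ {v} → OnP v → ∃ λ j → κ v ≡ inj₁ j
  on-class (j , refl) = toℕ j , κ-U (s≤s⁻¹ (Fin.toℕ<n j))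

  E-U : ∀ {i} → i ≤ D → E (U i) ≡ o i
  E-U {i} i≤D = ≤-antisym (maxOver≤ (dist G (U i)) (dist-U i≤D)) (o≤E i≤D)

  E-A : ∀ {v} → κ v ≡ inj₂ (false , false) → E v ≡ D
  E-A {v} ev = ≤-antisym (ecc≤D v) (≤-trans (subst₂ (λ x y → h x ≤ dist G v (U D) + h y) (κ-U ≤-refl) ev (dist≥ v (U D)))
    (≤-trans (≤-reflexive (+-identityʳ _)) (ecc-ub v (U D))))

  E-B : ∀ {v} → κ v ≡ inj₂ (false , true) → E v ≡ D₁
  E-B {v} ev = ≤-antisym (maxOver≤ (dist G v) (dist-B ev)) (≤-trans (s≤s⁻¹ (≤-trans
    (subst₂ (λ x y → h x ≤ dist G v (U D) + h y) (κ-U ≤-refl) ev (dist≥ v (U D))) (≤-reflexive (+-comm _ 1)))) (ecc-ub v (U D)))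

  x≡0 : ∀ {v} → Off v → x v ≡ 0
  x≡0 {v} off = trans (sumO-cong {N v} {λ _ → 0} N≡0) (trans (sumO-const 0) (*-zeroʳ m))
    where
    N≡0 : ∀ w → Off w → N v w ≡ 0
    N≡0 w off′ with v Fin.≟ w
    ... | yes _ = refl
    ... | no ne rewrite adj-κ ne | proj₂ (off-class off) | proj₂ (off-class off′) = refl

  1+dout : ∀ {v} → Off v → 1 + dout v ≡ m
  1+dout {v} off = trans (+-comm 1 (dout v)) (trans (cong (_+ 1) (trans (sym (+-identityʳ (dout v))) (cong (dout v +_) (sym (x≡0 off))))) (dout+x off))

  private
    adj-bit : ∀ {v b} → κ v ≡ inj₂ (false , b) → ∀ j → j ≤ D → a v (U j) ≡ 𝟙 (joined D (false , b) j)
    adj-bit {v} {b} ev j j≤D = cong 𝟙 (trans (adj-κ λ eq → case trans (sym ev) (trans (cong κ eq) (κ-U j≤D)) of λ ())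
      (cong₂ (classAdj D) ev (κ-U j≤D)))

    windowed : ∀ {v b} → κ v ≡ inj₂ (false , b) → ∀ (g : ℕ → ℕ) →
      ∑ (suc D) (λ l → a v (U l) * g l) ≡ 1 * g 0 + 1 * g 1 + 𝟙 (joined D (false , b) 2) * g 2
    windowed {v} {b} ev g = trans (∑-cong (suc D) λ j j≤D → cong (_* g j) (adj-bit ev j (s≤s⁻¹ j≤D)))
      (trans (∑-window (suc D) 0 (λ j → 𝟙 (joined D (false , b) j) * g j) (λ _ ())
        (λ j le → zero-from b j (≤-trans (s≤s (s≤s (s≤s z≤n))) le)) (zero-from b))
        (cong₂ (λ x y → x * g 0 + y * g 1 + 𝟙 (joined D (false , b) 2) * g 2) (head b 0 z≤n) (head b 1 ≤-refl)))
      where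
      zero-from : ∀ b j → 3 ≤ j → 𝟙 (joined D (false , b) j) * g j ≡ 0
      zero-from false (suc (suc j)) _ = refl
      zero-from true (suc (suc (suc j))) _ = refl
      zero-from false 1 (s≤s ())
      zero-from true 1 (s≤s ())
      zero-from true 2 (s≤s (s≤s ()))
      head : ∀ b j → j ≤ 1 → 𝟙 (joined D (false , b) j) ≡ 1
      head false 0 _ = refl
      head false 1 _ = refl
      head true 0 _ = refl
      head true 1 _ = refl
      head b (suc (suc j)) (s≤s ())

  wt-A : ∀ {v} → Off v → κ v ≡ inj₂ (false , false) → wt v ≡ A
  wt-A {v} off ev = begin
    wt v                                          ≡⟨ wt-pair (λ g → trans (windowed ev g) (trans (+-identityʳ _) (cong₂ _+_ (+-identityʳ (g 0)) (+-identityʳ (g 1))))) ⟩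
    E (U 0) + E (U 1) + (1 + (1 + dout v)) * E v  ≡⟨ cong₂ _+_ (cong₂ _+_ (E-U z≤n) (E-U (s≤s z≤n))) (cong₂ (λ x y → (1 + x) * y) (1+dout off) (E-A ev)) ⟩
    D + D₁ + (1 + m) * D                          ≡⟨ cong (_+ (1 + m) * D) (+-comm D D₁) ⟩
    D₁ + D + (1 + m) * D                          ≡⟨ A-form ⟩
    A                                             ∎
    where open ≡-Reasoning

  wt-B : ∀ {v} → Off v → κ v ≡ inj₂ (false , true) → wt v ≡ B
  wt-B {v} off ev = begin
    wt v                                          ≡⟨ wt-triple (λ g → trans (windowed ev g) (cong₂ _+_ (cong₂ _+_ (+-identityʳ (g 0)) (+-identityʳ (g 1))) (+-identityʳ (g 2)))) ⟩
    E (U 0) + E (U 1) + E (U 2) + (2 + (1 + dout v)) * E v  ≡⟨ cong₂ _+_ (cong₂ _+_ (cong₂ _+_ (E-U z≤n) (E-U (s≤s z≤n))) (E-U (s≤s (s≤s z≤n)))) (cong₂ (λ x y → (2 + x) * y) (1+dout off) (E-B ev)) ⟩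
    o 0 + o 1 + o 2 + (2 + m) * D₁                ≡⟨ B-form ⟩
    B                                             ∎
    where open ≡-Reasoning

  private
    cA cB : Fin n → ℕ
    cA v = 𝟙 (does (κ v ≟ᶜ inj₂ (false , false)))
    cB v = 𝟙 (does (κ v ≟ᶜ inj₂ (false , true)))

    sumO-count : ∀ τ → sumO (λ v → 𝟙 (does (κ v ≟ᶜ inj₂ τ))) ≡ count τ
    sumO-count τ = sum-cong {n} pt
      where
      pt : ∀ v → ō v * 𝟙 (does (κ v ≟ᶜ inj₂ τ)) ≡ 𝟙 (does (κ v ≟ᶜ inj₂ τ))
      pt v = [ (λ on → trans (cong (_* 𝟙 (does (κ v ≟ᶜ inj₂ τ))) (ō-on on)) (sym (none on))) , (λ off → trans (cong (_* 𝟙 (does (κ v ≟ᶜ inj₂ τ))) (ō-off off)) (+-identityʳ _)) ]′ (cases (onP? v))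
        where
        cases : Dec (OnP v) → OnP v ⊎ Off v
        cases (yes on) = inj₁ on
        cases (no off) = inj₂ off
        none : OnP v → 𝟙 (does (κ v ≟ᶜ inj₂ τ)) ≡ 0
        none on = cong 𝟙 (dec-false (κ v ≟ᶜ inj₂ τ) λ e → case trans (sym e) (proj₂ (on-class on)) of λ ())

    wt-split : ∀ v → Off v → wt v ≡ A * cA v + B * cB v
    wt-split v off = go (off-class off)
      where
      go : (∃ λ b → κ v ≡ inj₂ (false , b)) → wt v ≡ A * cA v + B * cB v
      go (false , ev) = trans (wt-A off ev) (sym (trans (cong₂ (λ x y → A * x + B * y)
            (cong 𝟙 (dec-true (κ v ≟ᶜ inj₂ (false , false)) ev))
            (cong 𝟙 (dec-false (κ v ≟ᶜ inj₂ (false , true)) λ e → case trans (sym ev) e of λ ())))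
          (trans (cong₂ _+_ (*-identityʳ A) (*-zeroʳ B)) (+-identityʳ A))))
      go (true , ev) = trans (wt-B off ev) (sym (trans (cong₂ (λ x y → A * x + B * y)
            (cong 𝟙 (dec-false (κ v ≟ᶜ inj₂ (false , false)) λ e → case trans (sym ev) e of λ ()))
            (cong 𝟙 (dec-true (κ v ≟ᶜ inj₂ (false , true)) ev)))
          (cong₂ _+_ (*-zeroʳ A) (*-identityʳ B))))

  off-count : ∀ {m′} → n ≡ suc D + m′ → m ≡ m′
  off-count eq = +-cancelˡ-≡ (suc D) _ _ (trans (sym n≡) eq)

  ξc-oneSided : ∀ {m′} → n ≡ suc D + m′ →
    ξc G ≡ base D + (valA k m′ * count (false , false) + valB k m′ * count (false , true))
  ξc-oneSided eq = subst (λ z → ξc G ≡ base D + (valA k z * count (false , false) + valB k z * count (false , true))) (off-count eq) (begin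
    ξc G                                                        ≡⟨ decomposition ⟩
    ∑ (suc D) (λ i → dp i * E (U i)) + sumO wt                  ≡⟨ cong₂ _+_ (∑-cong (suc D) λ i i≤D → cong₂ _*_ (dp≡ (s≤s⁻¹ i≤D)) (E-U (s≤s⁻¹ i≤D))) (sumO-cong wt-split) ⟩
    base D + sumO (λ v → A * cA v + B * cB v)                   ≡⟨ cong (base D +_) (trans (sumO-+ (λ v → A * cA v) (λ v → B * cB v)) (cong₂ _+_ (sumO-*ˡ A cA) (sumO-*ˡ B cB))) ⟩
    base D + (A * sumO cA + B * sumO cB)                        ≡⟨ cong₂ (λ x y → base D + (A * x + B * y)) (sumO-count (false , false)) (sumO-count (false , true)) ⟩
    base D + (A * count (false , false) + B * count (false , true)) ∎)
    where open ≡-Reasoning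

-- The graphs G_{n,D,k}, H₂ and H₃

≤ᵇ-true : ∀ {i j} → i ≤ j → (i ≤ᵇ j) ≡ true
≤ᵇ-true le = Equivalence.to T-≡ (≤⇒≤ᵇ le)

¬true⇒false : ∀ {b} → ¬ b ≡ true → b ≡ false
¬true⇒false {true} h = ⊥-elim (h refl)
¬true⇒false {false} _ = refl

≤ᵇ-false : ∀ {i j} → ¬ i ≤ j → (i ≤ᵇ j) ≡ false
≤ᵇ-false {i} {j} nle = ¬true⇒false λ e → nle (≤ᵇ⇒≤ i j (Equivalence.from T-≡ e))

≡ᵇ-false : ∀ {i j} → ¬ i ≡ j → (i ≡ᵇ j) ≡ false
≡ᵇ-false {i} {j} ne = ¬true⇒false λ e → ne (≡ᵇ-true⁻ i j e)

sadj-≢ : ∀ {n} (e : Fin n → Fin n → Bool) {u v} → u ≢ v → sadj e u v ≡ e u v ∨ e v u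
sadj-≢ e {u} {v} ne with u Fin.≟ v
... | yes eq = ⊥-elim (ne eq)
... | no _ = refl

-- `q` clique vertices are joined to u₂ and `r` are not; writing the order as a sum avoids truncated
-- subtraction.
module Broom (D q r : ℕ) where

  cls : ℕ → Class
  cls a = if a ≤ᵇ D then inj₁ a else inj₂ (false , (a <ᵇ suc (D + q)))

  cls-on : ∀ {a} → a ≤ D → cls a ≡ inj₁ a
  cls-on {a} a≤D = cong (λ b → if b then inj₁ a else inj₂ (false , (a <ᵇ suc (D + q)))) (≤ᵇ-true a≤D)

  cls-off : ∀ {a} → ¬ a ≤ D → cls a ≡ inj₂ (false , (a <ᵇ suc (D + q)))
  cls-off {a} a≰D = cong (λ b → if b then inj₁ a else inj₂ (false , (a <ᵇ suc (D + q)))) (≤ᵇ-false a≰D)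

  -- The Boolean skeleton of `GEdge`, which allows its tests to be replaced one by one with `cong`.
  edge : (consecutive onPath clique clique′ first second third : Bool) → Bool
  edge c p x y f s t = (c ∧ p) ∨ (x ∧ y) ∨ (x ∧ f) ∨ (x ∧ s ∧ t)

  GEdge-on : ∀ {a b} → a ≤ D → GEdge D q a b ≡ (b ≡ᵇ suc a) ∧ (b ≤ᵇ D)
  GEdge-on {a} {b} a≤D = trans
    (cong (λ x → edge (b ≡ᵇ suc a) (b ≤ᵇ D) x (suc D ≤ᵇ b) ((b ≡ᵇ 0) ∨ (b ≡ᵇ 1)) (a <ᵇ suc (D + q)) (b ≡ᵇ 2)) (≤ᵇ-false (≤⇒≯ a≤D)))
    (∨-identityʳ ((b ≡ᵇ suc a) ∧ (b ≤ᵇ D)))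

  GEdge-off-on : ∀ {a b} → ¬ a ≤ D → b ≤ D → GEdge D q a b ≡ joined D (false , (a <ᵇ suc (D + q))) b
  GEdge-off-on {a} {b} a≰D b≤D = trans
    (trans (cong (λ x → edge x (b ≤ᵇ D) (suc D ≤ᵇ a) (suc D ≤ᵇ b) ((b ≡ᵇ 0) ∨ (b ≡ᵇ 1)) (a <ᵇ suc (D + q)) (b ≡ᵇ 2))
             (≡ᵇ-false {b} {suc a} λ eq → <⇒≱ (≰⇒> a≰D) (≤-trans (n≤1+n a) (subst (_≤ D) eq b≤D))))
      (cong₂ (λ x y → edge false (b ≤ᵇ D) x y ((b ≡ᵇ 0) ∨ (b ≡ᵇ 1)) (a <ᵇ suc (D + q)) (b ≡ᵇ 2)) (≤ᵇ-true (≰⇒> a≰D)) (≤ᵇ-false (≤⇒≯ b≤D))))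
    (table (a <ᵇ suc (D + q)) b)
    where
    table : ∀ t b → ((b ≡ᵇ 0) ∨ (b ≡ᵇ 1)) ∨ (t ∧ (b ≡ᵇ 2)) ≡ joined D (false , t) b
    table false 0 = refl
    table false 1 = refl
    table false (suc (suc b)) = refl
    table true 0 = refl
    table true 1 = refl
    table true 2 = refl
    table true (suc (suc (suc b))) = refl

  GEdge-off-off : ∀ {a b} → ¬ a ≤ D → ¬ b ≤ D → GEdge D q a b ≡ true
  GEdge-off-off {a} {b} a≰D b≰D = trans
    (cong₂ (λ x y → edge (b ≡ᵇ suc a) (b ≤ᵇ D) x y ((b ≡ᵇ 0) ∨ (b ≡ᵇ 1)) (a <ᵇ suc (D + q)) (b ≡ᵇ 2)) (≤ᵇ-true (≰⇒> a≰D)) (≤ᵇ-true (≰⇒> b≰D)))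
    (∨-zeroʳ ((b ≡ᵇ suc a) ∧ (b ≤ᵇ D)))

  GEdge-class : ∀ a b → GEdge D q a b ∨ GEdge D q b a ≡ classAdj D (cls a) (cls b)
  GEdge-class a b with a ≤? D | b ≤? D
  ... | yes a≤D | yes b≤D = trans (cong₂ _∨_ (on a≤D b≤D) (on b≤D a≤D)) (trans (∨-comm (b ≡ᵇ suc a) (a ≡ᵇ suc b))
          (trans (cong ((a ≡ᵇ suc b) ∨_) (≡ᵇ-sym b (suc a))) (sym (cong₂ (classAdj D) (cls-on a≤D) (cls-on b≤D)))))
    where
    on : ∀ {a b} → a ≤ D → b ≤ D → GEdge D q a b ≡ (b ≡ᵇ suc a)
    on {a} {b} a≤D b≤D = trans (GEdge-on {a} {b} a≤D) (trans (cong ((b ≡ᵇ suc a) ∧_) (≤ᵇ-true b≤D)) (∧-identityʳ _))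
  ... | yes a≤D | no b≰D = trans (cong₂ _∨_ (trans (GEdge-on {a} {b} a≤D) (trans (cong ((b ≡ᵇ suc a) ∧_) (≤ᵇ-false b≰D)) (∧-zeroʳ _))) (GEdge-off-on b≰D a≤D))
          (sym (cong₂ (classAdj D) (cls-on a≤D) (cls-off b≰D)))
  ... | no a≰D | yes b≤D = trans (cong₂ _∨_ (GEdge-off-on a≰D b≤D) (trans (GEdge-on {b} {a} b≤D) (trans (cong ((a ≡ᵇ suc b) ∧_) (≤ᵇ-false a≰D)) (∧-zeroʳ _))))
          (trans (∨-identityʳ _) (sym (cong₂ (classAdj D) (cls-off a≰D) (cls-on b≤D))))
  ... | no a≰D | no b≰D = trans (cong (_∨ GEdge D q b a) (GEdge-off-off a≰D b≰D)) (sym (cong₂ (classAdj D) (cls-off a≰D) (cls-off b≰D)))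

  n : ℕ
  n = suc D + (q + r)

  layout : Layout (Gnk n D q) D
  layout = record
    { U = U
    ; κ = cls ∘ toℕ
    ; κ-U = λ j≤D → trans (cong cls (toℕ-U j≤D)) (cls-on j≤D)
    ; κ-path = λ {v} {j} → path v j
    ; adj-κ = λ {u} {v} ne → trans (sadj-≢ (λ a b → GEdge D q (toℕ a) (toℕ b)) ne) (GEdge-class (toℕ u) (toℕ v))
    }
    where
    U : ℕ → Fin n
    U j = Fin.fromℕ< (s≤s (m⊓n≤n j (D + (q + r))))
    toℕ-U : ∀ {j} → j ≤ D → toℕ (U j) ≡ j
    toℕ-U {j} j≤D = trans (Fin.toℕ-fromℕ< _) (m≤n⇒m⊓n≡m (≤-trans j≤D (m≤m+n D (q + r))))
    path : ∀ v j → cls (toℕ v) ≡ inj₁ j → j ≤ D × U j ≡ v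
    path v j e with toℕ v ≤? D
    ... | no nle = case trans (sym e) (cls-off nle) of λ ()
    ... | yes le with Sum.inj₁-injective (trans (sym e) (cls-on le))
    ...   | refl = le , Fin.toℕ-injective (toℕ-U le)

  near : ∀ {v s b} → Layout.κ layout v ≡ inj₂ (s , b) → s ≡ false
  near {v} e with toℕ v ≤? D
  ... | yes le = case trans (sym e) (cls-on le) of λ ()
  ... | no nle = sym (cong proj₁ (Sum.inj₂-injective (trans (sym (cls-off nle)) e)))

  private
    cls-B : ∀ {i} → i < q → cls (suc D + i) ≡ inj₂ (false , true)
    cls-B {i} i<q = trans (cls-off (<⇒≱ (m≤m+n (suc D) i))) (cong (λ b → inj₂ (false , b)) (≤ᵇ-true {suc (suc D + i)} (s≤s (≤-trans (≤-reflexive (sym (+-suc D i))) (+-monoʳ-≤ D i<q)))))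

    cls-A : ∀ i → cls (suc D + (q + i)) ≡ inj₂ (false , false)
    cls-A i = trans (cls-off (<⇒≱ (m≤m+n (suc D) (q + i)))) (cong (λ b → inj₂ (false , b)) (≤ᵇ-false {suc (suc D + (q + i))} λ le →
      <⇒≱ (s≤s⁻¹ le) (≤-trans (m≤m+n (D + q) i) (≤-reflexive (+-assoc D q i)))))

  count-parts : ∀ τ → Layout.count layout τ ≡
    q * 𝟙 (does (inj₂ {A = ℕ} (false , true) ≟ᶜ inj₂ τ)) + r * 𝟙 (does (inj₂ {A = ℕ} (false , false) ≟ᶜ inj₂ τ))
  count-parts τ = begin
    sum {n} (g ∘ toℕ)
      ≡⟨ ∑-Fin n g ⟨
    ∑ n g
      ≡⟨ ∑-split (suc D) (q + r) g ⟩
    ∑ (suc D) g + ∑ (q + r) (λ i → g (suc D + i))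
      ≡⟨ cong₂ _+_ (∑-zero (suc D) λ i i≤D → cong (λ c → 𝟙 (does (c ≟ᶜ inj₂ τ))) (cls-on (s≤s⁻¹ i≤D))) (∑-split q r (λ i → g (suc D + i))) ⟩
    ∑ q (λ i → g (suc D + i)) + ∑ r (λ i → g (suc D + (q + i)))
      ≡⟨ cong₂ _+_ (∑-cong q λ i i<q → cong (λ c → 𝟙 (does (c ≟ᶜ inj₂ τ))) (cls-B i<q)) (∑-cong r λ i _ → cong (λ c → 𝟙 (does (c ≟ᶜ inj₂ τ))) (cls-A i)) ⟩
    ∑ q (λ _ → 𝟙 (does (inj₂ {A = ℕ} (false , true) ≟ᶜ inj₂ τ))) + ∑ r (λ _ → 𝟙 (does (inj₂ {A = ℕ} (false , false) ≟ᶜ inj₂ τ)))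
      ≡⟨ cong₂ _+_ (∑-const q _) (∑-const r _) ⟩
    q * 𝟙 (does (inj₂ {A = ℕ} (false , true) ≟ᶜ inj₂ τ)) + r * 𝟙 (does (inj₂ {A = ℕ} (false , false) ≟ᶜ inj₂ τ)) ∎
    where
    open ≡-Reasoning
    g : ℕ → ℕ
    g a = 𝟙 (does (cls a ≟ᶜ inj₂ τ))

ξc-Gnk : ∀ k q r → ξc (Gnk (4 + k + (q + r)) (3 + k) q) ≡ base (3 + k) + (valA k (q + r) * r + valB k (q + r) * q)
ξc-Gnk k q r = trans (OneSided.ξc-oneSided layout near refl)
  (cong₂ (λ x y → base (3 + k) + (valA k (q + r) * x + valB k (q + r) * y))
    (trans (count-parts (false , false)) (cong₂ _+_ (*-zeroʳ q) (*-identityʳ r)))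
    (trans (count-parts (false , true)) (trans (cong₂ _+_ (*-identityʳ q) (*-zeroʳ r)) (+-identityʳ q))))
  where open Broom (3 + k) q r

-- The value of `f`

mix : ℕ → ℕ → ℕ → ℕ
mix k q r = valA k (q + r) * r + valB k (q + r) * q

mix≤ : ∀ k q r → mix k q r ≤ (q + r) * valM k (q + r)
mix≤ k q r = begin
  valA k (q + r) * r + valB k (q + r) * q   ≤⟨ +-mono-≤ (*-monoˡ-≤ r (m≤m⊔n (valA k (q + r)) (valB k (q + r)))) (*-monoˡ-≤ q (m≤n⊔m (valA k (q + r)) (valB k (q + r)))) ⟩
  M * r + M * q                             ≡⟨ arith M q r ⟩
  (q + r) * M                               ∎
  where
  open ≤-Reasoning
  M = valM k (q + r)
  arith : ∀ M q r → M * r + M * q ≡ (q + r) * M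
  arith = solve-∀

-- Only a kind that occurs has to be a heaviest one; hence the conditions on `r` and `q`.
mix-tight : ∀ k q r → (1 ≤ r → valB k (q + r) ≤ valA k (q + r)) → (1 ≤ q → valA k (q + r) ≤ valB k (q + r)) →
  mix k q r ≡ (q + r) * valM k (q + r)
mix-tight k q r hA hB = begin
  valA k (q + r) * r + valB k (q + r) * q   ≡⟨ cong₂ _+_ (scale r {valA k (q + r)} {M} (λ 1≤r → m≥n⇒m⊔n≡m (hA 1≤r))) (scale q {valB k (q + r)} {M} (λ 1≤q → m≤n⇒m⊔n≡n (hB 1≤q))) ⟩
  M * r + M * q                             ≡⟨ arith M q r ⟩
  (q + r) * M                               ∎
  where
  open ≡-Reasoning
  M = valM k (q + r)
  scale : ∀ r {x y} → (1 ≤ r → y ≡ x) → x * r ≡ y * r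
  scale zero {x} {y} _ = trans (*-zeroʳ x) (sym (*-zeroʳ y))
  scale (suc r) h = cong (_* suc r) (sym (h (s≤s z≤n)))
  arith : ∀ M q r → M * r + M * q ≡ (q + r) * M
  arith = solve-∀

max-ub : ∀ (g h : ℕ → ℕ) N {i} → i < N → g (h i) ≤ foldr _⊔_ 0 (map g (applyUpTo h N))
max-ub g h (suc N) {zero} _ = m≤m⊔n _ _
max-ub g h (suc N) {suc i} (s≤s lt) = ≤-trans (max-ub g (h ∘ suc) N lt) (m≤n⊔m (g (h 0)) _)

max-lub : ∀ (g h : ℕ → ℕ) N {b} → (∀ i → i < N → g (h i) ≤ b) → foldr _⊔_ 0 (map g (applyUpTo h N)) ≤ b
max-lub g h zero _ = z≤n
max-lub g h (suc N) le = ⊔-lub (le 0 (s≤s z≤n)) (max-lub g (h ∘ suc) N λ i lt → le (suc i) (s≤s lt))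

f-max : ∀ n D {b q} → (∀ i → i < n ∸ D → ξc (Gnk n D i) ≤ b) → q < n ∸ D → b ≤ ξc (Gnk n D q) → f n D ≡ b
f-max n D ub q< b≤ = ≤-antisym (max-lub (λ i → ξc (Gnk n D i)) id (n ∸ D) ub)
  (≤-trans b≤ (max-ub (λ i → ξc (Gnk n D i)) id (n ∸ D) q<))

-- With `q + r ≡ m` fixed, `mix` is linear in `q`, so its maximum lies at `q = 0` or at `q = m`,
-- according to the larger of `valA` and `valB`.
f-value : ∀ k m → f (4 + k + m) (3 + k) ≡ base (3 + k) + m * valM k m
f-value k m = [ (λ B≤A → at 0 m refl (mix-tight k 0 m (λ _ → B≤A) (λ ())))
              , (λ A≤B → at m 0 (+-identityʳ m) (trans (mix-tight k m 0 (λ ()) (λ _ → subst (λ z → valA k z ≤ valB k z) (sym (+-identityʳ m)) A≤B))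
                  (cong (λ z → z * valM k z) (+-identityʳ m)))) ]′ (≤-total (valB k m) (valA k m))
  where
  -- The list `upTo (n ∸ D)` in `f` stops before `suc m`, so `q` runs from 0 to `m`.
  size : 4 + k + m ∸ (3 + k) ≡ suc m
  size = trans (cong (_∸ (3 + k)) (sym (+-suc (3 + k) m))) (m+n∸m≡n (3 + k) (suc m))
  ξ-value : ∀ {q r} → q + r ≡ m → ξc (Gnk (4 + k + m) (3 + k) q) ≡ base (3 + k) + mix k q r
  ξ-value {q} {r} eq = subst (λ z → ξc (Gnk (4 + k + z) (3 + k) q) ≡ base (3 + k) + mix k q r) eq (ξc-Gnk k q r)
  each : ∀ q → q < 4 + k + m ∸ (3 + k) → ξc (Gnk (4 + k + m) (3 + k) q) ≤ base (3 + k) + m * valM k m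
  each q q< = ≤-trans (≤-reflexive (ξ-value eq)) (+-monoʳ-≤ (base (3 + k))
      (≤-trans (mix≤ k q (m ∸ q)) (≤-reflexive (cong (λ z → z * valM k z) eq))))
    where
    eq : q + (m ∸ q) ≡ m
    eq = m+[n∸m]≡n (s≤s⁻¹ (subst (q <_) size q<))
  at : ∀ q r → q + r ≡ m → mix k q r ≡ m * valM k m → f (4 + k + m) (3 + k) ≡ base (3 + k) + m * valM k m
  at q r eq e = f-max (4 + k + m) (3 + k) each (subst (q <_) (sym size) (s≤s (subst (q ≤_) eq (m≤m+n q r))))
    (≤-reflexive (sym (trans (ξ-value eq) (cong (base (3 + k) +_) e))))

opaque
  unfolding ∑

  base-3 : base 3 ≡ 14
  base-3 = refl

layout-H₂ : Layout H₂ 3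
layout-H₂ = record
  { U = U ; κ = κ ; κ-U = λ {j} → κ-U j ; κ-path = λ {v} → κ-path v
  ; adj-κ = λ {u} {v} → toWitness {a? = Fin.all? λ u → Fin.all? λ v → ¬? (u Fin.≟ v) →-dec (adj H₂ u v Bool.≟ classAdj 3 (κ u) (κ v))} _ u v }
  where
  U : ℕ → Fin 6
  U 0 = 0F
  U 1 = 1F
  U 2 = 2F
  U _ = 3F
  κ : Fin 6 → Class
  κ 4F = inj₂ (false , true)
  κ 5F = inj₂ (true , true)
  κ v = inj₁ (toℕ v)
  κ-U : ∀ j → j ≤ 3 → κ (U j) ≡ inj₁ j
  κ-U 0 _ = refl
  κ-U 1 _ = refl
  κ-U 2 _ = refl
  κ-U 3 _ = refl
  κ-U (suc (suc (suc (suc _)))) (s≤s (s≤s (s≤s ())))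
  κ-path : ∀ v {j} → κ v ≡ inj₁ j → j ≤ 3 × U j ≡ v
  κ-path 0F refl = z≤n , refl
  κ-path 1F refl = s≤s z≤n , refl
  κ-path 2F refl = s≤s (s≤s z≤n) , refl
  κ-path 3F refl = ≤-refl , refl
  κ-path 4F ()
  κ-path 5F ()

-- The diametral path is 5, 0, 3, 6. Of the other vertices, 1 and 2 are joined to 5, 0, 3 and vertex
-- 4 to 0, 3, 6.
layout-H₃ : Layout H₃ 3
layout-H₃ = record
  { U = U ; κ = κ ; κ-U = λ {j} → κ-U j ; κ-path = λ {v} → κ-path v
  ; adj-κ = λ {u} {v} → toWitness {a? = Fin.all? λ u → Fin.all? λ v → ¬? (u Fin.≟ v) →-dec (adj H₃ u v Bool.≟ classAdj 3 (κ u) (κ v))} _ u v }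
  where
  U : ℕ → Fin 7
  U 0 = 5F
  U 1 = 0F
  U 2 = 3F
  U _ = 6F
  κ : Fin 7 → Class
  κ 0F = inj₁ 1
  κ 1F = inj₂ (false , true)
  κ 2F = inj₂ (false , true)
  κ 3F = inj₁ 2
  κ 4F = inj₂ (true , true)
  κ 5F = inj₁ 0
  κ 6F = inj₁ 3
  κ-U : ∀ j → j ≤ 3 → κ (U j) ≡ inj₁ j
  κ-U 0 _ = refl
  κ-U 1 _ = refl
  κ-U 2 _ = refl
  κ-U 3 _ = refl
  κ-U (suc (suc (suc (suc _)))) (s≤s (s≤s (s≤s ())))
  κ-path : ∀ v {j} → κ v ≡ inj₁ j → j ≤ 3 × U j ≡ v
  κ-path 0F refl = s≤s z≤n , refl
  κ-path 1F ()
  κ-path 2F ()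
  κ-path 3F refl = s≤s (s≤s z≤n) , refl
  κ-path 4F ()
  κ-path 5F refl = z≤n , refl
  κ-path 6F refl = ≤-refl , refl

ξc-H₂ : ξc H₂ ≡ 44
ξc-H₂ = refl

ξc-H₃ : ξc H₃ ≡ 65
ξc-H₃ = refl

-- A clique vertex joined to u₂ weighs at least as much as one that is not iff m ≤ threshold k.
threshold : ℕ → ℕ
threshold zero = 3
threshold (suc k) = 4 + 2 * k

private
  -- What the two weights share; the remainders are `m` for `valA` and `threshold k` for `valB`.
  common : ℕ → ℕ → ℕ
  common k m = (2 + k) * (m + 2) + (4 + k)

  valA-common : ∀ k m → valA k m ≡ common k m + m
  valA-common = arith
    where
    arith : ∀ k m → (2 + k) + (3 + k) * (m + 2) ≡ (2 + k) * (m + 2) + (4 + k) + m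
    arith = solve-∀

  valB-common : ∀ k m → valB k m ≡ common k m + threshold k
  valB-common zero m = arith m
    where
    arith : ∀ m → 2 * (m + 2) + 7 ≡ 2 * (m + 2) + 4 + 3
    arith = solve-∀
  valB-common (suc k) m = arith k m
    where
    arith : ∀ k m → (3 + k) * (m + 2) + (4 + k + (3 + k) + (2 + k)) ≡ (3 + k) * (m + 2) + (5 + k) + (4 + 2 * k)
    arith = solve-∀

A≤B⇒ : ∀ k m → valA k m ≤ valB k m → m ≤ threshold k
A≤B⇒ k m le = +-cancelˡ-≤ (common k m) _ _ (subst₂ _≤_ (valA-common k m) (valB-common k m) le)

A≤B⇐ : ∀ k m → m ≤ threshold k → valA k m ≤ valB k m
A≤B⇐ k m le = subst₂ _≤_ (sym (valA-common k m)) (sym (valB-common k m)) (+-monoʳ-≤ (common k m) le)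

B≤A⇒ : ∀ k m → valB k m ≤ valA k m → threshold k ≤ m
B≤A⇒ k m le = +-cancelˡ-≤ (common k m) _ _ (subst₂ _≤_ (valB-common k m) (valA-common k m) le)

B≤A⇐ : ∀ k m → threshold k ≤ m → valB k m ≤ valA k m
B≤A⇐ k m le = subst₂ _≤_ (sym (valB-common k m)) (sym (valA-common k m)) (+-monoʳ-≤ (common k m) le)

-- The class in terms of the threshold

clique-size : ∀ k m → 4 + k + m ∸ (3 + k) ∸ 1 ≡ m
clique-size k m = cong (_∸ 1) (trans (cong (_∸ (3 + k)) (sym (+-suc (3 + k) m))) (m+n∸m≡n (3 + k) (suc m)))

-- With `D = 4 + k` and `n = 5 + k + m`, comparing `n` with `3 * (D ∸ 1)` amounts to comparing `m`
-- with `threshold (suc k)`.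
bound-split : ∀ k → 3 * (3 + k) ≡ 5 + k + (4 + 2 * k)
bound-split = solve-∀

-- `hA` and `hB` admit a kind only if it is not the lighter one: below the threshold `r = 0`, above
-- it `q = 0`, at the threshold any `q`. For `D = 3` the threshold is 3, so the orders 4, 5 and 6
-- lie below it.
Gnk⇒InClass : ∀ k m {q r} (G : Graph (4 + k + m)) → q + r ≡ m → G ≅ Gnk (4 + k + m) (3 + k) q →
  (1 ≤ r → threshold k ≤ m) → (1 ≤ q → m ≤ threshold k) → InClass (4 + k + m) (3 + k) G
Gnk⇒InClass zero 0 {zero} G eq iso hA hB = inj₁ (refl , inj₁ refl , iso)
Gnk⇒InClass zero 1 {suc zero} G eq iso hA hB = inj₁ (refl , inj₂ refl , iso)
Gnk⇒InClass zero 1 {zero} {suc r} G refl iso hA hB with hA (s≤s z≤n)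
... | s≤s ()
Gnk⇒InClass zero 2 {suc (suc zero)} G eq iso hA hB = inj₂ (inj₁ (refl , refl , inj₁ iso))
Gnk⇒InClass zero 2 {zero} {suc r} G refl iso hA hB with hA (s≤s z≤n)
... | s≤s (s≤s ())
Gnk⇒InClass zero 2 {suc zero} {suc r} G refl iso hA hB with hA (s≤s z≤n)
... | s≤s (s≤s ())
Gnk⇒InClass zero 3 {q} {r} G eq iso hA hB = inj₂ (inj₂ (inj₁ (refl , refl , inj₁ (q , subst (q ≤_) eq (m≤m+n q r) , iso))))
Gnk⇒InClass zero (suc (suc (suc (suc m)))) {zero} G eq iso hA hB =
  inj₂ (inj₂ (inj₂ (inj₁ (refl , s≤s (s≤s (s≤s (s≤s (s≤s (s≤s (s≤s (s≤s z≤n))))))) , iso))))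
Gnk⇒InClass zero (suc (suc (suc (suc m)))) {suc q} G eq iso hA hB with hB (s≤s z≤n)
... | s≤s (s≤s (s≤s ()))
Gnk⇒InClass (suc k) m {q} {r} G eq iso hA hB with <-cmp m (4 + 2 * k)
... | tri< m< _ _ = inj₂ (inj₂ (inj₂ (inj₂ (inj₁ (s≤s (s≤s (s≤s (s≤s z≤n))) ,
        subst (5 + k + m <_) (sym (bound-split k)) (+-monoʳ-< (5 + k) m<) ,
        subst (λ z → G ≅ Gnk (5 + k + m) (4 + k) z) (trans q≡m (sym (clique-size (suc k) m))) iso)))))
  where
  r≡0 : ∀ r → (1 ≤ r → 4 + 2 * k ≤ m) → r ≡ 0
  r≡0 zero _ = refl
  r≡0 (suc r) h = ⊥-elim (<⇒≱ m< (h (s≤s z≤n)))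
  q≡m : q ≡ m
  q≡m = trans (sym (+-identityʳ q)) (trans (cong (q +_) (sym (r≡0 r hA))) eq)
... | tri≈ _ m≡ _ = inj₂ (inj₂ (inj₂ (inj₂ (inj₂ (inj₁ (s≤s (s≤s (s≤s (s≤s z≤n))) ,
        trans (cong (5 + k +_) m≡) (sym (bound-split k)) ,
        q , subst (q ≤_) (trans eq (sym (clique-size (suc k) m))) (m≤m+n q r) , iso))))))
... | tri> _ _ m> = inj₂ (inj₂ (inj₂ (inj₂ (inj₂ (inj₂ (s≤s (s≤s (s≤s (s≤s z≤n))) ,
        subst (_< 5 + k + m) (sym (bound-split k)) (+-monoʳ-< (5 + k) m>) ,
        subst (λ z → G ≅ Gnk (5 + k + m) (4 + k) z) (q≡0 q hB) iso))))))
  where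
  q≡0 : ∀ q → (1 ≤ q → m ≤ 4 + 2 * k) → q ≡ 0
  q≡0 zero _ = refl
  q≡0 (suc q) h = ⊥-elim (<⇒≱ m> (h (s≤s z≤n)))

Gnk-attains : ∀ k m {q r} → q + r ≡ m → (1 ≤ r → threshold k ≤ m) → (1 ≤ q → m ≤ threshold k) →
  ξc (Gnk (4 + k + m) (3 + k) q) ≡ f (4 + k + m) (3 + k)
Gnk-attains k m {q} {r} refl hA hB = trans (ξc-Gnk k q r) (trans
  (cong (base (3 + k) +_) (mix-tight k q r (B≤A⇐ k (q + r) ∘ hA) (A≤B⇐ k (q + r) ∘ hB)))
  (sym (f-value k (q + r))))

f-6-3 : f 6 3 ≡ 44
f-6-3 = trans (f-value 0 2) (cong (_+ 30) base-3)

f-7-3 : f 7 3 ≡ 65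
f-7-3 = trans (f-value 0 3) (cong (_+ 51) base-3)

H₂-attains : ξc H₂ ≡ f 6 3
H₂-attains = trans ξc-H₂ (sym f-6-3)

H₃-attains : ξc H₃ ≡ f 7 3
H₃-attains = trans ξc-H₃ (sym f-7-3)

attains-≅ : ∀ {n} D (G H : Graph n) → G ≅ H → ξc H ≡ f n D → ξc G ≡ f n D
attains-≅ D G H iso = trans (Iso.ξc-iso {G = G} {H} iso)

InClass⇒attains′ : ∀ k m (G : Graph (4 + k + m)) → InClass (4 + k + m) (3 + k) G → ξc G ≡ f (4 + k + m) (3 + k)
InClass⇒attains′ k m G (inj₁ (refl , inj₁ refl , iso)) = attains-≅ 3 G (Gnk 4 3 0) iso (Gnk-attains 0 0 {0} {0} refl (λ ()) (λ ()))
InClass⇒attains′ k m G (inj₁ (refl , inj₂ refl , iso)) = attains-≅ 3 G (Gnk 5 3 1) iso (Gnk-attains 0 1 {1} {0} refl (λ ()) (λ _ → s≤s z≤n))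
InClass⇒attains′ k m G (inj₂ (inj₁ (refl , refl , inj₁ iso))) = attains-≅ 3 G (Gnk 6 3 2) iso (Gnk-attains 0 2 {2} {0} refl (λ ()) (λ _ → s≤s (s≤s z≤n)))
InClass⇒attains′ k m G (inj₂ (inj₁ (refl , refl , inj₂ iso))) = attains-≅ 3 G H₂ iso H₂-attains
InClass⇒attains′ k m G (inj₂ (inj₂ (inj₁ (refl , refl , inj₁ (q , q≤3 , iso))))) =
  attains-≅ 3 G (Gnk 7 3 q) iso (Gnk-attains 0 3 {q} {3 ∸ q} (m+[n∸m]≡n q≤3) (λ _ → ≤-refl) (λ _ → ≤-refl))
InClass⇒attains′ k m G (inj₂ (inj₂ (inj₁ (refl , refl , inj₂ iso)))) = attains-≅ 3 G H₃ iso H₃-attains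
InClass⇒attains′ k m G (inj₂ (inj₂ (inj₂ (inj₁ (refl , 7<n , iso))))) =
  attains-≅ 3 G (Gnk (4 + m) 3 0) iso (Gnk-attains 0 m {0} {m} refl (λ _ → ≤-trans (n≤1+n 3) (+-cancelˡ-≤ 4 4 m 7<n)) (λ ()))
InClass⇒attains′ (suc k) m G (inj₂ (inj₂ (inj₂ (inj₂ (inj₁ (_ , n< , iso)))))) =
  attains-≅ (4 + k) G (Gnk (5 + k + m) (4 + k) (5 + k + m ∸ (4 + k) ∸ 1)) iso (trans (cong (λ q → ξc (Gnk (5 + k + m) (4 + k) q)) (clique-size (suc k) m))
    (Gnk-attains (suc k) m {m} {0} (+-identityʳ m) (λ ()) (λ _ → <⇒≤ (+-cancelˡ-< (5 + k) m (4 + 2 * k) (subst (5 + k + m <_) (bound-split k) n<)))))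
InClass⇒attains′ (suc k) m G (inj₂ (inj₂ (inj₂ (inj₂ (inj₂ (inj₁ (_ , n≡ , q , q≤ , iso))))))) =
  attains-≅ (4 + k) G (Gnk (5 + k + m) (4 + k) q) iso (Gnk-attains (suc k) m {q} {m ∸ q} (m+[n∸m]≡n (subst (q ≤_) (clique-size (suc k) m) q≤))
    (λ _ → ≤-reflexive (sym m≡)) (λ _ → ≤-reflexive m≡))
  where
  m≡ : m ≡ 4 + 2 * k
  m≡ = +-cancelˡ-≡ (5 + k) m (4 + 2 * k) (trans n≡ (bound-split k))
InClass⇒attains′ (suc k) m G (inj₂ (inj₂ (inj₂ (inj₂ (inj₂ (inj₂ (_ , n> , iso))))))) =
  attains-≅ (4 + k) G (Gnk (5 + k + m) (4 + k) 0) iso (Gnk-attains (suc k) m {0} {m} refl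
    (λ _ → <⇒≤ (+-cancelˡ-< (5 + k) (4 + 2 * k) m (subst (_< 5 + k + m) (bound-split k) n>))) (λ ()))
InClass⇒attains′ zero m G (inj₂ (inj₂ (inj₂ (inj₂ (inj₁ (s≤s (s≤s (s≤s ())) , _))))))
InClass⇒attains′ zero m G (inj₂ (inj₂ (inj₂ (inj₂ (inj₂ (inj₁ (s≤s (s≤s (s≤s ())) , _)))))))
InClass⇒attains′ zero m G (inj₂ (inj₂ (inj₂ (inj₂ (inj₂ (inj₂ (s≤s (s≤s (s≤s ())) , _)))))))

InClass⇒attains : ∀ {n} k m → n ≡ 4 + k + m → (G : Graph n) → InClass n (3 + k) G → ξc G ≡ f n (3 + k)
InClass⇒attains k m refl = InClass⇒attains′ k m

-- The extremal graphs

oneSided⇒InClass : ∀ {n} k m → n ≡ 4 + k + m → {G : Graph n} (L : Layout G (3 + k)) →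
  Layout.count L (true , false) ≡ 0 → Layout.count L (true , true) ≡ 0 →
  (1 ≤ Layout.count L (false , false) → threshold k ≤ m) → (1 ≤ Layout.count L (false , true) → m ≤ threshold k) →
  InClass n (3 + k) G
oneSided⇒InClass {n} k m n≡ {G} L c₂ c₃ hA hB = transport {G = G} n≡ q+r≡m iso hA hB
  where
  open Layout L
  q = count (false , true)
  r = count (false , false)
  n≡′ : n ≡ 4 + k + (q + r)
  n≡′ = trans order (cong (4 + k +_) (trans (cong₂ (λ x y → r + q + x + y) c₂ c₃) (arith q r)))
    where
    arith : ∀ q r → r + q + 0 + 0 ≡ q + r
    arith = solve-∀
  q+r≡m : q + r ≡ m
  q+r≡m = +-cancelˡ-≡ (4 + k) (q + r) m (trans (sym n≡′) n≡)
  counts : ∀ τ → count τ ≡ q * 𝟙 (does (inj₂ {A = ℕ} (false , true) ≟ᶜ inj₂ τ)) + r * 𝟙 (does (inj₂ {A = ℕ} (false , false) ≟ᶜ inj₂ τ))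
  counts (false , false) = sym (cong₂ _+_ (*-zeroʳ q) (*-identityʳ r))
  counts (false , true) = sym (trans (cong₂ _+_ (*-identityʳ q) (*-zeroʳ r)) (+-identityʳ q))
  counts (true , false) = trans c₂ (sym (cong₂ _+_ (*-zeroʳ q) (*-zeroʳ r)))
  counts (true , true) = trans c₃ (sym (cong₂ _+_ (*-zeroʳ q) (*-zeroʳ r)))
  -- Generalised over graph and order, so that the equation for `n` can be matched with `refl`.
  Gnk-iso : ∀ {n} {G : Graph n} (L : Layout G (3 + k)) q r → n ≡ 4 + k + (q + r) →
    (∀ τ → Layout.count L τ ≡ q * 𝟙 (does (inj₂ {A = ℕ} (false , true) ≟ᶜ inj₂ τ)) + r * 𝟙 (does (inj₂ {A = ℕ} (false , false) ≟ᶜ inj₂ τ))) →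
    G ≅ Gnk n (3 + k) q
  Gnk-iso L q r refl eq = layout-iso L (Broom.layout (3 + k) q r) λ τ → trans (eq τ) (sym (Broom.count-parts (3 + k) q r τ))
  iso : G ≅ Gnk n (3 + k) q
  iso = Gnk-iso L q r n≡′ counts
  transport : ∀ {n m q r} {G : Graph n} → n ≡ 4 + k + m → q + r ≡ m → G ≅ Gnk n (3 + k) q →
    (1 ≤ r → threshold k ≤ m) → (1 ≤ q → m ≤ threshold k) → InClass n (3 + k) G
  transport {m = m} {G = G} refl = Gnk⇒InClass k m G

twoSided-H₂ : {G : Graph 6} (L : Layout G 3) → Layout.count L (false , false) ≡ 0 → Layout.count L (true , false) ≡ 0 →
  Layout.count L (false , true) ≡ 1 → Layout.count L (true , true) ≡ 1 → G ≅ H₂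
twoSided-H₂ L c₀ c₂ c₁ c₃ = layout-iso L layout-H₂ λ
  { (false , false) → c₀ ; (false , true) → c₁ ; (true , false) → c₂ ; (true , true) → c₃ }

twoSided-H₃ : {G : Graph 7} (L : Layout G 3) → Layout.count L (false , false) ≡ 0 → Layout.count L (true , false) ≡ 0 →
  Layout.count L (false , true) ≡ 2 → Layout.count L (true , true) ≡ 1 → G ≅ H₃
twoSided-H₃ L c₀ c₂ c₁ c₃ = layout-iso L layout-H₃ λ
  { (false , false) → c₀ ; (false , true) → c₁ ; (true , false) → c₂ ; (true , true) → c₃ }

-- At most three vertices with both ends occupied leave the counts (1, 1), (2, 1) and (1, 2); the
-- last becomes the second when the path is reversed.
twoSided⇒InClass : ∀ {n} k m → n ≡ 4 + k + m → {G : Graph n} (L : Layout G (3 + k)) → k ≡ 0 → m ≤ threshold k →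
  Layout.count L (false , false) ≡ 0 → Layout.count L (true , false) ≡ 0 →
  1 ≤ Layout.count L (false , true) → 1 ≤ Layout.count L (true , true) → InClass n (3 + k) G
twoSided⇒InClass .0 m refl L refl m≤3 c₀ c₂ 1≤c₁ 1≤c₃ = cases m (count (false , true)) (count (true , true)) L m≤3 c₀ c₂ refl refl 1≤c₁ 1≤c₃
    (+-cancelˡ-≡ 4 m _ (trans order (cong₂ (λ x y → 4 + (x + count (false , true) + y + count (true , true))) c₀ c₂)))
  where
  open Layout L
  cases : ∀ m b b′ {G : Graph (4 + m)} (L : Layout G 3) → m ≤ 3 → Layout.count L (false , false) ≡ 0 → Layout.count L (true , false) ≡ 0 →
    Layout.count L (false , true) ≡ b → Layout.count L (true , true) ≡ b′ → 1 ≤ b → 1 ≤ b′ → m ≡ 0 + b + 0 + b′ → InClass (4 + m) 3 G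
  cases .2 1 1 L _ c₀ c₂ c₁ c₃ _ _ refl = inj₂ (inj₁ (refl , refl , inj₂ (twoSided-H₂ L c₀ c₂ c₁ c₃)))
  cases .3 2 1 L _ c₀ c₂ c₁ c₃ _ _ refl = inj₂ (inj₂ (inj₁ (refl , refl , inj₂ (twoSided-H₃ L c₀ c₂ c₁ c₃))))
  cases .3 1 2 L _ c₀ c₂ c₁ c₃ _ _ refl = inj₂ (inj₂ (inj₁ (refl , refl , inj₂ (twoSided-H₃ (flipLayout L)
    (trans (flip-count L false false) c₂) (trans (flip-count L true false) c₀)
    (trans (flip-count L false true) c₃) (trans (flip-count L true true) c₁)))))
  cases _ 1 (suc (suc (suc b))) L (s≤s (s≤s (s≤s ()))) c₀ c₂ c₁ c₃ _ _ refl
  cases _ (suc (suc b)) (suc (suc b′)) L m≤3 c₀ c₂ c₁ c₃ _ _ refl = ⊥-elim (<⇒≱ (s≤s (s≤s (subst (2 ≤_) (sym (+-suc (b + 0) (suc b′)))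
    (s≤s (subst (1 ≤_) (sym (+-suc (b + 0) b′)) (s≤s z≤n)))))) m≤3)
  cases _ (suc (suc (suc b))) 1 L (s≤s (s≤s (s≤s le))) c₀ c₂ c₁ c₃ _ _ refl with subst (_≤ 0) (+-comm (b + 0) 1) le
  ... | ()

-- The order n is kept abstract, as sums over Fin (4 + k + m) would unfold.
module Core {n : ℕ} (k m : ℕ) (n≡ : n ≡ 4 + k + m) (G : Graph n) (diam : diameter G ≡ 3 + k) where

  private
    D = 3 + k
    v₀ : Fin n
    v₀ = subst Fin (sym n≡) zero

  ecc≤D : ∀ v → ecc G v ≤ D
  ecc≤D v = subst (ecc G v ≤_) diam (≤maxOver (ecc G) v)

  d<n : ∀ u w → dist G u w < n
  d<n u w = subst (dist G u w <_) (sym n≡) (s≤s (≤-trans (≤maxOver (dist G u) w) (≤-trans (ecc≤D u) (m≤m+n D m))))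

  open Metric G d<n

  u₀ u₁ : Fin n
  u₀ = proj₁ (maxOver-attained (ecc G) v₀)
  u₁ = proj₁ (ecc-far u₀)

  diametral : d u₀ u₁ ≡ D
  diametral = trans (proj₂ (ecc-far u₀)) (trans (proj₂ (maxOver-attained (ecc G) v₀)) diam)

  U : ℕ → Fin n
  U = along (geo u₀ u₁)

  U-dist : ∀ {i j} → i ≤ j → j ≤ D → dist G (U i) (U j) ≡ j ∸ i
  U-dist i≤j j≤D = along-dist u₀ u₁ i≤j (subst (_ ≤_) (sym diametral) j≤D)

  module UB = UpperBound G k d<n ecc≤D U U-dist

  m≡ : UB.m ≡ m
  m≡ = +-cancelˡ-≡ (suc D) UB.m m (trans (sym UB.n≡) n≡)

  bound≡f : base D + UB.m * UB.M ≡ f n D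
  bound≡f = trans (cong (λ z → base D + z * valM k z) m≡) (trans (sym (f-value k m)) (cong (λ z → f z D) (sym n≡)))

  ξ≤f : ξc G ≤ f n D
  ξ≤f = ≤-trans (m≤m+n (ξc G) UB.#W) (≤-trans UB.main-bound (≤-reflexive bound≡f))

  module _ (eq : ξc G ≡ f n D) where

    module EL = EqualityLayout G k d<n ecc≤D U U-dist (≤-reflexive (trans bound≡f (sym eq)))

    private
      L : Layout G D
      L = EL.layout
      L⁻ : Layout G D
      L⁻ = flipLayout L
      module L = Layout L
      module L⁻ = Layout L⁻

    A-heavy : ∀ s → 1 ≤ L.count (s , false) → threshold k ≤ m
    A-heavy s le = B≤A⇒ k m (subst (λ z → valB k z ≤ valA k z) m≡ (proj₂ (EL.typeA-facts (proj₂ (L.count-∃ le)))))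

    B-heavy : ∀ s → 1 ≤ L.count (s , true) → m ≤ threshold k
    B-heavy s le = A≤B⇒ k m (subst (λ z → valA k z ≤ valB k z) m≡ (EL.typeB-facts (proj₂ (L.count-∃ le))))

    -- A vertex of kind A has eccentricity `D`, but a vertex at the other end would shorten its way
    -- to `U D`.
    no-A-opposite : ∀ {b} → 1 ≤ L.count (false , false) → ¬ 1 ≤ L.count (true , b)
    no-A-opposite leA le = <⇒≱ (≤-reflexive (sym (proj₁ (EL.typeA-facts ev))))
      (Walks.opposite-ecc L (s≤s (s≤s (s≤s z≤n))) ev (proj₂ (L.count-∃ le)))
      where ev = proj₂ (L.count-∃ leA)

    no-A-opposite⁻ : ∀ {b} → 1 ≤ L.count (true , false) → ¬ 1 ≤ L.count (false , b)
    no-A-opposite⁻ {b} leA le = <⇒≱ (≤-reflexive (sym (proj₁ (EL.typeA-facts ev))))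
      (Walks.opposite-ecc L⁻ (s≤s (s≤s (s≤s z≤n))) (cong (flipClass D) ev) (cong (flipClass D) (proj₂ (L.count-∃ le))))
      where ev = proj₂ (L.count-∃ leA)

    k≡0 : 1 ≤ L.count (false , true) → 1 ≤ L.count (true , true) → k ≡ 0
    k≡0 le le′ = n≤0⇒n≡0 (+-cancelˡ-≤ 3 k 0 (≤-trans (≤-reflexive (sym (U-dist z≤n ≤-refl)))
      (Walks.opposite-short L (proj₂ (L.count-∃ le)) (proj₂ (L.count-∃ le′)))))

    -- `side L` looks for vertices at the far end and `side L⁻` for vertices at the near end. If one
    -- end is empty, the graph is some `Gnk`, after reversal if necessary; if both are occupied,
    -- kind A is excluded at either end.
    classify : InClass n D G
    classify = split (side L) (side L⁻)
      where
      side : (L : Layout G D) → (Layout.count L (true , false) ≡ 0 × Layout.count L (true , true) ≡ 0) ⊎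
        (1 ≤ Layout.count L (true , false) ⊎ 1 ≤ Layout.count L (true , true))
      side L = go (Layout.count L (true , false)) (Layout.count L (true , true))
        where
        go : ∀ x y → (x ≡ 0 × y ≡ 0) ⊎ (1 ≤ x ⊎ 1 ≤ y)
        go zero zero = inj₁ (refl , refl)
        go (suc x) y = inj₂ (inj₁ (s≤s z≤n))
        go zero (suc y) = inj₂ (inj₂ (s≤s z≤n))
      none : ∀ x → ¬ 1 ≤ x → x ≡ 0
      none zero _ = refl
      none (suc x) h = ⊥-elim (h (s≤s z≤n))
      unflip : ∀ {s b} → 1 ≤ L⁻.count (s , b) → 1 ≤ L.count (not s , b)
      unflip {s} {b} = subst (1 ≤_) (flip-count L s b)
      both : 1 ≤ L.count (true , true) → 1 ≤ L.count (false , true) → InClass n D G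
      both le′ le = twoSided⇒InClass k m n≡ L (k≡0 le le′) (B-heavy true le′) (none _ λ z → no-A-opposite z le′) (none _ λ z → no-A-opposite⁻ z le) le le′
      split : _ → _ → InClass n D G
      split (inj₁ (c₂ , c₃)) _ = oneSided⇒InClass k m n≡ L c₂ c₃ (A-heavy false) (B-heavy false)
      split (inj₂ _) (inj₁ (c₂ , c₃)) = oneSided⇒InClass k m n≡ L⁻ c₂ c₃ (A-heavy true ∘ unflip) (B-heavy true ∘ unflip)
      split (inj₂ (inj₁ le)) (inj₂ (inj₁ le′)) = ⊥-elim (no-A-opposite⁻ le (unflip le′))
      split (inj₂ (inj₁ le)) (inj₂ (inj₂ le′)) = ⊥-elim (no-A-opposite⁻ le (unflip le′))
      split (inj₂ (inj₂ le)) (inj₂ (inj₁ le′)) = ⊥-elim (no-A-opposite (unflip le′) le)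
      split (inj₂ (inj₂ le)) (inj₂ (inj₂ le′)) = both le (unflip le′)

theorem4 : (n D : ℕ) (G : Graph n) → 4 ≤ n → 3 ≤ D → D ≤ n ∸ 1 →
    Connected G → diameter G ≡ D →
    ξc G ≤ f n D × (ξc G ≡ f n D ⇔ InClass n D G)
theorem4 n .(suc (suc (suc k))) G 4≤n (s≤s (s≤s (s≤s {n = k} z≤n))) D≤ conn diam =
  ξ≤f , mk⇔ classify (InClass⇒attains k m n≡ G)
  where
  -- `D ≤ n ∸ 1` makes this subtraction exact.
  m = n ∸ (4 + k)
  n≡ : n ≡ 4 + k + m
  n≡ = sym (m+[n∸m]≡n (≤-trans (s≤s D≤) (≤-reflexive (m+[n∸m]≡n (≤-trans (s≤s z≤n) 4≤n)))))
  open Core k m n≡ G diam
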